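{- Let $\beta\ge5$ and $\epsilon\in\{1,-1\}$. Let $\Lambda_2$ be the quotient of $[4,8,2^\beta]^+$ by the relations $\sigma_2^2\sigma_1=\sigma_1\sigma_2^2$ and $\sigma_3\sigma_2^2=\sigma_2^2\sigma_3^{1+\epsilon2^{\beta-2}}$. Then $\Lambda_2$ is the automorphism group, with standard generators $\sigma_1,\sigma_2,\sigma_3$, of an atomic chiral $4$-polytope of type $\{4,8,2^\beta\}$.
   Context: $[p,q,r]^+=\langle\sigma_1,\sigma_2,\sigma_3\mid\sigma_1^p=\sigma_2^q=\sigma_3^r=(\sigma_1\sigma_2)^2=(\sigma_2\sigma_3)^2=(\sigma_1\sigma_2\sigma_3)^2=1\rangle$. Standard generators of a chiral polytope with base flag $\Phi$: $\Phi\sigma_i=\Phi^{i(i-1)}$, $\Phi^j$ the flag differing from $\Phi$ only in its $j$-face. Tight: type $\{p,q,r\}$ with exactly $2pqr$ flags. A tight chiral $4$-polytope is atomic if it does not properly cover any tight chiral polytope. -}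

module Defs where

open import Level using (0ℓ)
open import Data.Nat.Base as ℕ using (ℕ; zero; suc; _∸_)
open import Data.Integer.Base as ℤ using (ℤ; +_; -[1+_]; 1ℤ)
open import Data.Fin.Base as Fin using (Fin; zero; suc; toℕ; inject₁)
open import Data.Product.Base using (Σ; Σ-syntax; ∃-syntax; _×_; _,_; proj₁; proj₂)
open import Data.Sum.Base using (_⊎_)
open import Data.List.Base using (List; length)
open import Data.List.Relation.Unary.All using (All)
open import Data.List.Relation.Unary.Any using (Any)
open import Data.List.Relation.Unary.AllPairs using (AllPairs)
open import Function.Base using (_∘_; id)
open import Function.Bundles using (Inverse)
open import Relation.Nullary.Negation.Core using (¬_)
open import Relation.Binary.Core using (Rel; _Preserves_⟶_)
open import Relation.Binary.Bundles using (Setoid; Poset)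
open import Relation.Binary.Definitions using (Minimum; Maximum)
open import Relation.Binary.PropositionalEquality.Core as ≡ using (_≡_; _≢_)
import Relation.Binary.PropositionalEquality.Properties as ≡
open import Relation.Binary.Construct.Closure.ReflexiveTransitive using (Star)
import Relation.Binary.Construct.On as On
import Relation.Binary.Construct.NonStrictToStrict as ToStrict
open import Relation.Binary.Morphism.Structures
  using (IsOrderHomomorphism; IsOrderIsomorphism)
import Relation.Binary.Morphism.Construct.Identity as Id
import Relation.Binary.Morphism.Construct.Composition as Comp
open import Algebra.Bundles using (Group)
open import Algebra.Morphism.Structures using (module GroupMorphisms)

------------------------------------------------------------------------
-- Order isomorphisms

record PosetIsomorphism (P Q : Poset 0ℓ 0ℓ 0ℓ) : Set where
  private
    module P = Poset P
    module Q = Poset Q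
  field
    ⟦_⟧                : P.Carrier → Q.Carrier
    isOrderIsomorphism : IsOrderIsomorphism P._≈_ Q._≈_ P._≤_ Q._≤_ ⟦_⟧

  open IsOrderIsomorphism isOrderIsomorphism public

-- The product α ∙ β is "first α, then β": automorphisms act on the right.
AutomorphismGroup : Poset 0ℓ 0ℓ 0ℓ → Group 0ℓ 0ℓ
AutomorphismGroup P = record
  { Carrier = PosetIsomorphism P P
  ; _≈_     = λ α β → ∀ x → ⟦ α ⟧ x ≈ ⟦ β ⟧ x
  ; _∙_     = λ α β → record
      { ⟦_⟧                = ⟦ β ⟧ ∘ ⟦ α ⟧
      ; isOrderIsomorphism =
          Comp.isOrderIsomorphism Eq.trans (isOrderIsomorphism α) (isOrderIsomorphism β)
      }
  ; ε       = record
      { ⟦_⟧                = id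
      ; isOrderIsomorphism = Id.isOrderIsomorphism _≈_ _≤_ Eq.refl
      }
  ; _⁻¹     = inv
  ; isGroup = record
      { isMonoid = record
          { isSemigroup = record
              { isMagma = record
                  { isEquivalence = record
                      { refl  = λ _ → Eq.refl
                      ; sym   = λ p x → Eq.sym (p x)
                      ; trans = λ p q x → Eq.trans (p x) (q x)
                      }
                  ; ∙-cong = λ {_ _ γ} p q x → Eq.trans (cong γ (p x)) (q _)
                  }
              ; assoc = λ _ _ _ _ → Eq.refl
              }
          ; identity = (λ _ _ → Eq.refl) , (λ _ _ → Eq.refl)
          }
      ; inverse = right-inverse , left-inverse
      ; ⁻¹-cong = λ {α β} p x → injective α
          (Eq.trans (right-inverse α x)
            (Eq.trans (Eq.sym (right-inverse β x)) (Eq.sym (p _))))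
      }
  }
  where
  open Poset P
  open PosetIsomorphism

  inv-fun : PosetIsomorphism P P → Carrier → Carrier
  inv-fun α = proj₁ ∘ surjective α

  right-inverse : ∀ α x → ⟦ α ⟧ (inv-fun α x) ≈ x
  right-inverse α x = proj₂ (surjective α x) Eq.refl

  left-inverse : ∀ α x → inv-fun α (⟦ α ⟧ x) ≈ x
  left-inverse α x = injective α (right-inverse α (⟦ α ⟧ x))

  inv-cong : ∀ α {x y} → x ≈ y → inv-fun α x ≈ inv-fun α y
  inv-cong α {x} {y} x≈y = injective α
    (Eq.trans (right-inverse α x) (Eq.trans x≈y (Eq.sym (right-inverse α y))))

  inv : PosetIsomorphism P P → PosetIsomorphism P P
  inv α = record
    { ⟦_⟧                = inv-fun α
    ; isOrderIsomorphism = record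
        { isOrderMonomorphism = record
            { isOrderHomomorphism = record
                { cong = inv-cong α
                ; mono = λ {x} {y} x≤y → cancel α
                    (trans (reflexive (right-inverse α x))
                      (trans x≤y (reflexive (Eq.sym (right-inverse α y)))))
                }
            ; injective = λ {x} {y} p →
                Eq.trans (Eq.sym (right-inverse α x))
                  (Eq.trans (cong α p) (right-inverse α y))
            ; cancel = λ {x} {y} p →
                trans (reflexive (Eq.sym (right-inverse α x)))
                  (trans (mono α p) (reflexive (right-inverse α y)))
            }
        ; surjective = λ y → ⟦ α ⟧ y ,
            λ p → Eq.trans (inv-cong α p) (left-inverse α y)
        }
    }

------------------------------------------------------------------------
-- Abstract polytopes

-- The element k of Fin (2 + n) stands for the rank k - 1, so that the ranks
-- of an n-polytope run through -1, 0, …, n.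
record RankedPoset (n : ℕ) : Set₁ where
  field
    poset : Poset 0ℓ 0ℓ 0ℓ

  open Poset poset public renaming (Carrier to Face)
  open ToStrict _≈_ _≤_ public using (_<_)

  field
    rank      : Face → Fin (2 ℕ.+ n)
    rank-cong : ∀ {F G} → F ≈ G → rank F ≡ rank G
    rank-mono : ∀ {F G} → F < G → rank F Fin.< rank G

  IsMaximalChain : List Face → Set
  IsMaximalChain c =
    AllPairs _<_ c × (∀ H → All (λ G → G ≤ H ⊎ H ≤ G) c → Any (H ≈_) c)

  -- A maximal chain with n + 2 faces has exactly one face of each rank.
  record Flag : Set where
    field
      face      : Fin (2 ℕ.+ n) → Face
      face-rank : ∀ k → rank (face k) ≡ k
      face-mono : face Preserves Fin._≤_ ⟶ _≤_

  open Flag public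

  flagSetoid : Setoid 0ℓ 0ℓ
  flagSetoid = record
    { Carrier       = Flag
    ; _≈_           = λ Φ Ψ → ∀ k → face Φ k ≈ face Ψ k
    ; isEquivalence = record
        { refl  = λ _ → Eq.refl
        ; sym   = λ p k → Eq.sym (p k)
        ; trans = λ p q k → Eq.trans (p k) (q k)
        }
    }

  open Setoid flagSetoid public using () renaming (_≈_ to _≈ᶠ_)

  -- Here j is a genuine rank 0, …, n - 1, hence the shift.
  Adjacent : Fin n → Rel Flag 0ℓ
  Adjacent j Φ Ψ =
    ¬ face Φ (suc (inject₁ j)) ≈ face Ψ (suc (inject₁ j)) ×
    (∀ k → k ≢ suc (inject₁ j) → face Φ k ≈ face Ψ k)

  -- A step between adjacent flags that keeps Φ ∩ Ψ.
  StepWithin : Flag → Flag → Rel Flag 0ℓ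
  StepWithin Φ Ψ Ω Ω′ =
    (∃[ j ] Adjacent j Ω Ω′) ×
    (∀ k → face Φ k ≈ face Ψ k → face Ω′ k ≈ face Φ k)

  section : Face → Face → Poset 0ℓ 0ℓ 0ℓ
  section F G = On.poset {B = Σ[ H ∈ Face ] (F ≤ H × H ≤ G)} poset proj₁

record Polytope (n : ℕ) : Set₁ where
  field
    rankedPoset : RankedPoset n

  open RankedPoset rankedPoset public

  field
    least    : Face
    greatest : Face
    minimum  : Minimum _≤_ least
    maximum  : Maximum _≤_ greatest

    maximal-chain-length : ∀ c → IsMaximalChain c → length c ≡ 2 ℕ.+ n

    strongly-flag-connected : ∀ Φ Ψ →
      ∃[ Ω ] Star (StepWithin Φ Ψ) Φ Ω × Ω ≈ᶠ Ψ

    diamond : ∀ {F G} → F < G → toℕ (rank G) ≡ 2 ℕ.+ toℕ (rank F) →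
      ∃[ H₁ ] ∃[ H₂ ]
        ¬ H₁ ≈ H₂ ×
        (F < H₁ × H₁ < G) × (F < H₂ × H₂ < G) ×
        (∀ H → F < H → H < G → H ≈ H₁ ⊎ H ≈ H₂)

  Aut : Group 0ℓ 0ℓ
  Aut = AutomorphismGroup poset

  -- Maps α Φ Ψ says that Φα = Ψ.
  Maps : Group.Carrier Aut → Rel Flag 0ℓ
  Maps α Φ Ψ = ∀ k → PosetIsomorphism.⟦_⟧ α (face Φ k) ≈ face Ψ k

  SameOrbit : Rel Flag 0ℓ
  SameOrbit Φ Ψ = ∃[ α ] Maps α Φ Ψ

------------------------------------------------------------------------
-- Chirality

IsChiral : ∀ {n} → Polytope n → Set
IsChiral P =
  (∃[ Φ₁ ] ∃[ Φ₂ ] ¬ SameOrbit Φ₁ Φ₂ × (∀ Ψ → SameOrbit Φ₁ Ψ ⊎ SameOrbit Φ₂ Ψ)) ×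
  (∀ j Φ Ψ → Adjacent j Φ Ψ → ¬ SameOrbit Φ Ψ)
  where open Polytope P

------------------------------------------------------------------------
-- Schläfli types and tightness

data Cell (p : ℕ) : Set where
  least greatest : Cell p
  vertex edge    : Fin p → Cell p

-- l ≡ k + 1 modulo p
CyclicSuc : ∀ {p} → Rel (Fin p) 0ℓ
CyclicSuc {p} k l = toℕ l ≡ suc (toℕ k) ⊎ (suc (toℕ k) ≡ p × toℕ l ≡ 0)

data _⊑_ {p : ℕ} : Rel (Cell p) 0ℓ where
  least⊑    : ∀ {x} → least ⊑ x
  ⊑greatest : ∀ {x} → x ⊑ greatest
  vertex⊑   : ∀ {k} → vertex k ⊑ vertex k
  edge⊑     : ∀ {k} → edge k ⊑ edge k
  source    : ∀ {k} → vertex k ⊑ edge k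
  target    : ∀ {k l} → CyclicSuc k l → vertex l ⊑ edge k

polygon : ℕ → Poset 0ℓ 0ℓ 0ℓ
polygon p = record
  { Carrier        = Cell p
  ; _≈_            = _≡_
  ; _≤_            = _⊑_
  ; isPartialOrder = record
      { isPreorder = record
          { isEquivalence = ≡.isEquivalence
          ; reflexive     = λ { ≡.refl → ⊑-refl _ }
          ; trans         = ⊑-trans
          }
      ; antisym = ⊑-antisym
      }
  }
  where
  ⊑-refl : ∀ (x : Cell p) → x ⊑ x
  ⊑-refl least      = least⊑
  ⊑-refl greatest   = ⊑greatest
  ⊑-refl (vertex k) = vertex⊑
  ⊑-refl (edge k)   = edge⊑

  ⊑-trans : ∀ {x y z : Cell p} → x ⊑ y → y ⊑ z → x ⊑ z
  ⊑-trans least⊑     _         = least⊑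
  ⊑-trans ⊑greatest  ⊑greatest = ⊑greatest
  ⊑-trans vertex⊑    y⊑z       = y⊑z
  ⊑-trans edge⊑      y⊑z       = y⊑z
  ⊑-trans source     ⊑greatest = ⊑greatest
  ⊑-trans source     edge⊑     = source
  ⊑-trans (target _) ⊑greatest = ⊑greatest
  ⊑-trans (target c) edge⊑     = target c

  ⊑-antisym : ∀ {x y : Cell p} → x ⊑ y → y ⊑ x → x ≡ y
  ⊑-antisym least⊑    least⊑    = ≡.refl
  ⊑-antisym ⊑greatest ⊑greatest = ≡.refl
  ⊑-antisym vertex⊑   _         = ≡.refl
  ⊑-antisym edge⊑     _         = ≡.refl

-- Each section G/F with rank F = i - 2 and rank G = i + 1 is a p-gon, for
-- i = k + 1; as elements of Fin (2 + n) these ranks are k and k + 3.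
HasPolygonalSections : ∀ {n} → Polytope n → (k p : ℕ) → Set
HasPolygonalSections P k p = ∀ F G → F ≤ G →
  toℕ (rank F) ≡ k → toℕ (rank G) ≡ 3 ℕ.+ k →
  PosetIsomorphism (section F G) (polygon p)
  where open Polytope P

HasType : Polytope 4 → (p q r : ℕ) → Set
HasType P p q r =
  HasPolygonalSections P 0 p × HasPolygonalSections P 1 q × HasPolygonalSections P 2 r

IsTight : Polytope 4 → Set
IsTight P = ∃[ p ] ∃[ q ] ∃[ r ]
  HasType P p q r ×
  Inverse (≡.setoid (Fin (2 ℕ.* p ℕ.* q ℕ.* r))) (Polytope.flagSetoid P)

------------------------------------------------------------------------
-- Coverings and atomicity

record Covering {n} (P Q : Polytope n) : Set where
  private
    module P = Polytope P
    module Q = Polytope Q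
  field
    ⟦_⟧                 : P.Face → Q.Face
    isOrderHomomorphism : IsOrderHomomorphism P._≈_ Q._≈_ P._≤_ Q._≤_ ⟦_⟧
    rank-preserving     : ∀ F → Q.rank (⟦ F ⟧) ≡ P.rank F
    surjective          : ∀ G → ∃[ F ] ⟦ F ⟧ Q.≈ G

  open IsOrderHomomorphism isOrderHomomorphism public using (cong; mono)

  mapFlag : P.Flag → Q.Flag
  mapFlag Φ = record
    { face      = λ k → ⟦ P.face Φ k ⟧
    ; face-rank = λ k → ≡.trans (rank-preserving _) (P.face-rank Φ k)
    ; face-mono = λ k≤l → mono (P.face-mono Φ k≤l)
    }

  field
    adjacency-preserving : ∀ j Φ Ψ →
      P.Adjacent j Φ Ψ → Q.Adjacent j (mapFlag Φ) (mapFlag Ψ)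

ProperlyCovers : ∀ {n} → Polytope n → Polytope n → Set
ProperlyCovers P Q =
  Covering P Q × ¬ PosetIsomorphism (Polytope.poset P) (Polytope.poset Q)

IsAtomic : Polytope 4 → Set₁
IsAtomic P =
  (IsTight P × IsChiral P) ×
  (∀ Q → IsTight Q → IsChiral Q → ¬ ProperlyCovers P Q)

------------------------------------------------------------------------
-- Group presentations

infixl 7 _∙_
infixr 8 _^_ _^ᶻ_
infix  9 _⁻¹

data Term (X : Set) : Set where
  gen : X → Term X
  ε   : Term X
  _∙_ : Term X → Term X → Term X
  _⁻¹ : Term X → Term X

_^_ : ∀ {X} → Term X → ℕ → Term X
t ^ zero  = ε
t ^ suc n = t ∙ t ^ n

_^ᶻ_ : ∀ {X} → Term X → ℤ → Term X
t ^ᶻ (+ n)    = t ^ n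
t ^ᶻ -[1+ n ] = (t ^ suc n) ⁻¹

module _ {X : Set} (_∼_ : Rel (Term X) 0ℓ) where

  data Derivable : Rel (Term X) 0ℓ where
    relation  : ∀ {s t} → s ∼ t → Derivable s t
    refl      : ∀ {t} → Derivable t t
    sym       : ∀ {s t} → Derivable s t → Derivable t s
    trans     : ∀ {s t u} → Derivable s t → Derivable t u → Derivable s u
    ∙-cong    : ∀ {s s′ t t′} → Derivable s s′ → Derivable t t′ →
                Derivable (s ∙ t) (s′ ∙ t′)
    ⁻¹-cong   : ∀ {s t} → Derivable s t → Derivable (s ⁻¹) (t ⁻¹)
    assoc     : ∀ s t u → Derivable ((s ∙ t) ∙ u) (s ∙ (t ∙ u))
    identityˡ : ∀ t → Derivable (ε ∙ t) t
    identityʳ : ∀ t → Derivable (t ∙ ε) t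
    inverseˡ  : ∀ t → Derivable ((t ⁻¹) ∙ t) ε
    inverseʳ  : ∀ t → Derivable (t ∙ (t ⁻¹)) ε

  -- ⟨ X ∣ s = t whenever s ∼ t ⟩
  Presented : Group 0ℓ 0ℓ
  Presented = record
    { Carrier = Term X
    ; _≈_     = Derivable
    ; _∙_     = _∙_
    ; ε       = ε
    ; _⁻¹     = _⁻¹
    ; isGroup = record
        { isMonoid = record
            { isSemigroup = record
                { isMagma = record
                    { isEquivalence = record { refl = refl ; sym = sym ; trans = trans }
                    ; ∙-cong        = ∙-cong
                    }
                ; assoc = assoc
                }
            ; identity = identityˡ , identityʳ
            }
        ; inverse = inverseˡ , inverseʳ
        ; ⁻¹-cong = ⁻¹-cong
        }
    }

σ₁ σ₂ σ₃ : Term (Fin 3)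
σ₁ = gen zero
σ₂ = gen (suc zero)
σ₃ = gen (suc (suc zero))

-- The defining relations of [p,q,r]⁺.
data RotationRelation (p q r : ℕ) : Rel (Term (Fin 3)) 0ℓ where
  σ₁-order     : RotationRelation p q r (σ₁ ^ p) ε
  σ₂-order     : RotationRelation p q r (σ₂ ^ q) ε
  σ₃-order     : RotationRelation p q r (σ₃ ^ r) ε
  σ₁σ₂-order   : RotationRelation p q r ((σ₁ ∙ σ₂) ^ 2) ε
  σ₂σ₃-order   : RotationRelation p q r ((σ₂ ∙ σ₃) ^ 2) ε
  σ₁σ₂σ₃-order : RotationRelation p q r ((σ₁ ∙ σ₂ ∙ σ₃) ^ 2) ε

data Λ₂-Relation (β : ℕ) (e : ℤ) : Rel (Term (Fin 3)) 0ℓ where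
  rotation : ∀ {s t} → RotationRelation 4 8 (2 ℕ.^ β) s t → Λ₂-Relation β e s t
  σ₂²σ₁    : Λ₂-Relation β e (σ₂ ^ 2 ∙ σ₁) (σ₁ ∙ σ₂ ^ 2)
  σ₃σ₂²    : Λ₂-Relation β e
               (σ₃ ∙ σ₂ ^ 2)
               (σ₂ ^ 2 ∙ σ₃ ^ᶻ (1ℤ ℤ.+ e ℤ.* + (2 ℕ.^ (β ∸ 2))))

Λ₂ : ℕ → ℤ → Group 0ℓ 0ℓ
Λ₂ β e = Presented (Λ₂-Relation β e)

------------------------------------------------------------------------
-- Standard generators

-- With i = k + 1, the condition reads Φσᵢ = (Φⁱ)ⁱ⁻¹. By the diamond condition
-- the j-adjacent flag Φʲ exists and is unique up to equality of flags.
AreStandardGenerators : ∀ {m} (P : Polytope (suc m)) → Polytope.Flag P →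
                        (Fin m → Group.Carrier (Polytope.Aut P)) → Set
AreStandardGenerators P Φ s = ∀ k →
  ∃[ Φⁱ ] ∃[ Φσ ]
    Adjacent (suc k) Φ Φⁱ × Adjacent (inject₁ k) Φⁱ Φσ × Maps (s k) Φ Φσ
  where open Polytope P

-- G is the automorphism group of P, with g as its standard generators with
-- respect to some base flag.
IsAutomorphismGroup : ∀ {m} (G : Group 0ℓ 0ℓ) → (Fin m → Group.Carrier G) →
                      Polytope (suc m) → Set
IsAutomorphismGroup G g P =
  ∃[ Φ ] ∃[ f ]
    IsGroupIsomorphism f × AreStandardGenerators P Φ (f ∘ g)
  where
  open Polytope P
  open GroupMorphisms (Group.rawGroup G) (Group.rawGroup Aut)

{-# OPTIONS --safe #-}

-- Write n = 2 ^ β = 32 K. In a tight polytope of this type faces whose ranks differ by at least two are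
-- always incident, so it is determined by the incidences of consecutive ranks. The polytope is explicit: its
-- vertices are the v in ℤ/4, its edges the pairs (s , m) in ℤ/4 × ℤ/4, with vertices s and s + 1, its polygons the
-- pairs (i , j) in ℤ/n × ℤ/4, with facets i and i + 1 + 8 K j in ℤ/n, and the edge (s , m) lies on the polygon
-- (i , j) if and only if j = e s i + m. Residues are represented by integers, and equality of faces is congruence.
--
-- Maps that preserve adjacency of flags are determined by the image of one flag. Hence, up to words in the explicit
-- automorphisms σ₁, σ₂ and σ₃, a nontrivial automorphism would exchange the two vertices of the base flag and fix its
-- other faces; it would turn a walk that ends at the facet 2 + 8 K e into one that ends at 2 - 8 K e, but fix all
-- facets. That the relations of Λ₂ suffice follows from the normal form (σ₂²)ᵃ σ₃ᵇ σ₁ⁱ σ₂ʲ with j ≤ 1.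
--
-- The kernel of a covering of a chiral polytope Q is invariant under σ₁, σ₂ and σ₃. If it is not trivial, it
-- identifies two facets, hence, n being a power of two, facets that differ by n / 2 = 16 K. Modulo 16 K the map
-- (s , m) ↦ (- s , - m), (i , j) ↦ (i , - j) that fixes the facets preserves incidence, and it preserves the kernel;
-- so it induces an automorphism of Q that takes a flag to an adjacent one, which is impossible.

module Submission where

open import Defs hiding (refl; sym; trans; assoc)
open import Data.Nat.Base as ℕ using (ℕ; _≤_; zero; suc; NonZero; z≤n; s≤s)
import Data.Nat.Properties as ℕ
import Data.Nat.DivMod as ℕ
open import Data.Integer.Base as ℤ using (ℤ; +_; -[1+_]; 0ℤ; 1ℤ; -1ℤ; _+_; _*_; _-_; -_)
import Data.Integer.Properties as ℤ
import Data.Integer.DivMod as ℤ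
import Data.Integer.Divisibility.Signed as ℤ using (_∣_)
open import Data.Integer.Divisibility.Signed using (divides; _∣?_)
open import Data.Integer.Tactic.RingSolver using (solve; solve-∀)
open import Data.Bool.Base using (Bool; true; false; not)
open import Data.Fin.Base as Fin using (Fin; zero; suc; toℕ; inject₁; fromℕ<)
import Data.Fin.Properties as Fin
open import Data.List.Base using (List; []; _∷_; length)
open import Data.List.Relation.Unary.All as All using (All)
import Data.List.Relation.Unary.All.Properties as All
open import Data.List.Relation.Unary.Any as Any using (Any; here; there)
open import Data.List.Relation.Unary.AllPairs as AllPairs using (AllPairs)
open import Data.Product.Base using (Σ; Σ-syntax; ∃-syntax; _×_; _,_; proj₁; proj₂)
open import Data.Sum.Base as Sum using (_⊎_; inj₁; inj₂; [_,_]′)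
open import Data.Empty using (⊥; ⊥-elim)
open import Data.Unit.Base using (⊤; tt)
open import Function.Base using (_∘_; id; case_of_)
open import Relation.Nullary.Negation.Core using (¬_; contradiction)
open import Relation.Nullary.Decidable using (Dec; yes; no; map′; _×-dec_)
open import Relation.Binary.Core using (Rel)
open import Relation.Binary.Bundles using (Poset)
open import Relation.Binary.Definitions using (tri<; tri≈; tri>)
open import Relation.Binary.Construct.Closure.ReflexiveTransitive using (Star; _◅_) renaming (ε to nil)
open import Relation.Binary.PropositionalEquality.Core as ≡ using (_≡_; _≢_; refl)
open import Algebra.Bundles using (Group)
open import Level using (0ℓ)

-- Congruences

-- The summand 8 K j in the second facet of a polygon mirrors the last relation: σ₂² multiplies the
-- facets by 1 + 8 K e, and it carries the polygon (0 , j) to (0 , j + e). Around the edge (s , m),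
-- step t therefore advances the facet by 1 + 8 K (e s t + m), so that position t holds the facet t
-- + 8 K (e s t (t - 1) / 2 + m t). The quadratic term separates s from - s, whence the chirality.
-- Modulo 4 it depends on t modulo 8 only, so multiples of 8 K in the argument do not disturb it;
-- this needs K to be an integer, that is β ≥ 5. The obstacle to atomicity is that the reflection is
-- not an automorphism of P, so nothing general makes it preserve the kernel. On each pair of
-- identified faces it is compared with a true automorphism that has the same effect on the pair;
-- for polygons this succeeds only up to a translation by a multiple of 8 K. Moreover, equality of
-- faces of Q is not assumed decidable, so identifications have to be extracted from the diamond
-- condition.

infix 4 _≡[_]_

-- With the quotient as a witness and the equation solved for `a`, matching on `by q refl`
-- eliminates `a` and leaves a polynomial identity to the ring solver.
data _≡[_]_ (a d b : ℤ) : Set where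
  by : ∀ q → a ≡ b + q * d → a ≡[ d ] b

module _ {d : ℤ} where

  ≡⇒≡[] : ∀ {a b} → a ≡ b → a ≡[ d ] b
  ≡⇒≡[] {a} refl = by 0ℤ (solve (a ∷ d ∷ []))

  mod-refl : ∀ {a} → a ≡[ d ] a
  mod-refl = ≡⇒≡[] refl

  mod-sym : ∀ {a b} → a ≡[ d ] b → b ≡[ d ] a
  mod-sym {b = b} (by q refl) = by (- q) (solve (b ∷ q ∷ d ∷ []))

  mod-trans : ∀ {a b c} → a ≡[ d ] b → b ≡[ d ] c → a ≡[ d ] c
  mod-trans {c = c} (by p refl) (by q refl) = by (q + p) (solve (c ∷ p ∷ q ∷ d ∷ []))

  mod-+ : ∀ {a a′ b b′} → a ≡[ d ] a′ → b ≡[ d ] b′ → a + b ≡[ d ] a′ + b′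
  mod-+ {_} {a′} {_} {b′} (by p refl) (by q refl) =
    by (p + q) (solve (a′ ∷ b′ ∷ p ∷ q ∷ d ∷ []))

  mod-neg : ∀ {a a′} → a ≡[ d ] a′ → - a ≡[ d ] - a′
  mod-neg {_} {a′} (by p refl) = by (- p) (solve (a′ ∷ p ∷ d ∷ []))

  mod-*ˡ : ∀ x {a a′} → a ≡[ d ] a′ → x * a ≡[ d ] x * a′
  mod-*ˡ x {_} {a′} (by p refl) = by (x * p) (solve (x ∷ a′ ∷ p ∷ d ∷ []))

  mod-dec : ∀ a b → Dec (a ≡[ d ] b)
  mod-dec a b = map′ from to (d ∣? (a - b))
    where
    from : d ℤ.∣ (a - b) → a ≡[ d ] b
    from (divides q eq) = by q (≡.trans (split a b) (≡.cong (λ x → b + x) eq))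
      where
      split : ∀ a b → a ≡ b + (a - b)
      split = solve-∀

    to : a ≡[ d ] b → d ℤ.∣ (a - b)
    to (by q refl) = divides q (solve (b ∷ q ∷ d ∷ []))

  mod-divisor : ∀ f {a b} → a ≡[ f * d ] b → a ≡[ d ] b
  mod-divisor f {b = b} (by q refl) = by (q * f) (solve (b ∷ q ∷ f ∷ d ∷ []))

1≢4x : ∀ {x} → 1ℤ ≢ x * + 4
1≢4x {x} eq = go ℤ.∣ x ∣ (≡.trans (≡.cong ℤ.∣_∣ eq) (ℤ.abs-* x (+ 4)))
  where
  go : ∀ m → 1 ≢ m ℕ.* 4
  go zero    ()
  go (suc m) ()

1≢2x : ∀ {x} → 1ℤ ≢ x * + 2
1≢2x {x} eq = go ℤ.∣ x ∣ (≡.trans (≡.cong ℤ.∣_∣ eq) (ℤ.abs-* x (+ 2)))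
  where
  go : ∀ m → 1 ≢ m ℕ.* 2
  go zero    ()
  go (suc m) ()

remainder : ∀ j x → j ≡ x + (j - x)
remainder = solve-∀

cancel-summand : ∀ x m → m ≡ x + m - x
cancel-summand = solve-∀

predecessor : ∀ v → v ≡ v - 1ℤ + 1ℤ
predecessor = solve-∀

successor : ∀ s → s ≡ s + 1ℤ - 1ℤ
successor = solve-∀

+-exchange : ∀ v a b → v + b + a ≡ v + (a + b)
+-exchange = solve-∀

-- Parity, induction and triangular numbers of integers

data Parity : ℤ → Set where
  even : ∀ q → Parity (q * + 2)
  odd  : ∀ q → Parity (1ℤ + q * + 2)

parity : ∀ a → Parity a
parity a with a ℤ.%ℕ 2 | ℤ.n%ℕd<d a 2 | ℤ.a≡a%ℕn+[a/ℕn]*n a 2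
... | 0 | _ | eq = ≡.subst Parity (≡.sym (≡.trans eq (ℤ.+-identityˡ _))) (even (a ℤ./ℕ 2))
... | 1 | _ | eq = ≡.subst Parity (≡.sym eq) (odd (a ℤ./ℕ 2))
... | suc (suc _) | s≤s (s≤s ()) | _

ℤ-induction : (P : ℤ → Set) → P 0ℤ → (∀ z → P z → P (z + 1ℤ)) → (∀ z → P (z + 1ℤ) → P z) → ∀ z → P z
ℤ-induction P base up down = go
  where
  go : ∀ z → P z
  go (+ zero)        = base
  go (+ suc n)       = ≡.subst P (≡.cong +_ (ℕ.+-comm n 1)) (up (+ n) (go (+ n)))
  go -[1+ zero ]     = down -[1+ zero ] base
  go -[1+ suc n ]    = down -[1+ suc n ] (go -[1+ n ])

-- The binomial coefficient c (c - 1) / 2. The recursion avoids division: identities are proved for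
-- `+ 2 * T c` by `2T` and then halved.
T : ℤ → ℤ
T (+ zero)     = 0ℤ
T (+ suc n)    = T (+ n) + + n
T -[1+ zero ]  = 1ℤ
T -[1+ suc n ] = T -[1+ n ] + + suc (suc n)

2T : ∀ c → + 2 * T c ≡ c * (c - 1ℤ)
2T (+ zero)     = refl
2T (+ suc n)    = ≡.trans (step (T (+ n)) (+ n)) (≡.trans (≡.cong (_+ + 2 * + n) (2T (+ n))) (close (+ n)))
  where
  step : ∀ t c → + 2 * (t + c) ≡ + 2 * t + + 2 * c
  step = solve-∀
  close : ∀ c → c * (c - 1ℤ) + + 2 * c ≡ (1ℤ + c) * (1ℤ + c - 1ℤ)
  close = solve-∀
2T -[1+ zero ]  = refl
2T -[1+ suc n ] = ≡.trans (step (T -[1+ n ]) (+ n)) (≡.trans (≡.cong (_+ + 2 * (+ 2 + + n)) (2T -[1+ n ])) (close (+ n)))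
  where
  step : ∀ t c → + 2 * (t + (+ 2 + c)) ≡ + 2 * t + + 2 * (+ 2 + c)
  step = solve-∀
  close : ∀ c → - (1ℤ + c) * (- (1ℤ + c) - 1ℤ) + + 2 * (+ 2 + c) ≡ - (+ 2 + c) * (- (+ 2 + c) - 1ℤ)
  close = solve-∀

halve : ∀ {a b} → + 2 * a ≡ + 2 * b → a ≡ b
halve = ℤ.*-cancelˡ-≡ (+ 2) _ _

T-+ : ∀ c d → T (c + d) ≡ T c + T d + c * d
T-+ c d = halve (≡.trans (2T (c + d)) (≡.trans (expand c d)
  (≡.trans (≡.cong₂ (λ x y → x + y + + 2 * (c * d)) (≡.sym (2T c)) (≡.sym (2T d))) (collect (T c) (T d) c d))))
  where
  expand : ∀ c d → (c + d) * (c + d - 1ℤ) ≡ c * (c - 1ℤ) + d * (d - 1ℤ) + + 2 * (c * d)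
  expand = solve-∀
  collect : ∀ s t c d → + 2 * s + + 2 * t + + 2 * (c * d) ≡ + 2 * (s + t + c * d)
  collect = solve-∀

T-suc : ∀ c → T (c + 1ℤ) ≡ T c + c
T-suc c = ≡.trans (T-+ c 1ℤ) (simp (T c) c)
  where
  simp : ∀ t c → t + 0ℤ + c * 1ℤ ≡ t + c
  simp = solve-∀

T-neg : ∀ c → T (- c) ≡ T c + c
T-neg c = halve (≡.trans (2T (- c)) (≡.trans (expand c) (≡.trans (≡.cong (_+ + 2 * c) (≡.sym (2T c))) (collect (T c) c))))
  where
  expand : ∀ c → - c * (- c - 1ℤ) ≡ c * (c - 1ℤ) + + 2 * c
  expand = solve-∀
  collect : ∀ t c → + 2 * t + + 2 * c ≡ + 2 * (t + c)
  collect = solve-∀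

-- The cross term of `T-+` is 8 c t, and T (8 t) is 4 t (8 t - 1). Modulo 4 the period of `T` is 8
-- and not 4, which is why facets are compared modulo 8.
T-8 : ∀ c t → T (c + + 8 * t) ≡ T c + + 4 * (t * (+ 8 * t - 1ℤ) + + 2 * (c * t))
T-8 c t = ≡.trans (T-+ c (+ 8 * t)) (≡.trans (≡.cong (λ x → T c + x + c * (+ 8 * t)) T8t) (collect (T c) c t))
  where
  expand : ∀ t → + 8 * t * (+ 8 * t - 1ℤ) ≡ + 2 * (+ 4 * (t * (+ 8 * t - 1ℤ)))
  expand = solve-∀
  T8t : T (+ 8 * t) ≡ + 4 * (t * (+ 8 * t - 1ℤ))
  T8t = halve (≡.trans (2T (+ 8 * t)) (expand t))
  collect : ∀ s c t → s + + 4 * (t * (+ 8 * t - 1ℤ)) + c * (+ 8 * t) ≡ s + + 4 * (t * (+ 8 * t - 1ℤ) + + 2 * (c * t))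
  collect = solve-∀

-- Residues modulo n as elements of `Fin n`

module Residue (n : ℕ) .{{_ : NonZero n}} where

  residue : ℤ → Fin n
  residue a = fromℕ< (ℤ.n%ℕd<d a n)

  toℕ-residue : ∀ a → + toℕ (residue a) ≡[ + n ] a
  toℕ-residue a = mod-sym (by (a ℤ./ℕ n) (≡.trans (ℤ.a≡a%ℕn+[a/ℕn]*n a n)
    (≡.cong (λ x → + x + (a ℤ./ℕ n) * + n) (≡.sym (Fin.toℕ-fromℕ< _)))))

  small : ∀ {x y} → x ℕ.< n → y ℕ.< n → ∀ q → + x ≡ + y + + q * + n → x ≡ y
  small {x} {y} x<n y<n q eq = ≡.trans (≡.sym (ℕ.m<n⇒m%n≡m x<n))
    (≡.trans (≡.cong (ℕ._% n) x≡) (≡.trans (ℕ.[m+kn]%n≡m%n y q n) (ℕ.m<n⇒m%n≡m y<n)))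
    where
    x≡ : x ≡ y ℕ.+ q ℕ.* n
    x≡ = ℤ.+-injective (≡.trans eq (≡.sym (≡.trans (ℤ.pos-+ y (q ℕ.* n)) (≡.cong (λ x → + y + x) (ℤ.pos-* q n)))))

  residue-unique : ∀ {x y} → x ℕ.< n → y ℕ.< n → + x ≡[ + n ] + y → x ≡ y
  residue-unique x<n y<n (by (+ q) eq) = small x<n y<n q eq
  residue-unique {x} {y} x<n y<n (by -[1+ q ] eq) = ≡.sym (small y<n x<n (suc q) (move (+ x) (+ y) (+ suc q) (+ n) eq))
    where
    cancel : ∀ y q n → y ≡ y + - q * n + q * n
    cancel = solve-∀
    move : ∀ x y q n → x ≡ y + - q * n → y ≡ x + q * n
    move x y q n refl = cancel y q n

  residue-cong : ∀ {a b} → a ≡[ + n ] b → residue a ≡ residue b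
  residue-cong {a} {b} a≡b = Fin.toℕ-injective (residue-unique (Fin.toℕ<n _) (Fin.toℕ<n _)
    (mod-trans (toℕ-residue a) (mod-trans a≡b (mod-sym (toℕ-residue b)))))

  residue-injective : ∀ {a b} → residue a ≡ residue b → a ≡[ + n ] b
  residue-injective {a} {b} eq = mod-trans (mod-sym (toℕ-residue a))
    (mod-trans (≡⇒≡[] (≡.cong (λ k → + toℕ k) eq)) (toℕ-residue b))

  residue-toℕ : ∀ k → residue (+ toℕ k) ≡ k
  residue-toℕ k = Fin.toℕ-injective (residue-unique (Fin.toℕ<n _) (Fin.toℕ<n k) (toℕ-residue (+ toℕ k)))

  -- Below the last residue the successor is the next number; after the last one it wraps around to
  -- 0. These are the two alternatives of `CyclicSuc`.
  cyclicSuc⁺ : ∀ {a b} → b ≡[ + n ] a + 1ℤ → CyclicSuc (residue a) (residue b)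
  cyclicSuc⁺ {a} {b} b≡a+1 with ℕ.m≤n⇒m<n∨m≡n (Fin.toℕ<n (residue a))
  ... | inj₁ lt = inj₁ (residue-unique (Fin.toℕ<n _) lt succ)
    where
    succ : + toℕ (residue b) ≡[ + n ] + suc (toℕ (residue a))
    succ = mod-trans (toℕ-residue b) (mod-trans b≡a+1 (mod-trans (mod-+ (mod-sym (toℕ-residue a)) mod-refl)
      (≡⇒≡[] (ℤ.+-comm (+ toℕ (residue a)) 1ℤ))))
  ... | inj₂ eq = inj₂ (eq , residue-unique (Fin.toℕ<n _) (ℕ.>-nonZero⁻¹ n) zero′)
    where
    wrap : + suc (toℕ (residue a)) ≡[ + n ] 0ℤ
    wrap = by 1ℤ (≡.trans (≡.cong +_ eq) (≡.sym (≡.trans (ℤ.+-identityˡ _) (ℤ.*-identityˡ (+ n)))))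
    zero′ : + toℕ (residue b) ≡[ + n ] 0ℤ
    zero′ = mod-trans (toℕ-residue b) (mod-trans b≡a+1 (mod-trans (mod-+ (mod-sym (toℕ-residue a)) mod-refl)
      (mod-trans (≡⇒≡[] (ℤ.+-comm (+ toℕ (residue a)) 1ℤ)) wrap)))

  cyclicSuc⁻ : ∀ {a b} → CyclicSuc (residue a) (residue b) → b ≡[ + n ] a + 1ℤ
  cyclicSuc⁻ {a} {b} suc? = mod-trans (mod-sym (toℕ-residue b)) (mod-trans (step suc?)
    (mod-trans (≡⇒≡[] (ℤ.+-comm 1ℤ (+ toℕ (residue a)))) (mod-+ (toℕ-residue a) mod-refl)))
    where
    step : CyclicSuc (residue a) (residue b) → + toℕ (residue b) ≡[ + n ] + suc (toℕ (residue a))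
    step (inj₁ eq) = ≡⇒≡[] (≡.cong +_ eq)
    step (inj₂ (eq , eq₀)) = by -1ℤ (≡.trans (≡.cong +_ eq₀) (≡.sym (≡.trans
      (≡.cong (λ x → + x + -1ℤ * + n) eq) (cancel (+ n)))))
      where
      cancel : ∀ x → x + -1ℤ * x ≡ 0ℤ
      cancel = solve-∀

pos-2* : ∀ m → + (2 ℕ.* m) ≡ + 2 * + m
pos-2* m = ℤ.pos-* 2 m

-- Every nontrivial subgroup of ℤ / 2ᵐ⁺¹ contains the element 2ᵐ of order two.
multiple-of-order-two : ∀ m d → ¬ d ≡[ + (2 ℕ.^ suc m) ] 0ℤ → ∃[ q ] q * d ≡[ + (2 ℕ.^ suc m) ] + (2 ℕ.^ m)
multiple-of-order-two m d d≢0 with parity d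
-- For odd d = 1 + 2 q the multiplier is 2ᵐ itself: 2ᵐ d = 2ᵐ + q 2ᵐ⁺¹.
multiple-of-order-two m _ d≢0 | odd q = + (2 ℕ.^ m) , by q (≡.trans (expand (+ (2 ℕ.^ m)) q)
    (≡.cong (λ x → + (2 ℕ.^ m) + q * x) (≡.sym (pos-2* (2 ℕ.^ m)))))
    where
    expand : ∀ h q → h * (1ℤ + q * + 2) ≡ h + q * (+ 2 * h)
    expand = solve-∀
multiple-of-order-two zero    _ d≢0 | even q = contradiction (by q (≡.sym (ℤ.+-identityˡ _))) d≢0
multiple-of-order-two (suc m) _ d≢0 | even f = double (multiple-of-order-two m f f≢0)
    where
    double-eq : ∀ x h r p → x ≡ h + r * p → x * + 2 ≡ + 2 * h + r * (+ 2 * p)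
    double-eq _ h r p refl = solve (h ∷ r ∷ p ∷ [])
    f≢0 : ¬ f ≡[ + (2 ℕ.^ suc m) ] 0ℤ
    f≢0 (by r eq) = d≢0 (by r (≡.trans (double-eq f 0ℤ r (+ (2 ℕ.^ suc m)) eq)
      (≡.cong (λ x → 0ℤ + r * x) (≡.sym (pos-2* (2 ℕ.^ suc m))))))
    double : ∃[ q ] q * f ≡[ + (2 ℕ.^ suc m) ] + (2 ℕ.^ m) →
             ∃[ q ] q * (f * + 2) ≡[ + (2 ℕ.^ suc (suc m)) ] + (2 ℕ.^ suc m)
    double (q , by r eq) = q , by r (≡.trans (≡.sym (ℤ.*-assoc q f (+ 2)))
      (≡.trans (double-eq (q * f) (+ (2 ℕ.^ m)) r (+ (2 ℕ.^ suc m)) eq)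
        (≡.cong₂ (λ x y → x + r * y) (≡.sym (pos-2* (2 ℕ.^ m))) (≡.sym (pos-2* (2 ℕ.^ suc m))))))

-- Flags and sections of polytopes

lower middle upper : ∀ {n} → Fin n → Fin (2 ℕ.+ n)
lower j  = inject₁ (inject₁ j)
middle j = suc (inject₁ j)
upper j  = suc (suc j)

toℕ-lower : ∀ {n} (j : Fin n) → toℕ (lower j) ≡ toℕ j
toℕ-lower j = ≡.trans (Fin.toℕ-inject₁ (inject₁ j)) (Fin.toℕ-inject₁ j)

toℕ-middle : ∀ {n} (j : Fin n) → toℕ (middle j) ≡ suc (toℕ j)
toℕ-middle j = ≡.cong suc (Fin.toℕ-inject₁ j)

lower<middle : ∀ {n} (j : Fin n) → lower j Fin.< middle j
lower<middle j = ℕ.≤-reflexive (≡.trans (≡.cong suc (toℕ-lower j)) (≡.sym (toℕ-middle j)))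

middle<upper : ∀ {n} (j : Fin n) → middle j Fin.< upper j
middle<upper j = ℕ.≤-reflexive (≡.cong suc (toℕ-middle j))

lower≢middle : ∀ {n} (j : Fin n) → lower j ≢ middle j
lower≢middle j eq = ℕ.<⇒≢ (lower<middle j) (≡.cong toℕ eq)

upper≢middle : ∀ {n} (j : Fin n) → upper j ≢ middle j
upper≢middle j eq = ℕ.<⇒≢ (middle<upper j) (≡.cong toℕ (≡.sym eq))

-- Along a flag the ranks of the images under an automorphism increase strictly, and there are no
-- more ranks than faces in a flag; this is how automorphisms are seen to preserve ranks.
strictly-monotone⇒id : ∀ {m} (f : Fin (suc m) → Fin (suc m)) →
  (∀ {k l} → k Fin.< l → f k Fin.< f l) → ∀ k → f k ≡ k
strictly-monotone⇒id {m} f f-mono k = Fin.toℕ-injective (ℕ.≤-antisym (below k) above)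
  where
  below : ∀ k → toℕ (f k) ℕ.≤ toℕ k
  from : ∀ d k → toℕ k ℕ.+ d ≡ m → toℕ (f k) ℕ.+ d ℕ.≤ m
  from zero    k eq = ℕ.≤-trans (ℕ.≤-reflexive (ℕ.+-identityʳ _)) (ℕ.≤-pred (Fin.toℕ<n (f k)))
  from (suc d) k eq = ℕ.≤-trans
    (ℕ.≤-trans (ℕ.≤-reflexive (ℕ.+-suc _ d)) (ℕ.+-monoˡ-≤ d (f-mono k<k⁺)))
    (from d k⁺ (≡.trans (≡.cong (ℕ._+ d) toℕ-k⁺) (≡.trans (≡.sym (ℕ.+-suc (toℕ k) d)) eq)))
    where
    bound : suc (toℕ k) ℕ.< suc m
    bound = s≤s (ℕ.≤-trans (ℕ.m≤m+n (suc (toℕ k)) d)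
      (ℕ.≤-reflexive (≡.trans (≡.sym (ℕ.+-suc (toℕ k) d)) eq)))
    k⁺ : Fin (suc m)
    k⁺ = fromℕ< bound
    toℕ-k⁺ : toℕ k⁺ ≡ suc (toℕ k)
    toℕ-k⁺ = Fin.toℕ-fromℕ< bound
    k<k⁺ : k Fin.< k⁺
    k<k⁺ = ℕ.≤-reflexive (≡.sym toℕ-k⁺)
  below k = ℕ.+-cancelʳ-≤ (m ℕ.∸ toℕ k) _ _ (ℕ.≤-trans (from (m ℕ.∸ toℕ k) k sum) (ℕ.≤-reflexive (≡.sym sum)))
    where
    sum : toℕ k ℕ.+ (m ℕ.∸ toℕ k) ≡ m
    sum = ℕ.m+[n∸m]≡n (ℕ.≤-pred (Fin.toℕ<n k))
  aboveℕ : ∀ t (k : Fin (suc m)) → toℕ k ≡ t → t ℕ.≤ toℕ (f k)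
  aboveℕ zero    k       eq = z≤n
  aboveℕ (suc t) (suc k) eq = ℕ.≤-trans (s≤s (aboveℕ t (inject₁ k) (≡.trans (Fin.toℕ-inject₁ k) (ℕ.suc-injective eq))))
    (f-mono (ℕ.≤-reflexive (≡.cong suc (Fin.toℕ-inject₁ k))))
  above : toℕ k ℕ.≤ toℕ (f k)
  above = aboveℕ _ k refl

-- Walks through flags and lengths of chains

module FlagPaths {n : ℕ} (R : RankedPoset n) where
  open RankedPoset R hiding (refl) renaming (_≤_ to _≼_; _<_ to _≺_)

  ≺-respˡ : ∀ {F F′ G} → F ≈ F′ → F ≺ G → F′ ≺ G
  ≺-respˡ p (F≤G , F≉G) = trans (reflexive (Eq.sym p)) F≤G , λ q → F≉G (Eq.trans p q)

  ≺-respʳ : ∀ {F G G′} → G ≈ G′ → F ≺ G → F ≺ G′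
  ≺-respʳ p (F≤G , F≉G) = trans F≤G (reflexive p) , λ q → F≉G (Eq.trans q (Eq.sym p))

  ≼∧rank<⇒≺ : ∀ {F G} → F ≼ G → toℕ (rank F) ℕ.< toℕ (rank G) → F ≺ G
  ≼∧rank<⇒≺ F≤G lt = F≤G , λ F≈G → ℕ.<⇒≢ lt (≡.cong toℕ (rank-cong F≈G))

  flag-≺ : ∀ Φ {k l} → k Fin.< l → face Φ k ≺ face Φ l
  flag-≺ Φ {k} {l} k<l = ≼∧rank<⇒≺ (face-mono Φ (ℕ.<⇒≤ k<l))
    (≡.subst₂ (λ x y → toℕ x ℕ.< toℕ y) (≡.sym (face-rank Φ k)) (≡.sym (face-rank Φ l)) k<l)

  adjacent-respˡ : ∀ {j} Φ Φ′ Ψ → Φ ≈ᶠ Φ′ → Adjacent j Φ Ψ → Adjacent j Φ′ Ψ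
  adjacent-respˡ _ _ _ p (≉ , same) = (λ q → ≉ (Eq.trans (p _) q)) , λ k k≢ → Eq.trans (Eq.sym (p k)) (same k k≢)

  adjacent-sym : ∀ {j} Φ Ψ → Adjacent j Φ Ψ → Adjacent j Ψ Φ
  adjacent-sym _ _ (≉ , same) = (λ q → ≉ (Eq.sym q)) , λ k k≢ → Eq.sym (same k k≢)

  -- `StepWithin` refers to the common faces of two fixed flags. Restricting only the ranks of the
  -- steps gives walks that can be concatenated and reversed.
  data Path (J : Fin n → Set) : Rel Flag 0ℓ where
    done : ∀ {Φ Ψ} → Φ ≈ᶠ Ψ → Path J Φ Ψ
    step : ∀ {Φ Ω Ψ} j → J j → Adjacent j Φ Ω → Path J Ω Ψ → Path J Φ Ψ

  module _ {J : Fin n → Set} where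

    path-refl : ∀ {Φ} → Path J Φ Φ
    path-refl = done λ _ → Eq.refl

    path-respˡ : ∀ {Φ Φ′ Ψ} → Φ ≈ᶠ Φ′ → Path J Φ Ψ → Path J Φ′ Ψ
    path-respˡ p (done q)           = done λ k → Eq.trans (Eq.sym (p k)) (q k)
    path-respˡ {Φ} {Φ′} p (step {Ω = Ω} j Jj adj ps) = step j Jj (adjacent-respˡ Φ Φ′ Ω p adj) ps

    path-trans : ∀ {Φ Ψ Ω} → Path J Φ Ψ → Path J Ψ Ω → Path J Φ Ω
    path-trans (done p)           qs = path-respˡ (λ k → Eq.sym (p k)) qs
    path-trans (step j Jj adj ps) qs = step j Jj adj (path-trans ps qs)

    path-sym : ∀ {Φ Ψ} → Path J Φ Ψ → Path J Ψ Φ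
    path-sym (done p) = done λ k → Eq.sym (p k)
    path-sym {Φ} (step {Ω = Ω} j Jj adj ps) =
      path-trans (path-sym ps) (step j Jj (adjacent-sym Φ Ω adj) path-refl)

    -- A walk around a polygon is indexed by all integers; since its steps can be reversed, its
    -- period never has to be counted.
    path-ℤ : (Φ : ℤ → Flag) → (∀ z → Path J (Φ z) (Φ (z + 1ℤ))) → ∀ z → Path J (Φ 0ℤ) (Φ z)
    path-ℤ Φ next = ℤ-induction (λ z → Path J (Φ 0ℤ) (Φ z)) path-refl
      (λ z ps → path-trans ps (next z)) (λ z ps → path-trans ps (path-sym (next z)))

  -- A step of rank j changes only the face of rank j, where the two flags differ anyway; so no
  -- common face is ever lost.
  path⇒star : ∀ {Φ Ψ} → Path (λ j → ¬ face Φ (middle j) ≈ face Ψ (middle j)) Φ Ψ →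
              ∃[ Ω ] Star (StepWithin Φ Ψ) Φ Ω × Ω ≈ᶠ Ψ
  path⇒star {Φ} {Ψ} = go {Φ} (λ _ _ → Eq.refl)
    where
    go : ∀ {Ω} → (∀ k → face Φ k ≈ face Ψ k → face Ω k ≈ face Φ k) →
         Path (λ j → ¬ face Φ (middle j) ≈ face Ψ (middle j)) Ω Ψ → ∃[ Ω′ ] Star (StepWithin Φ Ψ) Ω Ω′ × Ω′ ≈ᶠ Ψ
    go {Ω} keeps (done p) = Ω , nil , p
    go {Ω} keeps (step {Ω = Ω₁} j Jj adj ps) with go {Ω₁} keeps₁ ps
      where
      keeps₁ : ∀ k → face Φ k ≈ face Ψ k → face Ω₁ k ≈ face Φ k
      keeps₁ k same with k Fin.≟ middle j
      ... | yes refl = contradiction same Jj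
      ... | no k≢    = Eq.trans (Eq.sym (proj₂ adj k k≢)) (keeps k same)
    ... | Ω′ , steps , Ω′≈Ψ = Ω′ , ((j , adj) , (λ k same → keeps₂ k same)) ◅ steps , Ω′≈Ψ
      where
      keeps₂ : ∀ k → face Φ k ≈ face Ψ k → face Ω₁ k ≈ face Φ k
      keeps₂ k same with k Fin.≟ middle j
      ... | yes refl = contradiction same Jj
      ... | no k≢    = Eq.trans (Eq.sym (proj₂ adj k k≢)) (keeps k same)

  -- Induction on the number d of the ranks a, ..., a + d - 1. The head has rank a: otherwise a face
  -- of rank a would come later in the chain and so lie strictly above the head.
  chain-length : ∀ d a (c : List Face) → AllPairs _≺_ c →
    All (λ F → a ℕ.≤ toℕ (rank F)) c → All (λ F → toℕ (rank F) ℕ.< a ℕ.+ d) c →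
    (∀ k → a ℕ.≤ k → k ℕ.< a ℕ.+ d → Any (λ F → toℕ (rank F) ≡ k) c) → length c ≡ d
  chain-length zero    a []      _ _ _ _ = refl
  chain-length zero    a (F ∷ c) _ (a≤F All.∷ _) (F<a All.∷ _) _ =
    contradiction (ℕ.<-≤-trans F<a (ℕ.≤-trans (ℕ.≤-reflexive (ℕ.+-identityʳ a)) a≤F)) (ℕ.<-irrefl refl)
  chain-length (suc d) a []      _ _ _ meets = case meets a ℕ.≤-refl (ℕ.m<m+n a (s≤s z≤n)) of λ ()
  chain-length (suc d) a (F ∷ c) (F<c AllPairs.∷ chain) (a≤F All.∷ _) (_ All.∷ c<) meets =
    ≡.cong suc (chain-length d (suc a) c chain
      (All.map (λ F<G → ≡.subst (ℕ._< _) F≡a (rank-mono F<G)) F<c)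
      (All.map (λ {G} lt → ≡.subst (toℕ (rank G) ℕ.<_) (ℕ.+-suc a d) lt) c<)
      λ k a<k k< → case meets k (ℕ.<⇒≤ a<k) (≡.subst (k ℕ.<_) (≡.sym (ℕ.+-suc a d)) k<) of λ where
        (here F≡k)  → contradiction (≡.trans (≡.sym F≡a) F≡k) (ℕ.<⇒≢ a<k)
        (there k∈c) → k∈c)
    where
    late : ∀ {c} → All (F ≺_) c → Any (λ G → toℕ (rank G) ≡ a) c → ⊥
    late (F<G All.∷ _) (here G≡a) = ℕ.<-irrefl refl (ℕ.<-≤-trans (≡.subst (toℕ (rank F) ℕ.<_) G≡a (rank-mono F<G)) a≤F)
    late (_ All.∷ F<c) (there p)  = late F<c p
    F≡a : toℕ (rank F) ≡ a
    F≡a = case meets a ℕ.≤-refl (ℕ.m<m+n a (s≤s z≤n)) of λ where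
      (here eq) → eq
      (there p) → ⊥-elim (late F<c p)

-- Consequences of the diamond condition and of chirality

module PolytopeProperties {n : ℕ} (P : Polytope n) where
  open Polytope P hiding (refl) renaming (_≤_ to _≼_; _<_ to _≺_)
  open FlagPaths rankedPoset public

  _covers-twice_ : Rel Face 0ℓ
  G covers-twice F = F ≺ G × toℕ (rank G) ≡ 2 ℕ.+ toℕ (rank F)

  -- The diamond condition only provides some two faces; the distinct faces A and B must be these
  -- two.
  between : ∀ {F G} → G covers-twice F → ∀ {A B C} → ¬ A ≈ B →
    F ≺ A × A ≺ G → F ≺ B × B ≺ G → F ≺ C × C ≺ G → C ≈ A ⊎ C ≈ B
  between (F<G , eq) A≉B (FA , AG) (FB , BG) (FC , CG) with diamond F<G eq
  ... | H₁ , H₂ , _ , _ , _ , only with only _ FA AG | only _ FB BG | only _ FC CG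
  ... | inj₁ a | inj₁ b | _      = contradiction (Eq.trans a (Eq.sym b)) A≉B
  ... | inj₂ a | inj₂ b | _      = contradiction (Eq.trans a (Eq.sym b)) A≉B
  ... | inj₁ a | inj₂ b | inj₁ c = inj₁ (Eq.trans c (Eq.sym a))
  ... | inj₁ a | inj₂ b | inj₂ c = inj₂ (Eq.trans c (Eq.sym b))
  ... | inj₂ a | inj₁ b | inj₁ c = inj₂ (Eq.trans c (Eq.sym b))
  ... | inj₂ a | inj₁ b | inj₂ c = inj₁ (Eq.trans c (Eq.sym a))

  adjacent-unique : ∀ Φ Φ′ Ψ Ψ′ j → Φ ≈ᶠ Φ′ → Adjacent j Φ Ψ → Adjacent j Φ′ Ψ′ → Ψ ≈ᶠ Ψ′
  adjacent-unique Φ Φ′ Ψ Ψ′ j p (Φ≉Ψ , same) (Φ′≉Ψ′ , same′) l with l Fin.≟ middle j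
  ... | no l≢    = Eq.trans (Eq.sym (same l l≢)) (Eq.trans (p l) (same′ l l≢))
  ... | yes refl with between (flag-≺ Φ (ℕ.<-trans (lower<middle j) (middle<upper j)) , ranks) Φ≉Ψ
                        (flag-≺ Φ (lower<middle j) , flag-≺ Φ (middle<upper j))
                        ( ≺-respˡ (Eq.sym (same _ (lower≢middle j))) (flag-≺ Ψ (lower<middle j))
                        , ≺-respʳ (Eq.sym (same _ (upper≢middle j))) (flag-≺ Ψ (middle<upper j)))
                        ( ≺-respˡ (moved (lower≢middle j)) (flag-≺ Ψ′ (lower<middle j))
                        , ≺-respʳ (moved (upper≢middle j)) (flag-≺ Ψ′ (middle<upper j)))
    where
    ranks : toℕ (rank (face Φ (upper j))) ≡ 2 ℕ.+ toℕ (rank (face Φ (lower j)))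
    ranks = ≡.trans (≡.cong toℕ (face-rank Φ _))
      (≡.cong (2 ℕ.+_) (≡.sym (≡.trans (≡.cong toℕ (face-rank Φ _)) (toℕ-lower j))))
    moved : ∀ {l} → l ≢ middle j → face Ψ′ l ≈ face Φ l
    moved l≢ = Eq.trans (Eq.sym (same′ _ l≢)) (Eq.sym (p _))
  ...   | inj₁ Ψ′≈Φ = contradiction (Eq.trans (Eq.sym (p _)) (Eq.sym Ψ′≈Φ)) Φ′≉Ψ′
  ...   | inj₂ Ψ′≈Ψ = Eq.sym Ψ′≈Ψ

  connected : ∀ Φ Ψ → Path (λ _ → ⊤) Φ Ψ
  connected Φ Ψ with strongly-flag-connected Φ Ψ
  ... | Ω , steps , Ω≈Ψ = go steps
    where
    go : ∀ {Ω₁} → Star (StepWithin Φ Ψ) Ω₁ Ω → Path (λ _ → ⊤) Ω₁ Ψ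
    go nil                       = done Ω≈Ψ
    go (((j , adj) , _) ◅ steps) = step j tt adj (go steps)

  sameOrbit-sym : ∀ Φ Ψ → SameOrbit Φ Ψ → SameOrbit Ψ Φ
  sameOrbit-sym Φ Ψ (α , maps) = α Aut.⁻¹ , λ k →
    PosetIsomorphism.injective α (Eq.trans (Aut.inverseˡ α (face Ψ k)) (Eq.sym (maps k)))
    where module Aut = Group Aut

  sameOrbit-trans : ∀ Φ Ψ Ω → SameOrbit Φ Ψ → SameOrbit Ψ Ω → SameOrbit Φ Ω
  sameOrbit-trans _ _ _ (α , mapsα) (β , mapsβ) = α Aut.∙ β , λ k →
    Eq.trans (PosetIsomorphism.cong β (mapsα k)) (mapsβ k)
    where module Aut = Group Aut

  -- There are only two orbits and adjacent flags never share one, so a second adjacency step leads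
  -- back to the first orbit. This is the source of automorphisms of chiral quotients.
  chiral-even : IsChiral P → ∀ j k Φ Ψ Ω → Adjacent j Φ Ψ → Adjacent k Ψ Ω → SameOrbit Φ Ω
  chiral-even ((Φ₁ , Φ₂ , _ , orbits) , apart) j k Φ Ψ Ω ΦΨ ΨΩ with orbits Φ | orbits Ψ | orbits Ω
  ... | inj₁ a | inj₁ b | _      = contradiction (sameOrbit-trans Φ Φ₁ Ψ (sameOrbit-sym Φ₁ Φ a) b) (apart j Φ Ψ ΦΨ)
  ... | inj₂ a | inj₂ b | _      = contradiction (sameOrbit-trans Φ Φ₂ Ψ (sameOrbit-sym Φ₂ Φ a) b) (apart j Φ Ψ ΦΨ)
  ... | _      | inj₁ b | inj₁ c = contradiction (sameOrbit-trans Ψ Φ₁ Ω (sameOrbit-sym Φ₁ Ψ b) c) (apart k Ψ Ω ΨΩ)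
  ... | _      | inj₂ b | inj₂ c = contradiction (sameOrbit-trans Ψ Φ₂ Ω (sameOrbit-sym Φ₂ Ψ b) c) (apart k Ψ Ω ΨΩ)
  ... | inj₁ a | inj₂ _ | inj₁ c = sameOrbit-trans Φ Φ₁ Ω (sameOrbit-sym Φ₁ Φ a) c
  ... | inj₂ a | inj₁ _ | inj₂ c = sameOrbit-trans Φ Φ₂ Ω (sameOrbit-sym Φ₂ Φ a) c

-- Maps determined by the image of one flag

module Rigidity {n : ℕ} (P Q : Polytope n) where
  private
    module P = Polytope P
    module Q = Polytope Q
    module PP = PolytopeProperties P
    module QP = PolytopeProperties Q

  -- Weak enough to hold for automorphisms, coverings and their composites, yet strong enough for
  -- the diamond argument: adjacent flags keep different images.
  record IsFlagMap (h : P.Face → Q.Face) : Set where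
    field
      cong     : ∀ {F G} → F P.≈ G → h F Q.≈ h G
      strict   : ∀ {F G} → F P.< G → h F Q.< h G
      separate : ∀ j Φ Ψ → P.Adjacent j Φ Ψ → ¬ h (P.face Φ (middle j)) Q.≈ h (P.face Ψ (middle j))

  Agree : (h k : P.Face → Q.Face) → P.Flag → Set
  Agree h k Φ = ∀ l → h (P.face Φ l) Q.≈ k (P.face Φ l)

  module _ {h k : P.Face → Q.Face} (hm : IsFlagMap h) (km : IsFlagMap k)
           (k-rank : ∀ F → Q.rank (k F) ≡ P.rank F) where
    private
      module h = IsFlagMap hm
      module k = IsFlagMap km

    -- Since h and k agree in the neighbouring ranks, the image under h of the changed face lies in
    -- the diamond formed by the images under k of the old face and the new one. It cannot be the
    -- old one, because h separates the two flags.
    agree-adjacent : ∀ Φ Ψ j → P.Adjacent j Φ Ψ → Agree h k Φ → Agree h k Ψ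
    agree-adjacent Φ Ψ j (Φ≉Ψ , same) agree l with l Fin.≟ middle j
    ... | no l≢    = Q.Eq.trans (h.cong (P.Eq.sym (same l l≢))) (Q.Eq.trans (agree l) (k.cong (same l l≢)))
    ... | yes refl with QP.between (k.strict (PP.flag-≺ Φ (ℕ.<-trans (lower<middle j) (middle<upper j))) , ranks)
                          (k.separate j Φ Ψ (Φ≉Ψ , same))
                          (k.strict (PP.flag-≺ Φ (lower<middle j)) , k.strict (PP.flag-≺ Φ (middle<upper j)))
                          ( QP.≺-respˡ (Q.Eq.sym (k.cong (same _ (lower≢middle j)))) (k.strict (PP.flag-≺ Ψ (lower<middle j)))
                          , QP.≺-respʳ (Q.Eq.sym (k.cong (same _ (upper≢middle j)))) (k.strict (PP.flag-≺ Ψ (middle<upper j))))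
                          ( QP.≺-respˡ (moved (lower≢middle j)) (h.strict (PP.flag-≺ Ψ (lower<middle j)))
                          , QP.≺-respʳ (moved (upper≢middle j)) (h.strict (PP.flag-≺ Ψ (middle<upper j))))
      where
      ranks : toℕ (Q.rank (k (P.face Φ (upper j)))) ≡ 2 ℕ.+ toℕ (Q.rank (k (P.face Φ (lower j))))
      ranks = ≡.trans (≡.cong toℕ (≡.trans (k-rank _) (P.face-rank Φ _)))
        (≡.cong (2 ℕ.+_) (≡.sym (≡.trans (≡.cong toℕ (≡.trans (k-rank _) (P.face-rank Φ _))) (toℕ-lower j))))
      moved : ∀ {l} → l ≢ middle j → h (P.face Ψ l) Q.≈ k (P.face Φ l)
      moved l≢ = Q.Eq.trans (h.cong (P.Eq.sym (same _ l≢))) (agree _)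
    ...   | inj₁ hΨ≈kΦ = contradiction (Q.Eq.trans (agree (middle j)) (Q.Eq.sym hΨ≈kΦ)) (h.separate j Φ Ψ (Φ≉Ψ , same))
    ...   | inj₂ hΨ≈kΨ = hΨ≈kΨ

    agree-path : ∀ {Φ Ψ J} → PP.Path J Φ Ψ → Agree h k Φ → Agree h k Ψ
    agree-path (PP.done p) agree l = Q.Eq.trans (h.cong (P.Eq.sym (p l))) (Q.Eq.trans (agree l) (k.cong (p l)))
    agree-path {Φ} (PP.step {Ω = Ω} j _ adj ps) agree = agree-path ps (agree-adjacent Φ Ω j adj agree)

    agree-everywhere : (∀ F → ∃[ Φ ] ∃[ l ] P.face Φ l P.≈ F) → ∀ Φ → Agree h k Φ → ∀ F → h F Q.≈ k F
    agree-everywhere inFlag Φ agree F with inFlag F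
    ... | Ψ , l , Ψl≈F = Q.Eq.trans (h.cong (P.Eq.sym Ψl≈F))
      (Q.Eq.trans (agree-path (PP.connected Φ Ψ) agree l) (k.cong Ψl≈F))

  iso∘map : ∀ {h} → IsFlagMap h → (α : Group.Carrier Q.Aut) → IsFlagMap (PosetIsomorphism.⟦_⟧ α ∘ h)
  iso∘map hm α = record
    { cong     = λ p → α.cong (h.cong p)
    ; strict   = λ F<G → α.mono (proj₁ (h.strict F<G)) , λ p → proj₂ (h.strict F<G) (α.injective p)
    ; separate = λ j Φ Ψ adj p → h.separate j Φ Ψ adj (α.injective p)
    }
    where
    module α = PosetIsomorphism α
    module h = IsFlagMap hm

  covering-isFlagMap : (π : Covering P Q) → IsFlagMap (Covering.⟦_⟧ π)
  covering-isFlagMap π = record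
    { cong     = π.cong
    ; strict   = λ {F} {G} F<G → QP.≼∧rank<⇒≺ (π.mono (proj₁ F<G))
        (≡.subst₂ (λ x y → toℕ x ℕ.< toℕ y) (≡.sym (π.rank-preserving F)) (≡.sym (π.rank-preserving G)) (P.rank-mono F<G))
    ; separate = λ j Φ Ψ adj → proj₁ (π.adjacency-preserving j Φ Ψ adj)
    }
    where module π = Covering π

module _ {n : ℕ} (P : Polytope n) where
  open Polytope P
  open Rigidity P P

  id-isFlagMap : IsFlagMap id
  id-isFlagMap = record { cong = id ; strict = id ; separate = λ _ _ _ → proj₁ }

  automorphism-isFlagMap : (α : Group.Carrier Aut) → IsFlagMap (PosetIsomorphism.⟦_⟧ α)
  automorphism-isFlagMap = iso∘map id-isFlagMap

  automorphism-flag : Group.Carrier Aut → Flag → Flag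
  automorphism-flag α Φ = record
    { face      = λ k → α.⟦_⟧ (face Φ k)
    ; face-rank = strictly-monotone⇒id (λ k → rank (α.⟦_⟧ (face Φ k)))
        (λ k<l → rank-mono (IsFlagMap.strict (automorphism-isFlagMap α) (PolytopeProperties.flag-≺ P Φ k<l)))
    ; face-mono = λ k≤l → α.mono (face-mono Φ k≤l)
    }
    where module α = PosetIsomorphism α

  maps-adjacent : ∀ α Φ Φ′ Ψ Ψ′ j → Maps α Φ Φ′ → Adjacent j Φ Ψ → Adjacent j Φ′ Ψ′ → Maps α Ψ Ψ′
  maps-adjacent α Φ Φ′ Ψ Ψ′ j maps (Φ≉Ψ , same) adj =
    PolytopeProperties.adjacent-unique P (automorphism-flag α Φ) Φ′ (automorphism-flag α Ψ) Ψ′ j maps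
      ((λ p → Φ≉Ψ (α.injective p)) , λ k k≢ → α.cong (same k k≢)) adj
    where module α = PosetIsomorphism α

-- Recognising polygonal sections

⊑-vertices : ∀ {p} {k l : Fin p} → vertex k ⊑ vertex l → k ≡ l
⊑-vertices vertex⊑ = refl

⊑-edges : ∀ {p} {k l : Fin p} → edge k ⊑ edge l → k ≡ l
⊑-edges edge⊑ = refl

⊑-incident : ∀ {p} {k l : Fin p} → vertex k ⊑ edge l → k ≡ l ⊎ CyclicSuc l k
⊑-incident source     = inj₁ refl
⊑-incident (target c) = inj₂ c

module PolygonalSection {n : ℕ} (R : RankedPoset n)
  (rank-≤ : ∀ {F G} → RankedPoset._≤_ R F G → toℕ (RankedPoset.rank R F) ℕ.≤ toℕ (RankedPoset.rank R G))
  (rank-≈ : ∀ {F G} → RankedPoset._≤_ R F G → toℕ (RankedPoset.rank R F) ≡ toℕ (RankedPoset.rank R G) →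
            RankedPoset._≈_ R F G)
  (p : ℕ) .{{_ : NonZero p}} (k : ℕ) {F G : RankedPoset.Face R} (F≤G : RankedPoset._≤_ R F G)
  (rankF : toℕ (RankedPoset.rank R F) ≡ k) (rankG : toℕ (RankedPoset.rank R G) ≡ 3 ℕ.+ k)
  where
  open RankedPoset R hiding (refl) renaming (_≤_ to _≼_)
  open Residue p

  record In (r : ℕ) (H : Face) : Set where
    constructor in-section
    field
      above : F ≼ H
      below : H ≼ G
      level : toℕ (rank H) ≡ r ℕ.+ k

  -- ν and η number the two inner ranks of the section around the polygon, edge number k having the
  -- vertices k and k + 1. They are defined on all faces, but only their values within the section
  -- matter.
  module _ (ν η : Face → ℤ)
    (ν-cong : ∀ {H H′} → In 1 H → In 1 H′ → H ≈ H′ → ν H ≡[ + p ] ν H′)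
    (ν-injective : ∀ {H H′} → In 1 H → In 1 H′ → ν H ≡[ + p ] ν H′ → H ≈ H′)
    (η-cong : ∀ {H H′} → In 2 H → In 2 H′ → H ≈ H′ → η H ≡[ + p ] η H′)
    (η-injective : ∀ {H H′} → In 2 H → In 2 H′ → η H ≡[ + p ] η H′ → H ≈ H′)
    (incident⁺ : ∀ {H H′} → In 1 H → In 2 H′ → H ≼ H′ → ν H ≡[ + p ] η H′ ⊎ ν H ≡[ + p ] η H′ + 1ℤ)
    (incident⁻ : ∀ {H H′} → In 1 H → In 2 H′ → ν H ≡[ + p ] η H′ ⊎ ν H ≡[ + p ] η H′ + 1ℤ → H ≼ H′)
    (ν-surjective : ∀ z → ∃[ H ] In 1 H × ν H ≡[ + p ] z)
    (η-surjective : ∀ z → ∃[ H ] In 2 H × η H ≡[ + p ] z)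
    where

    data Stratum (H : Face) : Set where
      bottom : In 0 H → Stratum H
      vertexᴸ : In 1 H → Stratum H
      edgeᴸ  : In 2 H → Stratum H
      top    : In 3 H → Stratum H

    levelOf : ∀ H → F ≼ H → H ≼ G → Stratum H
    levelOf H F≤H H≤G = split (toℕ (rank H) ℕ.∸ k) (≡.sym (ℕ.m∸n+n≡m k≤H))
      where
      k≤H : k ℕ.≤ toℕ (rank H)
      k≤H = ≡.subst (ℕ._≤ _) rankF (rank-≤ F≤H)
      split : ∀ r → toℕ (rank H) ≡ r ℕ.+ k → Stratum H
      split 0 eq = bottom (in-section F≤H H≤G eq)
      split 1 eq = vertexᴸ (in-section F≤H H≤G eq)
      split 2 eq = edgeᴸ (in-section F≤H H≤G eq)
      split 3 eq = top (in-section F≤H H≤G eq)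
      split (suc (suc (suc (suc r)))) eq = contradiction
        (≡.subst₂ ℕ._≤_ eq rankG (rank-≤ H≤G)) (ℕ.<⇒≱ (ℕ.+-monoˡ-< k {3} (s≤s (s≤s (s≤s (s≤s z≤n))))))

    cellAt : ∀ {H} → Stratum H → Cell p
    cellAt     (bottom _) = least
    cellAt {H} (vertexᴸ _) = vertex (residue (ν H))
    cellAt {H} (edgeᴸ _)  = edge (residue (η H))
    cellAt     (top _)    = greatest

    descending : ∀ {r s H H′} → In r H → In s H′ → s ℕ.< r → H ≼ H′ → ⊥
    descending {r} {s} h h′ s<r H≤H′ =
      ℕ.<⇒≱ (ℕ.+-monoˡ-< k s<r) (≡.subst₂ ℕ._≤_ (In.level h) (In.level h′) (rank-≤ H≤H′))

    same-level : ∀ {r H H′} → In r H → In r H′ → H ≼ H′ → H ≈ H′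
    same-level h h′ H≤H′ = rank-≈ H≤H′ (≡.trans (In.level h) (≡.sym (In.level h′)))

    mono-at : ∀ {H H′} (l : Stratum H) (l′ : Stratum H′) → H ≼ H′ → cellAt l ⊑ cellAt l′
    mono-at (bottom _)  _            H≤H′ = least⊑
    mono-at (vertexᴸ h) (bottom h′)  H≤H′ = ⊥-elim (descending h h′ (s≤s z≤n) H≤H′)
    mono-at (edgeᴸ h)   (bottom h′)  H≤H′ = ⊥-elim (descending h h′ (s≤s z≤n) H≤H′)
    mono-at (top h)     (bottom h′)  H≤H′ = ⊥-elim (descending h h′ (s≤s z≤n) H≤H′)
    mono-at (vertexᴸ h) (vertexᴸ h′) H≤H′ =
      ≡.subst (λ z → vertex _ ⊑ vertex z) (residue-cong (ν-cong h h′ (same-level h h′ H≤H′))) vertex⊑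
    mono-at (edgeᴸ h)   (vertexᴸ h′) H≤H′ = ⊥-elim (descending h h′ (s≤s (s≤s z≤n)) H≤H′)
    mono-at (top h)     (vertexᴸ h′) H≤H′ = ⊥-elim (descending h h′ (s≤s (s≤s z≤n)) H≤H′)
    mono-at (vertexᴸ h) (edgeᴸ h′)   H≤H′ with incident⁺ h h′ H≤H′
    ... | inj₁ eq = ≡.subst (λ z → vertex _ ⊑ edge z) (residue-cong eq) source
    ... | inj₂ eq = target (cyclicSuc⁺ {η _} {ν _} eq)
    mono-at (edgeᴸ h)   (edgeᴸ h′)   H≤H′ =
      ≡.subst (λ z → edge _ ⊑ edge z) (residue-cong (η-cong h h′ (same-level h h′ H≤H′))) edge⊑
    mono-at (top h)     (edgeᴸ h′)   H≤H′ = ⊥-elim (descending h h′ (s≤s (s≤s (s≤s z≤n))) H≤H′)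
    mono-at (vertexᴸ _) (top _)      H≤H′ = ⊑greatest
    mono-at (edgeᴸ _)   (top _)      H≤H′ = ⊑greatest
    mono-at (top _)     (top _)      H≤H′ = ⊑greatest

    at-bottom : ∀ {H} → In 0 H → F ≈ H
    at-bottom h = rank-≈ (In.above h) (≡.trans rankF (≡.sym (In.level h)))

    at-top : ∀ {H} → In 3 H → H ≈ G
    at-top h = rank-≈ (In.below h) (≡.trans (In.level h) (≡.sym rankG))

    above-of : ∀ {H} → Stratum H → F ≼ H
    above-of (bottom h)  = In.above h
    above-of (vertexᴸ h) = In.above h
    above-of (edgeᴸ h)   = In.above h
    above-of (top h)     = In.above h

    below-of : ∀ {H} → Stratum H → H ≼ G
    below-of (bottom h)  = In.below h
    below-of (vertexᴸ h) = In.below h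
    below-of (edgeᴸ h)   = In.below h
    below-of (top h)     = In.below h

    cancel-at : ∀ {H H′} (l : Stratum H) (l′ : Stratum H′) → cellAt l ⊑ cellAt l′ → H ≼ H′
    cancel-at (bottom h)  l′           c = trans (reflexive (Eq.sym (at-bottom h))) (above-of l′)
    cancel-at l           (top h′)     c = trans (below-of l) (reflexive (Eq.sym (at-top h′)))
    cancel-at (vertexᴸ h) (vertexᴸ h′) c = reflexive (ν-injective h h′ (residue-injective (⊑-vertices c)))
    cancel-at (vertexᴸ h) (edgeᴸ h′)   c = incident⁻ h h′ (case ⊑-incident c of λ where
      (inj₁ eq) → inj₁ (residue-injective eq)
      (inj₂ cs) → inj₂ (cyclicSuc⁻ {η _} {ν _} cs))
    cancel-at (edgeᴸ h)   (edgeᴸ h′)   c = reflexive (η-injective h h′ (residue-injective (⊑-edges c)))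

    private
      S : Poset 0ℓ 0ℓ 0ℓ
      S = section F G
      module S = Poset S

    cell : S.Carrier → Cell p
    cell (H , F≤H , H≤G) = cellAt (levelOf H F≤H H≤G)

    cell-mono : ∀ {x y} → x S.≤ y → cell x ⊑ cell y
    cell-mono = mono-at (levelOf _ _ _) (levelOf _ _ _)

    cell-cancel : ∀ {x y} → cell x ⊑ cell y → x S.≤ y
    cell-cancel = cancel-at (levelOf _ _ _) (levelOf _ _ _)

    cell-cong : ∀ {x y} → x S.≈ y → cell x ≡ cell y
    cell-cong {x} {y} p = Poset.antisym (polygon _) (cell-mono {x} {y} (S.reflexive {x} {y} p)) (cell-mono {y} {x} (S.reflexive {y} {x} (Eq.sym p)))

    -- The stratum found by `levelOf` is not definitionally the given one; monotonicity in both
    -- directions still makes the cells equal.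
    cell-level : ∀ {H} (a : F ≼ H) (b : H ≼ G) (l : Stratum H) → cell (H , a , b) ≡ cellAt l
    cell-level {H} a b l = Poset.antisym (polygon _) (mono-at (levelOf H a b) l refl′) (mono-at l (levelOf H a b) refl′)
      where
      refl′ : H ≼ H
      refl′ = reflexive Eq.refl

    polygonal : PosetIsomorphism S (polygon p)
    polygonal = record
      { ⟦_⟧ = cell
      ; isOrderIsomorphism = record
        { isOrderMonomorphism = record
          { isOrderHomomorphism = record
            { cong = λ {x} {y} → cell-cong {x} {y}
            ; mono = λ {x} {y} → cell-mono {x} {y}
            }
          ; injective = λ {x} {y} eq → antisym
              (cell-cancel {x} {y} (Poset.reflexive (polygon _) eq))
              (cell-cancel {y} {x} (Poset.reflexive (polygon _) (≡.sym eq)))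
          ; cancel = λ {x} {y} → cell-cancel {x} {y}
          }
        ; surjective = preimage
        }
      }
      where
      reach : ∀ {H} (l : Stratum H) {c} → cellAt l ≡ c → ∃[ x ] (∀ {z} → z S.≈ x → cell z ≡ c)
      reach {H} l eq = (H , above-of l , below-of l) , λ {z} z≈ →
        ≡.trans (cell-cong {z} {_ , above-of l , below-of l} z≈) (≡.trans (cell-level _ _ l) eq)
      preimage : ∀ c → ∃[ x ] (∀ {z} → z S.≈ x → cell z ≡ c)
      preimage least      = reach (bottom (in-section (reflexive Eq.refl) F≤G rankF)) refl
      preimage greatest   = reach (top (in-section F≤G (reflexive Eq.refl) rankG)) refl
      preimage (vertex k) with ν-surjective (+ toℕ k)
      ... | H , h , eq = reach (vertexᴸ h) (≡.cong vertex (≡.trans (residue-cong {ν H} eq) (residue-toℕ k)))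
      preimage (edge k)   with η-surjective (+ toℕ k)
      ... | H , h , eq = reach (edgeᴸ h) (≡.cong edge (≡.trans (residue-cong {η H} eq) (residue-toℕ k)))

-- The face lattice

mod-* : ∀ {d a a′ b b′} → a ≡[ d ] a′ → b ≡[ d ] b′ → a * b ≡[ d ] a′ * b′
mod-* {d} {_} {a′} {_} {b′} (by p refl) (by q refl) = by (a′ * q + p * b′ + p * q * d) (solve (a′ ∷ b′ ∷ p ∷ q ∷ d ∷ []))

unit-shift : ∀ {a} x → ¬ a ≡[ + 4 ] a + (1ℤ + + 4 * x)
unit-shift {a} x (by q eq) = 1≢4x { - (x + q) } (isolate x q vanish)
  where
  regroup : ∀ a x q → a + (1ℤ + + 4 * x) + q * + 4 - a ≡ 1ℤ + + 4 * x + q * + 4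
  regroup = solve-∀
  vanish : 0ℤ ≡ 1ℤ + + 4 * x + q * + 4
  vanish = ≡.trans (≡.sym (ℤ.+-inverseʳ a)) (≡.trans (≡.cong (_- a) eq) (regroup a x q))
  identity : ∀ x q → 1ℤ ≡ (1ℤ + + 4 * x + q * + 4) + - (x + q) * + 4
  identity = solve-∀
  isolate : ∀ x q → 0ℤ ≡ 1ℤ + + 4 * x + q * + 4 → 1ℤ ≡ - (x + q) * + 4
  isolate x q v = ≡.trans (identity x q) (≡.trans (≡.cong (_+ - (x + q) * + 4) (≡.sym v)) (ℤ.+-identityˡ _))

2≢0 : ¬ + 2 ≡[ + 4 ] 0ℤ
2≢0 (by q eq) = 1≢2x {q} (halve (≡.trans eq (solve (q ∷ []))))

mod4-of-8 : ∀ {a b} → a ≡[ + 8 ] b → a ≡[ + 4 ] b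
mod4-of-8 = mod-divisor (+ 2)

T-cong : ∀ {c c′} → c ≡[ + 8 ] c′ → T c ≡[ + 4 ] T c′
T-cong {_} {c} (by q refl) = by (q * (+ 8 * q - 1ℤ) + + 2 * (c * q))
  (≡.trans (≡.cong (λ x → T (c + x)) (ℤ.*-comm q (+ 8)))
    (≡.trans (T-8 c q) (≡.cong (λ x → T c + x) (ℤ.*-comm (+ 4) (q * (+ 8 * q - 1ℤ) + + 2 * (c * q))))))

-- Quadratic permutations of the facets

module Shear (K e : ℤ) where

  mod8 : ∀ {a b} → a ≡[ + 32 * K ] b → a ≡[ + 8 ] b
  mod8 {_} {b} (by q refl) = by (+ 4 * K * q) (solve (b ∷ q ∷ K ∷ []))

  mod4 : ∀ {a b} → a ≡[ + 32 * K ] b → a ≡[ + 4 ] b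
  mod4 p = mod4-of-8 (mod8 p)

  -- 8 K times 4 is the modulus of the facets: a correction 8 K j sees j only modulo 4.
  scale : ∀ {a b} → a ≡[ + 4 ] b → + 8 * K * a ≡[ + 32 * K ] + 8 * K * b
  scale {_} {b} (by q refl) = by q (solve (b ∷ q ∷ K ∷ []))

  next≢ : ∀ i j → ¬ i ≡[ + 4 ] i + 1ℤ + + 8 * K * j
  next≢ i j p = unit-shift (+ 2 * K * j) (mod-trans p (≡⇒≡[] (solve (K ∷ i ∷ j ∷ []))))

  below-next : ∀ c j → c ≡ c - 1ℤ - + 8 * K * j + 1ℤ + + 8 * K * j
  below-next c j = regroup c j K
    where
    regroup : ∀ c j K → c ≡ c - 1ℤ - + 8 * K * j + 1ℤ + + 8 * K * j
    regroup = solve-∀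

  below-mod4 : ∀ c j → c - 1ℤ - + 8 * K * j ≡[ + 4 ] c - 1ℤ
  below-mod4 c j = by (- (+ 2 * K * j)) (solve (c ∷ j ∷ K ∷ []))

  below≢ : ∀ c j → ¬ c - 1ℤ - + 8 * K * j ≡[ + 4 ] c
  below≢ c j p = next≢ (c - 1ℤ - + 8 * K * j) j (mod-trans p (≡⇒≡[] (below-next c j)))

  -- The facets of the n-gon around an edge are met in the order θ s m 0, θ s m 1, …
  θ : ℤ → ℤ → ℤ → ℤ
  θ a u c = c + + 8 * K * (e * a * T c + u * c)

  θ-cong : ∀ {a a′ u u′ c c′} → a ≡[ + 4 ] a′ → u ≡[ + 4 ] u′ → c ≡[ + 32 * K ] c′ →
           θ a u c ≡[ + 32 * K ] θ a′ u′ c′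
  θ-cong a u c = mod-+ c (scale (mod-+ (mod-* (mod-*ˡ e a) (T-cong (mod8 c))) (mod-* u (mod4 c))))

  θ-mod8 : ∀ a u c → θ a u c ≡[ + 8 ] c
  θ-mod8 a u c = by (K * (e * a * T c + u * c)) (regroup c K (e * a * T c + u * c))
    where
    regroup : ∀ c K y → c + + 8 * K * y ≡ c + K * y * + 8
    regroup = solve-∀

  -- The inner θ moves c by a multiple of 8, which changes neither c nor `T c` modulo 4; so the
  -- outer correction is the one at c, and the corrections add.
  θ-+ : ∀ a u a′ u′ c → θ a u (θ a′ u′ c) ≡[ + 32 * K ] θ (a + a′) (u + u′) c
  θ-+ a u a′ u′ c = mod-trans
    (mod-+ {a = θ a′ u′ c} mod-refl (scale (mod-+ (mod-*ˡ (e * a) (T-cong (θ-mod8 a′ u′ c))) (mod-*ˡ u (mod4-of-8 (θ-mod8 a′ u′ c))))))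
    (≡⇒≡[] (collect c K e a u a′ u′ (T c)))
    where
    collect : ∀ c K e a u a′ u′ t → c + + 8 * K * (e * a′ * t + u′ * c) + + 8 * K * (e * a * t + u * c)
                                  ≡ c + + 8 * K * (e * (a + a′) * t + (u + u′) * c)
    collect = solve-∀

  θ-0 : ∀ c → θ 0ℤ 0ℤ c ≡ c
  θ-0 c = simp c K e (T c)
    where
    simp : ∀ c K e t → c + + 8 * K * (e * 0ℤ * t + 0ℤ * c) ≡ c
    simp = solve-∀

  θ-inverse : ∀ a u c → θ a u (θ (- a) (- u) c) ≡[ + 32 * K ] c
  θ-inverse a u c = mod-trans (θ-+ a u (- a) (- u) c)
    (≡⇒≡[] (≡.trans (≡.cong₂ (λ x y → θ x y c) (ℤ.+-inverseʳ a) (ℤ.+-inverseʳ u)) (θ-0 c)))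

  -- By `T-suc` the correction grows by e a c + u, and this is what `rotate` adds to the index j of
  -- a polygon.
  θ-next : ∀ a u c j → θ a u (c + 1ℤ + + 8 * K * j) ≡[ + 32 * K ] θ a u c + 1ℤ + + 8 * K * (j + e * a * c + u)
  θ-next a u c j = mod-trans
    (mod-+ {a = c + 1ℤ + + 8 * K * j} mod-refl
      (scale (mod-+ (mod-*ˡ (e * a) (mod-trans (T-cong shift) (≡⇒≡[] (T-suc c)))) (mod-*ˡ u (mod4-of-8 shift)))))
    (≡⇒≡[] (collect c K e a u j (T c)))
    where
    shift : c + 1ℤ + + 8 * K * j ≡[ + 8 ] c + 1ℤ
    shift = by (K * j) (solve (c ∷ K ∷ j ∷ []))
    collect : ∀ c K e a u j t → c + 1ℤ + + 8 * K * j + + 8 * K * (e * a * (t + c) + u * (c + 1ℤ))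
                              ≡ c + + 8 * K * (e * a * t + u * c) + 1ℤ + + 8 * K * (j + e * a * c + u)
    collect = solve-∀

module FaceLattice (K e : ℤ) where
  open Shear K e public

  infix 4 _≈_ _⋖_ _≼_

  data Face : Set where
    bot   : Face
    vert  : ℤ → Face
    edge  : ℤ → ℤ → Face
    poly  : ℤ → ℤ → Face
    facet : ℤ → Face
    top   : Face

  data _≈_ : Rel Face 0ℓ where
    bot≈   : bot ≈ bot
    vert≈  : ∀ {v v′} → v ≡[ + 4 ] v′ → vert v ≈ vert v′
    edge≈  : ∀ {s m s′ m′} → s ≡[ + 4 ] s′ → m ≡[ + 4 ] m′ → edge s m ≈ edge s′ m′
    poly≈  : ∀ {i j i′ j′} → i ≡[ + 32 * K ] i′ → j ≡[ + 4 ] j′ → poly i j ≈ poly i′ j′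
    facet≈ : ∀ {c c′} → c ≡[ + 32 * K ] c′ → facet c ≈ facet c′
    top≈   : top ≈ top

  -- Since the polytope is tight, faces whose ranks differ by at least two are always incident, and
  -- it suffices to say which faces of consecutive ranks are incident.
  data _⋖_ : Rel Face 0ℓ where
    bot⋖vert   : ∀ {v} → bot ⋖ vert v
    vert⋖edge  : ∀ {v s m} → v ≡[ + 4 ] s ⊎ v ≡[ + 4 ] s + 1ℤ → vert v ⋖ edge s m
    edge⋖poly  : ∀ {s m i j} → j ≡[ + 4 ] e * s * i + m → edge s m ⋖ poly i j
    poly⋖facet : ∀ {i j c} → c ≡[ + 32 * K ] i ⊎ c ≡[ + 32 * K ] i + 1ℤ + + 8 * K * j → poly i j ⋖ facet c
    facet⋖top  : ∀ {c} → facet c ⋖ top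

  rank : Face → Fin 6
  rank bot        = zero
  rank (vert _)   = suc zero
  rank (edge _ _) = suc (suc zero)
  rank (poly _ _) = suc (suc (suc zero))
  rank (facet _)  = suc (suc (suc (suc zero)))
  rank top        = suc (suc (suc (suc (suc zero))))

  data _≼_ (F G : Face) : Set where
    equal : F ≈ G → F ≼ G
    cover : F ⋖ G → F ≼ G
    far   : 2 ℕ.+ toℕ (rank F) ℕ.≤ toℕ (rank G) → F ≼ G

  ≈-refl : ∀ {F} → F ≈ F
  ≈-refl {bot}      = bot≈
  ≈-refl {vert _}   = vert≈ mod-refl
  ≈-refl {edge _ _} = edge≈ mod-refl mod-refl
  ≈-refl {poly _ _} = poly≈ mod-refl mod-refl
  ≈-refl {facet _}  = facet≈ mod-refl
  ≈-refl {top}      = top≈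

  ≈-sym : ∀ {F G} → F ≈ G → G ≈ F
  ≈-sym bot≈        = bot≈
  ≈-sym (vert≈ p)   = vert≈ (mod-sym p)
  ≈-sym (edge≈ p q) = edge≈ (mod-sym p) (mod-sym q)
  ≈-sym (poly≈ p q) = poly≈ (mod-sym p) (mod-sym q)
  ≈-sym (facet≈ p)  = facet≈ (mod-sym p)
  ≈-sym top≈        = top≈

  ≈-trans : ∀ {F G H} → F ≈ G → G ≈ H → F ≈ H
  ≈-trans bot≈        bot≈          = bot≈
  ≈-trans (vert≈ p)   (vert≈ p′)    = vert≈ (mod-trans p p′)
  ≈-trans (edge≈ p q) (edge≈ p′ q′) = edge≈ (mod-trans p p′) (mod-trans q q′)
  ≈-trans (poly≈ p q) (poly≈ p′ q′) = poly≈ (mod-trans p p′) (mod-trans q q′)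
  ≈-trans (facet≈ p)  (facet≈ p′)   = facet≈ (mod-trans p p′)
  ≈-trans top≈        top≈          = top≈

  ≈-dec : ∀ F G → rank F ≡ rank G → Dec (F ≈ G)
  ≈-dec bot        bot          _ = yes bot≈
  ≈-dec (vert v)   (vert v′)    _ = map′ vert≈ (λ { (vert≈ p) → p }) (mod-dec v v′)
  ≈-dec (edge s m) (edge s′ m′) _ =
    map′ (λ (p , q) → edge≈ p q) (λ { (edge≈ p q) → p , q }) (mod-dec s s′ ×-dec mod-dec m m′)
  ≈-dec (poly i j) (poly i′ j′) _ =
    map′ (λ (p , q) → poly≈ p q) (λ { (poly≈ p q) → p , q }) (mod-dec i i′ ×-dec mod-dec j j′)
  ≈-dec (facet c)  (facet c′)   _ = map′ facet≈ (λ { (facet≈ p) → p }) (mod-dec c c′)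
  ≈-dec top        top          _ = yes top≈

  rank-cong : ∀ {F G} → F ≈ G → rank F ≡ rank G
  rank-cong bot≈        = refl
  rank-cong (vert≈ _)   = refl
  rank-cong (edge≈ _ _) = refl
  rank-cong (poly≈ _ _) = refl
  rank-cong (facet≈ _)  = refl
  rank-cong top≈        = refl

  toℕ-rank-cong : ∀ {F G} → F ≈ G → toℕ (rank F) ≡ toℕ (rank G)
  toℕ-rank-cong p = ≡.cong toℕ (rank-cong p)

  rank-⋖ : ∀ {F G} → F ⋖ G → toℕ (rank G) ≡ suc (toℕ (rank F))
  rank-⋖ bot⋖vert       = refl
  rank-⋖ (vert⋖edge _)  = refl
  rank-⋖ (edge⋖poly _)  = refl
  rank-⋖ (poly⋖facet _) = refl
  rank-⋖ facet⋖top      = refl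

  next-cong : ∀ {i i′ j j′} → i ≡[ + 32 * K ] i′ → j ≡[ + 4 ] j′ →
              i + 1ℤ + + 8 * K * j ≡[ + 32 * K ] i′ + 1ℤ + + 8 * K * j′
  next-cong p q = mod-+ (mod-+ p mod-refl) (scale q)

  side-cong : ∀ {s s′ i i′ m m′} → s ≡[ + 4 ] s′ → i ≡[ + 32 * K ] i′ → m ≡[ + 4 ] m′ →
              e * s * i + m ≡[ + 4 ] e * s′ * i′ + m′
  side-cong p q r = mod-+ (mod-* (mod-*ˡ e p) (mod4 q)) r

  ⋖-respˡ : ∀ {F F′ G} → F ≈ F′ → F ⋖ G → F′ ⋖ G
  ⋖-respˡ bot≈        bot⋖vert       = bot⋖vert
  ⋖-respˡ (vert≈ p)   (vert⋖edge q)  = vert⋖edge (Sum.map (mod-trans (mod-sym p)) (mod-trans (mod-sym p)) q)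
  ⋖-respˡ (edge≈ p q) (edge⋖poly {i = i} r) = edge⋖poly (mod-trans r (side-cong {i = i} p mod-refl q))
  ⋖-respˡ (poly≈ p q) (poly⋖facet r) = poly⋖facet (Sum.map (λ x → mod-trans x p) (λ x → mod-trans x (next-cong p q)) r)
  ⋖-respˡ (facet≈ _)  facet⋖top      = facet⋖top

  ⋖-respʳ : ∀ {F G G′} → G ≈ G′ → F ⋖ G → F ⋖ G′
  ⋖-respʳ (vert≈ _)   bot⋖vert       = bot⋖vert
  ⋖-respʳ (edge≈ p q) (vert⋖edge r)  = vert⋖edge (Sum.map (λ x → mod-trans x p) (λ x → mod-trans x (mod-+ p mod-refl)) r)
  ⋖-respʳ (poly≈ p q) (edge⋖poly {s} r) = edge⋖poly (mod-trans (mod-sym q) (mod-trans r (side-cong {s} mod-refl p mod-refl)))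
  ⋖-respʳ (facet≈ p)  (poly⋖facet r) = poly⋖facet (Sum.map (mod-trans (mod-sym p)) (mod-trans (mod-sym p)) r)
  ⋖-respʳ top≈        facet⋖top      = facet⋖top

  ≼-rank : ∀ {F G} → F ≼ G → toℕ (rank F) ℕ.≤ toℕ (rank G)
  ≼-rank (equal p) = ℕ.≤-reflexive (toℕ-rank-cong p)
  ≼-rank (cover c) = ℕ.≤-trans (ℕ.n≤1+n _) (ℕ.≤-reflexive (≡.sym (rank-⋖ c)))
  ≼-rank (far f)   = ℕ.≤-trans (ℕ.≤-trans (ℕ.n≤1+n _) (ℕ.n≤1+n _)) f

  ≼∧rank≡⇒≈ : ∀ {F G} → F ≼ G → toℕ (rank F) ≡ toℕ (rank G) → F ≈ G
  ≼∧rank≡⇒≈ (equal p) _  = p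
  ≼∧rank≡⇒≈ (cover c) eq = contradiction (≡.trans eq (rank-⋖ c)) (ℕ.<⇒≢ ℕ.≤-refl)
  ≼∧rank≡⇒≈ (far f)   eq = contradiction eq (ℕ.<⇒≢ (ℕ.≤-trans (ℕ.n≤1+n _) f))

  ≼⇒⋖ : ∀ {F G} → F ≼ G → toℕ (rank G) ≡ suc (toℕ (rank F)) → F ⋖ G
  ≼⇒⋖ (equal p) eq = contradiction (≡.trans (toℕ-rank-cong p) eq) (ℕ.<⇒≢ ℕ.≤-refl)
  ≼⇒⋖ (cover c) _  = c
  ≼⇒⋖ (far f)   eq = contradiction (≡.sym eq) (ℕ.<⇒≢ f)

  ≼-trans : ∀ {F G H} → F ≼ G → G ≼ H → F ≼ H
  ≼-trans (equal p) (equal q) = equal (≈-trans p q)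
  ≼-trans (equal p) (cover c) = cover (⋖-respˡ (≈-sym p) c)
  ≼-trans (equal p) (far f)   = far (≡.subst (λ r → 2 ℕ.+ r ℕ.≤ _) (toℕ-rank-cong (≈-sym p)) f)
  ≼-trans (cover c) (equal q) = cover (⋖-respʳ q c)
  ≼-trans (cover c) (cover d) = far (ℕ.≤-reflexive (≡.sym (≡.trans (rank-⋖ d) (≡.cong suc (rank-⋖ c)))))
  ≼-trans (cover c) (far f)   = far (ℕ.≤-trans (s≤s (s≤s (≼-rank (cover c)))) f)
  ≼-trans (far f)   q         = far (ℕ.≤-trans f (≼-rank q))

  poset : Poset 0ℓ 0ℓ 0ℓ
  poset = record
    { Carrier        = Face
    ; _≈_            = _≈_
    ; _≤_            = _≼_
    ; isPartialOrder = record
      { isPreorder = record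
        { isEquivalence = record { refl = ≈-refl ; sym = ≈-sym ; trans = ≈-trans }
        ; reflexive     = equal
        ; trans         = ≼-trans
        }
      ; antisym = λ p q → ≼∧rank≡⇒≈ p (ℕ.≤-antisym (≼-rank p) (≼-rank q))
      }
    }

  rankedPoset : RankedPoset 4
  rankedPoset = record
    { poset     = poset
    ; rank      = rank
    ; rank-cong = rank-cong
    ; rank-mono = λ { (equal p , F≉G) → contradiction p F≉G
                    ; (cover c , _)   → ℕ.≤-reflexive (≡.sym (rank-⋖ c))
                    ; (far f   , _)   → ℕ.≤-trans (ℕ.n≤1+n _) f }
    }

  open RankedPoset rankedPoset using (_<_; rank-mono; Flag; face; face-rank; face-mono; _≈ᶠ_; Adjacent; IsMaximalChain)
  open FlagPaths rankedPoset using (Path; done; step; path-refl; path-trans; path-sym; path-ℤ; path⇒star; chain-length)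

  ⋖⇒< : ∀ {F G} → F ⋖ G → F < G
  ⋖⇒< c = cover c , λ p → ℕ.<⇒≢ (ℕ.≤-reflexive (≡.sym (rank-⋖ c))) (toℕ-rank-cong p)

  consecutive : ∀ {F G H} → F < H → H < G → toℕ (rank G) ≡ 2 ℕ.+ toℕ (rank F) → F ⋖ H × H ⋖ G
  consecutive {F} {G} {H} F<H H<G eq = ≼⇒⋖ (proj₁ F<H) rankH , ≼⇒⋖ (proj₁ H<G) (≡.trans eq (≡.cong suc (≡.sym rankH)))
    where
    rankH : toℕ (rank H) ≡ suc (toℕ (rank F))
    rankH = ℕ.≤-antisym (ℕ.≤-pred (ℕ.≤-trans (rank-mono H<G) (ℕ.≤-reflexive eq))) (rank-mono F<H)

  -- Incidence of consecutive ranks is an explicit congruence, which each case solves for the middle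
  -- face. There are two solutions because a vertex may be the first or the second of an edge, and a
  -- facet the first or the second of a polygon.
  diamond⋖ : ∀ F G → toℕ (rank G) ≡ 2 ℕ.+ toℕ (rank F) → ∃[ H₁ ] ∃[ H₂ ]
    ¬ H₁ ≈ H₂ × (F ⋖ H₁ × H₁ ⋖ G) × (F ⋖ H₂ × H₂ ⋖ G) × (∀ H → F ⋖ H → H ⋖ G → H ≈ H₁ ⊎ H ≈ H₂)
  diamond⋖ bot (edge s m) _ = vert s , vert (s + 1ℤ)
    , (λ { (vert≈ p) → unit-shift 0ℤ p })
    , (bot⋖vert , vert⋖edge (inj₁ mod-refl))
    , (bot⋖vert , vert⋖edge (inj₂ mod-refl))
    , λ { (vert _) bot⋖vert (vert⋖edge r) → Sum.map vert≈ vert≈ r }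
  diamond⋖ (vert v) (poly i j) _ = edge v (j - e * v * i) , edge (v - 1ℤ) (j - e * (v - 1ℤ) * i)
    , (λ { (edge≈ p _) → unit-shift 0ℤ (mod-trans (mod-sym p) (≡⇒≡[] (predecessor v))) })
    , (vert⋖edge (inj₁ mod-refl) , edge⋖poly (≡⇒≡[] (solve-for-m v)))
    , (vert⋖edge (inj₂ (≡⇒≡[] (predecessor v))) , edge⋖poly (≡⇒≡[] (solve-for-m (v - 1ℤ))))
    , λ { (edge s m) (vert⋖edge r) (edge⋖poly q) → Sum.map
          (λ v≡s → edge≈ (mod-sym v≡s) (unique m s v (mod-sym v≡s) q))
          (λ v≡s+1 → edge≈ (s≡v-1 s v≡s+1) (unique m s (v - 1ℤ) (s≡v-1 s v≡s+1) q)) r }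
    where
    solve-for-m : ∀ s → j ≡ e * s * i + (j - e * s * i)
    solve-for-m s = remainder j (e * s * i)
    unique : ∀ m s s′ → s ≡[ + 4 ] s′ → j ≡[ + 4 ] e * s * i + m → m ≡[ + 4 ] j - e * s′ * i
    unique m s s′ p q = mod-trans (≡⇒≡[] (cancel-summand (e * s * i) m))
      (mod-+ (mod-sym q) (mod-neg (mod-* (mod-*ˡ e p) (mod-refl {a = i}))))
    s≡v-1 : ∀ s → v ≡[ + 4 ] s + 1ℤ → s ≡[ + 4 ] v - 1ℤ
    s≡v-1 s p = mod-trans (≡⇒≡[] (successor s)) (mod-+ (mod-sym p) mod-refl)
  diamond⋖ (edge s m) (facet c) _ = poly c (e * s * c + m) , poly i₋ j₋
    , (λ { (poly≈ p _) → below≢ c j₋ (mod-sym (mod4 p)) })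
    , (edge⋖poly mod-refl , poly⋖facet (inj₁ mod-refl))
    , (edge⋖poly (mod-sym (side-cong′ (below-mod4 c j₋))) , poly⋖facet (inj₂ (≡⇒≡[] (below-next c j₋))))
    , λ { (poly i j) (edge⋖poly q) (poly⋖facet r) → Sum.map
          (λ c≡i → poly≈ (mod-sym c≡i) (mod-trans q (side-cong′ (mod-sym (mod4 c≡i)))))
          (λ c≡i⁺ → poly≈ (lower-i i j c≡i⁺ (lower-j i j q c≡i⁺)) (lower-j i j q c≡i⁺)) r }
    where
    -- A polygon with second facet c has i ≡ c - 1 modulo 4, which already determines j; then i is
    -- found from i + 1 + 8 K j = c.
    j₋ = e * s * (c - 1ℤ) + m
    i₋ = c - 1ℤ - + 8 * K * j₋
    side-cong′ : ∀ {i i′} → i ≡[ + 4 ] i′ → e * s * i + m ≡[ + 4 ] e * s * i′ + m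
    side-cong′ p = mod-+ (mod-*ˡ (e * s) p) mod-refl
    back : ∀ i j K → i ≡ (i + 1ℤ + + 8 * K * j) - 1ℤ - + 8 * K * j
    back = solve-∀
    lower-i : ∀ i j → c ≡[ + 32 * K ] i + 1ℤ + + 8 * K * j → j ≡[ + 4 ] j₋ → i ≡[ + 32 * K ] i₋
    lower-i i j p q = mod-trans (≡⇒≡[] (back i j K)) (mod-+ (mod-+ (mod-sym p) mod-refl) (mod-neg (scale q)))
    lower-j : ∀ i j → j ≡[ + 4 ] e * s * i + m → c ≡[ + 32 * K ] i + 1ℤ + + 8 * K * j → j ≡[ + 4 ] j₋
    lower-j i j q p = mod-trans q (side-cong′ (mod-trans (≡⇒≡[] (back i j K))
      (mod-trans (mod-+ (mod-+ (mod-sym (mod4 p)) mod-refl) mod-refl) (below-mod4 c j))))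
  diamond⋖ (poly i j) top _ = facet i , facet (i + 1ℤ + + 8 * K * j)
    , (λ { (facet≈ p) → next≢ i j (mod4 p) })
    , (poly⋖facet (inj₁ mod-refl) , facet⋖top)
    , (poly⋖facet (inj₂ mod-refl) , facet⋖top)
    , λ { (facet _) (poly⋖facet r) facet⋖top → Sum.map facet≈ facet≈ r }

  someFace : Fin 6 → Face
  someFace zero                            = bot
  someFace (suc zero)                      = vert 0ℤ
  someFace (suc (suc zero))                = edge 0ℤ 0ℤ
  someFace (suc (suc (suc zero)))          = poly 0ℤ 0ℤ
  someFace (suc (suc (suc (suc zero))))    = facet 0ℤ
  someFace (suc (suc (suc (suc (suc zero))))) = top

  rank-someFace : ∀ k → rank (someFace k) ≡ k
  rank-someFace zero                            = refl
  rank-someFace (suc zero)                      = refl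
  rank-someFace (suc (suc zero))                = refl
  rank-someFace (suc (suc (suc zero)))          = refl
  rank-someFace (suc (suc (suc (suc zero))))    = refl
  rank-someFace (suc (suc (suc (suc (suc zero))))) = refl

  -- If the chain has no face of rank k, an arbitrary face of that rank serves as a default, and the
  -- last component holds vacuously.
  locate : ∀ k c → AllPairs _<_ c → ∃[ F ] rank F ≡ k × All (λ G → rank G ≡ k → G ≡ F) c
  locate k []      _ = someFace k , rank-someFace k , All.[]
  locate k (F ∷ c) (F<c AllPairs.∷ chain) with rank F Fin.≟ k
  ... | yes F≡k = F , F≡k , (λ _ → refl) All.∷
    All.map (λ F<G G≡k → contradiction (≡.cong toℕ (≡.trans F≡k (≡.sym G≡k))) (ℕ.<⇒≢ (rank-mono F<G))) F<c
  ... | no F≢k with locate k c chain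
  ...   | G , G≡k , only = G , G≡k , (λ F≡k → contradiction F≡k F≢k) All.∷ only

  bot≼ : ∀ F → bot ≼ F
  bot≼ bot        = equal bot≈
  bot≼ (vert _)   = cover bot⋖vert
  bot≼ (edge _ _) = far (s≤s (s≤s z≤n))
  bot≼ (poly _ _) = far (s≤s (s≤s z≤n))
  bot≼ (facet _)  = far (s≤s (s≤s z≤n))
  bot≼ top        = far (s≤s (s≤s z≤n))

  ≼top : ∀ F → F ≼ top
  ≼top bot        = far (s≤s (s≤s z≤n))
  ≼top (vert _)   = far (s≤s (s≤s (s≤s z≤n)))
  ≼top (edge _ _) = far (s≤s (s≤s (s≤s (s≤s z≤n))))
  ≼top (poly _ _) = far (s≤s (s≤s (s≤s (s≤s (s≤s z≤n)))))
  ≼top (facet _)  = cover facet⋖top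
  ≼top top        = equal top≈

  -- Suppose an inner rank is missed, and take H of that rank between the faces of the chain in the
  -- two neighbouring ranks. All other faces of the chain are at least two ranks away from H, hence
  -- comparable with it, so maximality puts H into the chain.
  maximal-chain-length : ∀ c → IsMaximalChain c → length c ≡ 6
  maximal-chain-length c (chain , maximal) = chain-length 6 0 c chain
    (All.universal (λ _ → z≤n) c) (All.universal (λ F → Fin.toℕ<n (rank F)) c)
    λ k _ k<6 → ≡.subst (λ r → Any (λ F → toℕ (rank F) ≡ r) c) (Fin.toℕ-fromℕ< k<6) (meets (fromℕ< k<6))
    where
    found : ∀ H → All (λ G → G ≼ H ⊎ H ≼ G) c → Any (λ F → toℕ (rank F) ≡ toℕ (rank H)) c
    found H comparable = Any.map (λ H≈F → ≡.sym (toℕ-rank-cong H≈F)) (maximal H comparable)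

    inner : ∀ (j : Fin 4) → Any (λ F → toℕ (rank F) ≡ toℕ (middle j)) c
    inner j with Any.any? (λ F → toℕ (rank F) ℕ.≟ toℕ (middle j)) c
    ... | yes met = met
    ... | no unmet with locate (lower j) c chain | locate (upper j) c chain
    ...   | F , F≡ , onlyF | G , G≡ , onlyG with diamond⋖ F G
            (≡.trans (≡.cong toℕ G≡) (≡.cong (2 ℕ.+_) (≡.sym (≡.trans (≡.cong toℕ F≡) (toℕ-lower j)))))
    ...     | H , _ , _ , (F⋖H , H⋖G) , _ = contradiction
              (≡.subst (λ r → Any (λ F → toℕ (rank F) ≡ r) c) rankH
                (found H (All.zipWith comparable (All.zip (onlyF , onlyG) , All.¬Any⇒All¬ c unmet)))) unmet
      where
      rankH : toℕ (rank H) ≡ toℕ (middle j)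
      rankH = ≡.trans (rank-⋖ F⋖H) (≡.trans (≡.cong (suc ∘ toℕ) F≡) (≡.trans (≡.cong suc (toℕ-lower j)) (≡.sym (toℕ-middle j))))
      comparable : ∀ {E} → ((rank E ≡ lower j → E ≡ F) × (rank E ≡ upper j → E ≡ G)) × toℕ (rank E) ≢ toℕ (middle j) →
                   E ≼ H ⊎ H ≼ E
      comparable {E} ((lo , hi) , E≢) with ℕ.<-cmp (toℕ (rank E)) (toℕ (middle j))
      ... | tri≈ _ E≡ _ = contradiction E≡ E≢
      ... | tri< E< _ _ with ℕ.m≤n⇒m<n∨m≡n E<
      ...   | inj₁ far< = inj₁ (far (≡.subst (_ ℕ.≤_) (≡.sym rankH) far<))
      ...   | inj₂ near = inj₁ (≡.subst (_≼ H) (≡.sym (lo (Fin.toℕ-injective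
                (≡.trans (ℕ.suc-injective (≡.trans near (toℕ-middle j))) (≡.sym (toℕ-lower j)))))) (cover F⋖H))
      comparable {E} ((lo , hi) , E≢) | tri> _ _ E> with ℕ.m≤n⇒m<n∨m≡n E>
      ...   | inj₁ far< = inj₂ (far (≡.subst (λ r → 2 ℕ.+ r ℕ.≤ _) (≡.sym rankH) far<))
      ...   | inj₂ near = inj₂ (≡.subst (H ≼_) (≡.sym (hi (Fin.toℕ-injective
                (≡.sym (≡.trans (≡.cong suc (≡.sym (toℕ-middle j))) near))))) (cover H⋖G))

    meets : ∀ (k : Fin 6) → Any (λ F → toℕ (rank F) ≡ toℕ k) c
    meets zero = found bot (All.universal (λ F → inj₂ (bot≼ F)) c)
    meets (suc zero)                   = inner zero
    meets (suc (suc zero))             = inner (suc zero)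
    meets (suc (suc (suc zero)))       = inner (suc (suc zero))
    meets (suc (suc (suc (suc zero)))) = inner (suc (suc (suc zero)))
    meets (suc (suc (suc (suc (suc zero))))) = found top (All.universal (λ F → inj₁ (≼top F)) c)

-- Flag-connectedness

pattern 0F = zero
pattern 1F = suc zero
pattern 2F = suc (suc zero)
pattern 3F = suc (suc (suc zero))
pattern 4F = suc (suc (suc (suc zero)))
pattern 5F = suc (suc (suc (suc (suc zero))))

module Flags (K e : ℤ) where
  open FaceLattice K e public
  open RankedPoset rankedPoset using (Flag; face; face-rank; face-mono; _≈ᶠ_; Adjacent) public
  open FlagPaths rankedPoset using (Path; done; step; path-refl; path-trans; path-sym; path-ℤ; path⇒star) public

  vertexOf : Bool → ℤ → ℤ
  vertexOf false s = s
  vertexOf true  s = s + 1ℤ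

  facetOf : Bool → ℤ → ℤ → ℤ
  facetOf false i j = i
  facetOf true  i j = i + 1ℤ + + 8 * K * j

  vertexOf-cong : ∀ a {s s′} → s ≡[ + 4 ] s′ → vertexOf a s ≡[ + 4 ] vertexOf a s′
  vertexOf-cong false p = p
  vertexOf-cong true  p = mod-+ p mod-refl

  facetOf-cong : ∀ b {i i′ j j′} → i ≡[ + 32 * K ] i′ → j ≡[ + 4 ] j′ → facetOf b i j ≡[ + 32 * K ] facetOf b i′ j′
  facetOf-cong false p q = p
  facetOf-cong true  p q = next-cong p q

  -- Computing the index of the polygon from s, m and i leaves no incidence condition: any five
  -- coordinates form a flag. The bits choose one of the two vertices of the edge and one of the two
  -- facets of the polygon.
  flagFace : Bool → ℤ → ℤ → ℤ → Bool → Fin 6 → Face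
  flagFace a s m i b 0F = bot
  flagFace a s m i b 1F = vert (vertexOf a s)
  flagFace a s m i b 2F = edge s m
  flagFace a s m i b 3F = poly i (e * s * i + m)
  flagFace a s m i b 4F = facet (facetOf b i (e * s * i + m))
  flagFace a s m i b 5F = top

  flagFace-rank : ∀ a s m i b k → rank (flagFace a s m i b k) ≡ k
  flagFace-rank a s m i b 0F = refl
  flagFace-rank a s m i b 1F = refl
  flagFace-rank a s m i b 2F = refl
  flagFace-rank a s m i b 3F = refl
  flagFace-rank a s m i b 4F = refl
  flagFace-rank a s m i b 5F = refl

  flagFace-⋖ : ∀ a s m i b (k : Fin 5) → flagFace a s m i b (inject₁ k) ⋖ flagFace a s m i b (suc k)
  flagFace-⋖ a     s m i b     0F = bot⋖vert
  flagFace-⋖ false s m i b     1F = vert⋖edge (inj₁ mod-refl)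
  flagFace-⋖ true  s m i b     1F = vert⋖edge (inj₂ mod-refl)
  flagFace-⋖ a     s m i b     2F = edge⋖poly mod-refl
  flagFace-⋖ a     s m i false 3F = poly⋖facet (inj₁ mod-refl)
  flagFace-⋖ a     s m i true  3F = poly⋖facet (inj₂ mod-refl)
  flagFace-⋖ a     s m i b     4F = facet⋖top

  flagFace-mono : ∀ a s m i b {k l} → k Fin.≤ l → flagFace a s m i b k ≼ flagFace a s m i b l
  flagFace-mono a s m i b {k} {l} k≤l with ℕ.m≤n⇒m<n∨m≡n k≤l
  ... | inj₂ eq with Fin.toℕ-injective eq
  ...   | refl = equal ≈-refl
  flagFace-mono a s m i b {k} {suc l} k≤l | inj₁ k<l with ℕ.m≤n⇒m<n∨m≡n k<l
  ... | inj₁ k≪l = far (≡.subst₂ (λ x y → 2 ℕ.+ toℕ x ℕ.≤ toℕ y)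
    (≡.sym (flagFace-rank a s m i b k)) (≡.sym (flagFace-rank a s m i b (suc l))) k≪l)
  ... | inj₂ eq with Fin.toℕ-injective {i = k} {j = inject₁ l} (≡.trans (ℕ.suc-injective eq) (≡.sym (Fin.toℕ-inject₁ l)))
  ...   | refl = cover (flagFace-⋖ a s m i b l)

  flag : Bool → ℤ → ℤ → ℤ → Bool → Flag
  flag a s m i b = record
    { face      = flagFace a s m i b
    ; face-rank = flagFace-rank a s m i b
    ; face-mono = flagFace-mono a s m i b
    }

  flag-≈ : ∀ {Φ Ψ : Flag} → face Φ 1F ≈ face Ψ 1F → face Φ 2F ≈ face Ψ 2F → face Φ 3F ≈ face Ψ 3F →
           face Φ 4F ≈ face Ψ 4F → Φ ≈ᶠ Ψ
  flag-≈ {Φ} {Ψ} p q r s 0F = rank-0 (face-rank Φ 0F) (face-rank Ψ 0F)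
    where
    rank-0 : ∀ {F G} → rank F ≡ 0F → rank G ≡ 0F → F ≈ G
    rank-0 {bot} {bot} _ _ = bot≈
  flag-≈ p q r s 1F = p
  flag-≈ p q r s 2F = q
  flag-≈ p q r s 3F = r
  flag-≈ p q r s 4F = s
  flag-≈ {Φ} {Ψ} p q r s 5F = rank-5 (face-rank Φ 5F) (face-rank Ψ 5F)
    where
    rank-5 : ∀ {F G} → rank F ≡ 5F → rank G ≡ 5F → F ≈ G
    rank-5 {top} {top} _ _ = top≈

  Coordinates : Flag → Set
  Coordinates Φ = ∃[ a ] ∃[ s ] ∃[ m ] ∃[ i ] ∃[ b ] Φ ≈ᶠ flag a s m i b

  coordinates : ∀ Φ → Coordinates Φ
  coordinates Φ = build _ _ _ _ refl refl refl refl (face-rank Φ 1F) (face-rank Φ 2F) (face-rank Φ 3F) (face-rank Φ 4F)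
    (inc 1F) (inc 2F) (inc 3F)
    where
    inc : ∀ (k : Fin 5) → face Φ (inject₁ k) ⋖ face Φ (suc k)
    inc k = ≼⇒⋖ (face-mono Φ (ℕ.≤-trans (ℕ.≤-reflexive (Fin.toℕ-inject₁ k)) (ℕ.n≤1+n _)))
      (≡.trans (≡.cong toℕ (face-rank Φ (suc k)))
        (≡.cong suc (≡.sym (≡.trans (≡.cong toℕ (face-rank Φ (inject₁ k))) (Fin.toℕ-inject₁ k)))))
    ≡⇒≈ : ∀ {F G H} → F ≡ G → G ≈ H → F ≈ H
    ≡⇒≈ refl p = p
    build : ∀ V E P C → face Φ 1F ≡ V → face Φ 2F ≡ E → face Φ 3F ≡ P → face Φ 4F ≡ C →
            rank V ≡ 1F → rank E ≡ 2F → rank P ≡ 3F → rank C ≡ 4F → V ⋖ E → E ⋖ P → P ⋖ C →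
            Coordinates Φ
    build (vert v) (edge s m) (poly i j) (facet c) eqV eqE eqP eqC _ _ _ _ (vert⋖edge p) (edge⋖poly q) (poly⋖facet r)
      with bit p | bit′ r
      where
      bit : v ≡[ + 4 ] s ⊎ v ≡[ + 4 ] s + 1ℤ → ∃[ a ] v ≡[ + 4 ] vertexOf a s
      bit (inj₁ p) = false , p
      bit (inj₂ p) = true , p
      bit′ : c ≡[ + 32 * K ] i ⊎ c ≡[ + 32 * K ] i + 1ℤ + + 8 * K * j →
             ∃[ b ] c ≡[ + 32 * K ] facetOf b i (e * s * i + m)
      bit′ (inj₁ r) = false , r
      bit′ (inj₂ r) = true , mod-trans r (next-cong (mod-refl {a = i}) q)
    ... | a , p′ | b , r′ = a , s , m , i , b , flag-≈ {Φ} {flag a s m i b} (≡⇒≈ eqV (vert≈ p′)) (≡⇒≈ eqE ≈-refl)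
      (≡⇒≈ eqP (poly≈ mod-refl q)) (≡⇒≈ eqC (facet≈ r′))

  inFlag : ∀ F → ∃[ Φ ] ∃[ k ] face Φ k ≈ F
  inFlag bot        = flag false 0ℤ 0ℤ 0ℤ false , 0F , bot≈
  inFlag (vert v)   = flag false v 0ℤ 0ℤ false , 1F , ≈-refl
  inFlag (edge s m) = flag false s m 0ℤ false , 2F , ≈-refl
  inFlag (poly i j) = flag false 0ℤ j i false , 3F , poly≈ mod-refl (≡⇒≡[] (solve (e ∷ i ∷ j ∷ [])))
  inFlag (facet c)  = flag false 0ℤ 0ℤ c false , 4F , ≈-refl
  inFlag top        = flag false 0ℤ 0ℤ 0ℤ false , 5F , top≈

  Except : Fin 4 → Flag → Flag → Set
  Except j Φ Ψ = ∀ k → k ≢ middle j → face Φ k ≈ face Ψ k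

  except : ∀ Φ Ψ j → j ≡ 0F ⊎ face Φ 1F ≈ face Ψ 1F → j ≡ 1F ⊎ face Φ 2F ≈ face Ψ 2F →
           j ≡ 2F ⊎ face Φ 3F ≈ face Ψ 3F → j ≡ 3F ⊎ face Φ 4F ≈ face Ψ 4F → Except j Φ Ψ
  except Φ Ψ j p q r s 0F _  = rank-0 (face-rank Φ 0F) (face-rank Ψ 0F)
    where
    rank-0 : ∀ {F G} → rank F ≡ 0F → rank G ≡ 0F → F ≈ G
    rank-0 {bot} {bot} _ _ = bot≈
  except Φ Ψ j p q r s 1F k≢ = [ (λ { refl → contradiction refl k≢ }) , id ]′ p
  except Φ Ψ j p q r s 2F k≢ = [ (λ { refl → contradiction refl k≢ }) , id ]′ q
  except Φ Ψ j p q r s 3F k≢ = [ (λ { refl → contradiction refl k≢ }) , id ]′ r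
  except Φ Ψ j p q r s 4F k≢ = [ (λ { refl → contradiction refl k≢ }) , id ]′ s
  except Φ Ψ j p q r s 5F _  = rank-5 (face-rank Φ 5F) (face-rank Ψ 5F)
    where
    rank-5 : ∀ {F G} → rank F ≡ 5F → rank G ≡ 5F → F ≈ G
    rank-5 {top} {top} _ _ = top≈

  -- Equality of faces is decidable, so flags that can differ in rank j only are adjacent or equal,
  -- and its uses need not decide which.
  single : ∀ {J : Fin 4 → Set} {Φ Ψ} j → J j →
           j ≡ 0F ⊎ face Φ 1F ≈ face Ψ 1F → j ≡ 1F ⊎ face Φ 2F ≈ face Ψ 2F →
           j ≡ 2F ⊎ face Φ 3F ≈ face Ψ 3F → j ≡ 3F ⊎ face Φ 4F ≈ face Ψ 4F → Path J Φ Ψ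
  single {Φ = Φ} {Ψ} j Jj p q r s with ≈-dec (face Φ (middle j)) (face Ψ (middle j))
                                  (≡.trans (face-rank Φ _) (≡.sym (face-rank Ψ _)))
  ... | no ≉  = step j Jj (≉ , except Φ Ψ j p q r s) path-refl
  ... | yes ≈j = done λ k → case k Fin.≟ middle j of λ where
    (yes refl) → ≈j
    (no k≢)    → except Φ Ψ j p q r s k k≢

  module _ {J : Fin 4 → Set} where

    -- Alternating steps of ranks 3 and 2 run through the polygons with first facet θ s m z. Since θ
    -- is invertible, the walk visits every polygon on the edge.
    around-edge : J 2F → J 3F → ∀ a s m i b i′ b′ → Path J (flag a s m i b) (flag a s m i′ b′)
    around-edge J₂ J₃ a s m i b i′ b′ = path-trans (to-line i b) (path-sym (to-line i′ b′))
      where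
      side : ℤ → ℤ
      side i = e * s * i + m

      flip : ∀ i b b′ → Path J (flag a s m i b) (flag a s m i b′)
      flip i b b′ = single 3F J₃ (inj₂ ≈-refl) (inj₂ ≈-refl) (inj₂ ≈-refl) (inj₁ refl)

      line : ℤ → Flag
      line z = flag a s m (θ s m z) false

      line-next : ∀ z → Path J (line z) (line (z + 1ℤ))
      line-next z = path-trans (flip (θ s m z) false true)
        (single 2F J₂ (inj₂ ≈-refl) (inj₂ ≈-refl) (inj₁ refl) (inj₂ (facet≈ next≡)))
        where
        next≡ : θ s m z + 1ℤ + + 8 * K * side (θ s m z) ≡[ + 32 * K ] θ s m (z + 1ℤ)
        next≡ = mod-trans (mod-+ (mod-refl {a = θ s m z + 1ℤ}) (scale (mod-+ (mod-*ˡ (e * s) (mod4-of-8 (θ-mod8 s m z))) mod-refl)))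
          (mod-sym (mod-trans (≡⇒≡[] (≡.cong (θ s m) (pad z K)))
            (mod-trans (θ-next s m z 0ℤ) (≡⇒≡[] (≡.cong (λ x → θ s m z + 1ℤ + + 8 * K * x) (drop e s z m))))))
          where
          pad : ∀ z K → z + 1ℤ ≡ z + 1ℤ + + 8 * K * 0ℤ
          pad = solve-∀
          drop : ∀ e s z m → 0ℤ + e * s * z + m ≡ e * s * z + m
          drop = solve-∀

      to-line : ∀ i b → Path J (flag a s m i b) (line 0ℤ)
      to-line i b = path-trans (flip i b false) (path-sym (path-trans
        (path-ℤ line line-next (θ (- s) (- m) i))
        (done (flag-≈ {line (θ (- s) (- m) i)} {flag a s m i false} ≈-refl ≈-refl
          (poly≈ i≡ (mod-+ (mod-*ˡ (e * s) (mod4 i≡)) mod-refl)) (facet≈ i≡)))))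
        where
        i≡ : θ s m (θ (- s) (- m) i) ≡[ + 32 * K ] i
        i≡ = θ-inverse s m i

    -- The next edge of the polygon must keep e s i + m, so m drops by e i whenever s grows by 1.
    around-polygon : J 0F → J 1F → ∀ a s m i b a′ s′ m′ → e * s * i + m ≡[ + 4 ] e * s′ * i + m′ →
                     Path J (flag a s m i b) (flag a′ s′ m′ i b)
    around-polygon J₀ J₁ a s m i b a′ s′ m′ p = path-trans (path-trans (flip s m a false) start)
      (path-trans (path-ℤ line line-next (s′ - s)) (path-trans (done finish) (flip s′ m′ false a′)))
      where
      flip : ∀ s m a a′ → Path J (flag a s m i b) (flag a′ s m i b)
      flip s m a a′ = single 0F J₀ (inj₁ refl) (inj₂ ≈-refl) (inj₂ ≈-refl) (inj₂ ≈-refl)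

      line : ℤ → Flag
      line z = flag false (s + z) (m - z * e * i) i b

      start : Path J (flag false s m i b) (line 0ℤ)
      start = done (flag-≈ {flag false s m i b} {line 0ℤ} (vert≈ (≡⇒≡[] (s+0 s))) (edge≈ (≡⇒≡[] (s+0 s)) (≡⇒≡[] (solve (m ∷ e ∷ i ∷ []))))
          (poly≈ mod-refl j≡) (facet≈ (facetOf-cong b mod-refl j≡)))
        where
        s+0 : ∀ s → s ≡ s + 0ℤ
        s+0 = solve-∀
        j≡ : e * s * i + m ≡[ + 4 ] e * (s + 0ℤ) * i + (m - 0ℤ * e * i)
        j≡ = ≡⇒≡[] (solve (e ∷ s ∷ i ∷ m ∷ []))

      line-next : ∀ z → Path J (line z) (line (z + 1ℤ))
      line-next z = path-trans (flip (s + z) (m - z * e * i) false true)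
        (single 1F J₁ (inj₂ (vert≈ (≡⇒≡[] (assoc′ s z)))) (inj₁ refl) (inj₂ (poly≈ mod-refl j≡))
          (inj₂ (facet≈ (facetOf-cong b mod-refl j≡))))
        where
        assoc′ : ∀ s z → s + z + 1ℤ ≡ s + (z + 1ℤ)
        assoc′ = solve-∀
        j≡ : e * (s + z) * i + (m - z * e * i) ≡[ + 4 ] e * (s + (z + 1ℤ)) * i + (m - (z + 1ℤ) * e * i)
        j≡ = ≡⇒≡[] (solve (e ∷ s ∷ i ∷ m ∷ z ∷ []))

      finish : line (s′ - s) ≈ᶠ flag false s′ m′ i b
      finish = flag-≈ {line (s′ - s)} {flag false s′ m′ i b} (vert≈ s≡) (edge≈ s≡ m≡) (poly≈ mod-refl j≡) (facet≈ (facetOf-cong b mod-refl j≡))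
        where
        add-sub : ∀ s s′ → s + (s′ - s) ≡ s′
        add-sub = solve-∀
        s≡ : s + (s′ - s) ≡[ + 4 ] s′
        s≡ = ≡⇒≡[] (add-sub s s′)
        out : ∀ e s s′ i m → m - (s′ - s) * e * i ≡ e * s * i + m - e * s′ * i
        out = solve-∀
        m≡ : m - (s′ - s) * e * i ≡[ + 4 ] m′
        m≡ = mod-trans (≡⇒≡[] (out e s s′ i m)) (mod-trans (mod-+ p (mod-refl {a = - (e * s′ * i)})) (≡⇒≡[] (solve (e ∷ s′ ∷ i ∷ m′ ∷ []))))
        j≡ : e * (s + (s′ - s)) * i + (m - (s′ - s) * e * i) ≡[ + 4 ] e * s′ * i + m′
        j≡ = side-cong s≡ (mod-refl {a = i}) m≡

    module _ (e² : e * e ≡ 1ℤ) (J₁ : J 1F) (J₂ : J 2F) where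

      private
        -- The section between the vertex v and the facet c is an 8-gon with 16 flags. A quarter
        -- turn, four steps of ranks 1 and 2, replaces m by m + e.
        line-next : ∀ v c m → Path J (flag false v m c false) (flag false v (m + e) c false)
        line-next v c m = path-trans turn₁ (path-trans turn₂ (path-trans turn₃ turn₄))
          where
          m₁ = m + e * c
          j₁ = e * (v - 1ℤ) * (c - 1ℤ) + m₁
          i₁ = c - 1ℤ - + 8 * K * j₁
          m₂ = m₁ - e * i₁

          same₁ : ∀ e v c m → e * v * c + m ≡ e * (v - 1ℤ) * c + (m + e * c)
          same₁ = solve-∀
          same₂ : ∀ e v i m → e * (v - 1ℤ) * i + m ≡ e * v * i + (m - e * i)
          same₂ = solve-∀
          i₁-mod4 : i₁ ≡[ + 4 ] c - 1ℤ
          i₁-mod4 = below-mod4 c j₁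
          up : c ≡[ + 32 * K ] i₁ + 1ℤ + + 8 * K * (e * (v - 1ℤ) * i₁ + m₁)
          up = mod-trans (≡⇒≡[] (below-next c j₁)) (mod-+ (mod-refl {a = i₁ + 1ℤ})
            (scale (mod-+ (mod-*ˡ (e * (v - 1ℤ)) (mod-sym i₁-mod4)) (mod-refl {a = m₁}))))
          m₂≡ : m₂ ≡[ + 4 ] m + e
          m₂≡ = mod-trans (mod-+ (mod-refl {a = m₁}) (mod-neg (mod-*ˡ e i₁-mod4))) (≡⇒≡[] (simp m e c))
            where
            simp : ∀ m e c → m + e * c + - (e * (c - 1ℤ)) ≡ m + e
            simp = solve-∀

          turn₁ : Path J (flag false v m c false) (flag true (v - 1ℤ) m₁ c false)
          turn₁ = single 1F J₁ (inj₂ (vert≈ (≡⇒≡[] (predecessor v)))) (inj₁ refl)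
            (inj₂ (poly≈ mod-refl (≡⇒≡[] (same₁ e v c m)))) (inj₂ ≈-refl)
          turn₂ : Path J (flag true (v - 1ℤ) m₁ c false) (flag true (v - 1ℤ) m₁ i₁ true)
          turn₂ = single 2F J₂ (inj₂ ≈-refl) (inj₂ ≈-refl) (inj₁ refl) (inj₂ (facet≈ up))
          turn₃ : Path J (flag true (v - 1ℤ) m₁ i₁ true) (flag false v m₂ i₁ true)
          turn₃ = single 1F J₁ (inj₂ (vert≈ (≡⇒≡[] (≡.sym (predecessor v))))) (inj₁ refl)
            (inj₂ (poly≈ mod-refl j≡)) (inj₂ (facet≈ (next-cong (mod-refl {a = i₁}) j≡)))
            where
            j≡ : e * (v - 1ℤ) * i₁ + m₁ ≡[ + 4 ] e * v * i₁ + m₂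
            j≡ = ≡⇒≡[] (same₂ e v i₁ m₁)
          turn₄ : Path J (flag false v m₂ i₁ true) (flag false v (m + e) c false)
          turn₄ = single 2F J₂ (inj₂ ≈-refl) (inj₂ (edge≈ mod-refl m₂≡)) (inj₁ refl) (inj₂ (facet≈ (mod-sym
            (mod-trans up (mod-+ (mod-refl {a = i₁ + 1ℤ}) (scale (≡⇒≡[] (same₂ e v i₁ m₁))))))))

        line : ∀ v c m m′ → Path J (flag false v m c false) (flag false v m′ c false)
        line v c m m′ = path-trans (done (flag-≈ {flag false v m c false} {g 0ℤ} ≈-refl (edge≈ mod-refl m≡)
            (poly≈ mod-refl (mod-+ (mod-refl {a = e * v * c}) m≡)) ≈-refl))
          -- Each quarter turn adds e, so e (m′ - m) of them add m′ - m, by e e = 1.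
          (path-trans (path-ℤ g next (e * (m′ - m)))
            (done (flag-≈ {g (e * (m′ - m))} {flag false v m′ c false} ≈-refl (edge≈ mod-refl m′≡)
              (poly≈ mod-refl (mod-+ (mod-refl {a = e * v * c}) m′≡)) ≈-refl)))
          where
          g : ℤ → Flag
          g z = flag false v (m + z * e) c false
          m≡ : m ≡[ + 4 ] m + 0ℤ * e
          m≡ = ≡⇒≡[] (solve (m ∷ e ∷ []))
          m′≡ : m + e * (m′ - m) * e ≡[ + 4 ] m′
          m′≡ = ≡⇒≡[] (≡.trans (out m m′ e) (≡.trans (≡.cong (λ x → m + x * (m′ - m)) e²) (solve (m ∷ m′ ∷ []))))
            where
            out : ∀ m m′ e → m + e * (m′ - m) * e ≡ m + e * e * (m′ - m)
            out = solve-∀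
          next : ∀ z → Path J (g z) (g (z + 1ℤ))
          next z = path-trans (line-next v c (m + z * e)) (done (flag-≈ {flag false v (m + z * e + e) c false} {g (z + 1ℤ)}
              ≈-refl (edge≈ mod-refl m≡′) (poly≈ mod-refl (mod-+ (mod-refl {a = e * v * c}) m≡′)) ≈-refl))
            where
            simp : ∀ m z e → m + z * e + e ≡ m + (z + 1ℤ) * e
            simp = solve-∀
            m≡′ : m + z * e + e ≡[ + 4 ] m + (z + 1ℤ) * e
            m≡′ = ≡⇒≡[] (simp m z e)

        to-line : ∀ a s m i b → ∃[ m₁ ] Path J (flag a s m i b) (flag false (vertexOf a s) m₁ (facetOf b i (e * s * i + m)) false)
        to-line a s m i b = turn a , path-trans (lower-facet b) (lower-vertex a)
          where
          c = facetOf b i (e * s * i + m)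
          turn : Bool → ℤ
          turn false = m
          turn true  = m - e * c
          lower-facet : ∀ b → Path J (flag a s m i b) (flag a s m (facetOf b i (e * s * i + m)) false)
          lower-facet false = path-refl
          lower-facet true  = single 2F J₂ (inj₂ ≈-refl) (inj₂ ≈-refl) (inj₁ refl) (inj₂ ≈-refl)
          same : ∀ e s c m → e * s * c + m ≡ e * (s + 1ℤ) * c + (m - e * c)
          same = solve-∀
          lower-vertex : ∀ a → Path J (flag a s m c false) (flag false (vertexOf a s) (turn a) c false)
          lower-vertex false = path-refl
          lower-vertex true  = single 1F J₁ (inj₂ ≈-refl) (inj₁ refl)
            (inj₂ (poly≈ mod-refl (≡⇒≡[] (same e s c m)))) (inj₂ ≈-refl)

      around-vertex-facet : ∀ a s m i b a′ s′ m′ i′ b′ →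
        vertexOf a s ≡[ + 4 ] vertexOf a′ s′ →
        facetOf b i (e * s * i + m) ≡[ + 32 * K ] facetOf b′ i′ (e * s′ * i′ + m′) →
        Path J (flag a s m i b) (flag a′ s′ m′ i′ b′)
      around-vertex-facet a s m i b a′ s′ m′ i′ b′ v≡ c≡ with to-line a s m i b | to-line a′ s′ m′ i′ b′
      ... | m₁ , ps | m₂ , qs = path-trans ps (path-trans
        (done (flag-≈ {flag false v m₁ c false} {flag false v′ m₁ c′ false} (vert≈ v≡) (edge≈ v≡ mod-refl)
          (poly≈ c≡ (side-cong v≡ c≡ mod-refl)) (facet≈ c≡)))
        (path-trans (line v′ c′ m₁ m₂) (path-sym qs)))
        where
        v  = vertexOf a s
        v′ = vertexOf a′ s′
        c  = facetOf b i (e * s * i + m)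
        c′ = facetOf b′ i′ (e * s′ * i′ + m′)

  module _ (e² : e * e ≡ 1ℤ) where

    -- A common edge or a common polygon splits the flags into two sides that are treated
    -- independently. Otherwise ranks 1 and 2 are free: a walk around an edge corrects the facet and
    -- one around a polygon the vertex, if needed, and the rest happens in the 8-gon between that
    -- vertex and that facet.
    connect : ∀ {J : Fin 4 → Set} a s m i b a′ s′ m′ i′ b′ →
      (∀ j → J j ⊎ face (flag a s m i b) (middle j) ≈ face (flag a′ s′ m′ i′ b′) (middle j)) →
      Path J (flag a s m i b) (flag a′ s′ m′ i′ b′)
    connect {J} a s m i b a′ s′ m′ i′ b′ free = go (free 0F) (free 1F) (free 2F) (free 3F)
      where
      Φ = flag a s m i b
      Ψ = flag a′ s′ m′ i′ b′
      j  = e * s * i + m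
      j′ = e * s′ * i′ + m′
      c′ = facetOf b′ i′ j′

      common-edge : J 0F ⊎ face Φ 1F ≈ face Ψ 1F → s ≡[ + 4 ] s′ → m ≡[ + 4 ] m′ →
                    J 2F ⊎ face Φ 3F ≈ face Ψ 3F → J 3F ⊎ face Φ 4F ≈ face Ψ 4F → Path J Φ Ψ
      common-edge p₀ s≡ m≡ p₂ p₃ = path-trans (first p₀) (second p₂ p₃)
        where
        Ω = flag a′ s m i b
        v≡ : face Ω 1F ≈ face Ψ 1F
        v≡ = vert≈ (vertexOf-cong a′ s≡)
        first : J 0F ⊎ face Φ 1F ≈ face Ψ 1F → Path J Φ Ω
        first (inj₁ J₀) = single 0F J₀ (inj₁ refl) (inj₂ ≈-refl) (inj₂ ≈-refl) (inj₂ ≈-refl)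
        first (inj₂ p)  = done (flag-≈ {Φ} {Ω} (≈-trans p (≈-sym v≡)) ≈-refl ≈-refl ≈-refl)
        second : J 2F ⊎ face Φ 3F ≈ face Ψ 3F → J 3F ⊎ face Φ 4F ≈ face Ψ 4F → Path J Ω Ψ
        second (inj₁ J₂) (inj₁ J₃) = path-trans (around-edge J₂ J₃ a′ s m i b i′ b′)
          (done (flag-≈ {flag a′ s m i′ b′} {Ψ} v≡ (edge≈ s≡ m≡) (poly≈ mod-refl j≡) (facet≈ (facetOf-cong b′ mod-refl j≡))))
          where
          j≡ : e * s * i′ + m ≡[ + 4 ] e * s′ * i′ + m′
          j≡ = side-cong s≡ (mod-refl {a = i′}) m≡
        second (inj₁ J₂) (inj₂ q)  = single 2F J₂ (inj₂ v≡) (inj₂ (edge≈ s≡ m≡)) (inj₁ refl) (inj₂ q)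
        second (inj₂ r)  (inj₁ J₃) = single 3F J₃ (inj₂ v≡) (inj₂ (edge≈ s≡ m≡)) (inj₂ r) (inj₁ refl)
        second (inj₂ r)  (inj₂ q)  = done (flag-≈ {Ω} {Ψ} v≡ (edge≈ s≡ m≡) r q)

      common-polygon : J 0F ⊎ face Φ 1F ≈ face Ψ 1F → J 1F → i ≡[ + 32 * K ] i′ → j ≡[ + 4 ] j′ →
                       J 3F ⊎ face Φ 4F ≈ face Ψ 4F → Path J Φ Ψ
      common-polygon p₀ J₁ i≡ j≡ p₃ = path-trans (first p₃) (second p₀)
        where
        Ω = flag a s m i b′
        c≡ : face Ω 4F ≈ face Ψ 4F
        c≡ = facet≈ (facetOf-cong b′ i≡ j≡)
        first : J 3F ⊎ face Φ 4F ≈ face Ψ 4F → Path J Φ Ω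
        first (inj₁ J₃) = single 3F J₃ (inj₂ ≈-refl) (inj₂ ≈-refl) (inj₂ ≈-refl) (inj₁ refl)
        first (inj₂ p)  = done (flag-≈ {Φ} {Ω} ≈-refl ≈-refl ≈-refl (≈-trans p (≈-sym c≡)))
        second : J 0F ⊎ face Φ 1F ≈ face Ψ 1F → Path J Ω Ψ
        second (inj₂ p)  = single 1F J₁ (inj₂ p) (inj₁ refl) (inj₂ (poly≈ i≡ j≡)) (inj₂ c≡)
        second (inj₁ J₀) = path-trans
          (around-polygon J₀ J₁ a s m i b′ a′ s′ m′ (mod-trans j≡ j′≡))
          (done (flag-≈ {flag a′ s′ m′ i b′} {Ψ} ≈-refl ≈-refl (poly≈ i≡ (mod-sym j′≡)) (facet≈ (facetOf-cong b′ i≡ (mod-sym j′≡)))))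
          where
          j′≡ : j′ ≡[ + 4 ] e * s′ * i + m′
          j′≡ = side-cong (mod-refl {a = s′}) (mod-sym i≡) mod-refl

      go : J 0F ⊎ face Φ 1F ≈ face Ψ 1F → J 1F ⊎ face Φ 2F ≈ face Ψ 2F →
           J 2F ⊎ face Φ 3F ≈ face Ψ 3F → J 3F ⊎ face Φ 4F ≈ face Ψ 4F → Path J Φ Ψ
      go p₀ (inj₂ (edge≈ s≡ m≡)) p₂ p₃ = common-edge p₀ s≡ m≡ p₂ p₃
      go p₀ (inj₁ J₁) (inj₂ (poly≈ i≡ j≡)) p₃ = common-polygon p₀ J₁ i≡ j≡ p₃
      go (inj₂ (vert≈ v≡)) (inj₁ J₁) (inj₁ J₂) (inj₂ (facet≈ c≡)) =
        around-vertex-facet e² J₁ J₂ a s m i b a′ s′ m′ i′ b′ v≡ c≡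
      go (inj₂ (vert≈ v≡)) (inj₁ J₁) (inj₁ J₂) (inj₁ J₃) = path-trans (around-edge J₂ J₃ a s m i b c′ false)
        (around-vertex-facet e² J₁ J₂ a s m c′ false a′ s′ m′ i′ b′ v≡ mod-refl)
      go (inj₁ J₀) (inj₁ J₁) (inj₁ J₂) (inj₂ (facet≈ c≡)) = path-trans
        (around-polygon J₀ J₁ a s m i b a′ s′ m₁ j≡)
        (around-vertex-facet e² J₁ J₂ a′ s′ m₁ i b a′ s′ m′ i′ b′ mod-refl
          (mod-trans (facetOf-cong b (mod-refl {a = i}) (mod-sym j≡)) c≡))
        where
        m₁ = j - e * s′ * i
        j≡ : j ≡[ + 4 ] e * s′ * i + m₁
        j≡ = ≡⇒≡[] (remainder j (e * s′ * i))
      go (inj₁ J₀) (inj₁ J₁) (inj₁ J₂) (inj₁ J₃) = path-trans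
        (around-polygon J₀ J₁ a s m i b a′ s′ m₁ (≡⇒≡[] (remainder j (e * s′ * i))))
        (path-trans (around-edge J₂ J₃ a′ s′ m₁ i b c′ false)
          (around-vertex-facet e² J₁ J₂ a′ s′ m₁ c′ false a′ s′ m′ i′ b′ mod-refl mod-refl))
        where
        m₁ = j - e * s′ * i

    strongly-flag-connected : ∀ Φ Ψ → ∃[ Ω ] Star (RankedPoset.StepWithin rankedPoset Φ Ψ) Φ Ω × Ω ≈ᶠ Ψ
    strongly-flag-connected Φ Ψ with coordinates Φ | coordinates Ψ
    ... | a , s , m , i , b , Φ≈ | a′ , s′ , m′ , i′ , b′ , Ψ≈ = path⇒star {Φ} {Ψ}
      (path-trans (done Φ≈) (path-trans (connect a s m i b a′ s′ m′ i′ b′ free) (done λ k → ≈-sym (Ψ≈ k))))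
      where
      free : ∀ j → ¬ face Φ (middle j) ≈ face Ψ (middle j) ⊎
             face (flag a s m i b) (middle j) ≈ face (flag a′ s′ m′ i′ b′) (middle j)
      free j with ≈-dec (face Φ (middle j)) (face Ψ (middle j)) (≡.trans (face-rank Φ _) (≡.sym (face-rank Ψ _)))
      ... | no ≉  = inj₁ ≉
      ... | yes p = inj₂ (≈-trans (≈-sym (Φ≈ (middle j))) (≈-trans p (Ψ≈ (middle j))))

    polytope : Polytope 4
    polytope = record
      { rankedPoset             = rankedPoset
      ; least                   = bot
      ; greatest                = top
      ; minimum                 = bot≼
      ; maximum                 = ≼top
      ; maximal-chain-length    = maximal-chain-length
      ; strongly-flag-connected = strongly-flag-connected
      ; diamond                 = λ {F} {G} F<G eq → case diamond⋖ F G eq of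
          λ (H₁ , H₂ , H₁≉H₂ , (F⋖H₁ , H₁⋖G) , (F⋖H₂ , H₂⋖G) , only) →
            H₁ , H₂ , H₁≉H₂ , (⋖⇒< F⋖H₁ , ⋖⇒< H₁⋖G) , (⋖⇒< F⋖H₂ , ⋖⇒< H₂⋖G) ,
            λ H F<H H<G → case consecutive F<H H<G eq of λ (F⋖H , H⋖G) → only H F⋖H H⋖G
      }

-- Automorphisms

module Automorphisms (K e : ℤ) where
  open Flags K e public

  record IsSymmetric (f : Face → Face) : Set where
    field
      rank-f : ∀ F → rank (f F) ≡ rank F
      cong   : ∀ {F G} → F ≈ G → f F ≈ f G
      incident : ∀ {F G} → F ⋖ G → f F ⋖ f G

    mono : ∀ {F G} → F ≼ G → f F ≼ f G
    mono (equal p) = equal (cong p)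
    mono (cover c) = cover (incident c)
    mono {F} {G} (far d) = far (≡.subst₂ (λ x y → 2 ℕ.+ toℕ x ℕ.≤ toℕ y) (≡.sym (rank-f F)) (≡.sym (rank-f G)) d)

  automorphism : (f g : Face → Face) → IsSymmetric f → IsSymmetric g →
                 (∀ F → f (g F) ≈ F) → (∀ F → g (f F) ≈ F) → PosetIsomorphism poset poset
  automorphism f g sf sg fg gf = record
    { ⟦_⟧ = f
    ; isOrderIsomorphism = record
      { isOrderMonomorphism = record
        { isOrderHomomorphism = record { cong = sf.cong ; mono = sf.mono }
        ; injective = λ p → ≈-trans (≈-sym (gf _)) (≈-trans (sg.cong p) (gf _))
        ; cancel = λ p → ≼-trans (equal (≈-sym (gf _))) (≼-trans (sg.mono p) (equal (gf _)))
        }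
      ; surjective = λ F → g F , λ p → ≈-trans (sf.cong p) (fg F)
      }
    }
    where
    module sf = IsSymmetric sf
    module sg = IsSymmetric sg

  -- `rotate 1ℤ 0ℤ` is σ₁ and `rotate 0ℤ e` is σ₂²; the two parameters are exponents in the abelian
  -- group that they generate.
  rotate : ℤ → ℤ → Face → Face
  rotate a u bot        = bot
  rotate a u (vert v)   = vert (v + a)
  rotate a u (edge s m) = edge (s + a) (m + u)
  rotate a u (poly i j) = poly (θ a u i) (j + e * a * i + u)
  rotate a u (facet c)  = facet (θ a u c)
  rotate a u top        = top

  shift : ℤ → Face → Face
  shift b bot        = bot
  shift b (vert v)   = vert v
  shift b (edge s m) = edge s (m - e * s * b)
  shift b (poly i j) = poly (i + b) j
  shift b (facet c)  = facet (c + b)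
  shift b top        = top

  -- The involution σ₁ σ₂. It exchanges the vertices of the edge (0 , 0) and reverses the cycle of
  -- the vertices and that of the facets.
  turn : Face → Face
  turn bot        = bot
  turn (vert v)   = vert (1ℤ - v)
  turn (edge s m) = edge (- s) (m - e * s)
  turn (poly i j) = poly (- i - 1ℤ - + 8 * K * j) j
  turn (facet c)  = facet (- c)
  turn top        = top

  rotate-cong : ∀ {a a′ u u′ F G} → a ≡[ + 4 ] a′ → u ≡[ + 4 ] u′ → F ≈ G → rotate a u F ≈ rotate a′ u′ G
  rotate-cong a u bot≈        = bot≈
  rotate-cong a u (vert≈ p)   = vert≈ (mod-+ p a)
  rotate-cong a u (edge≈ p q) = edge≈ (mod-+ p a) (mod-+ q u)
  rotate-cong a u (poly≈ p q) = poly≈ (θ-cong a u p) (mod-+ (mod-+ q (mod-* (mod-*ˡ e a) (mod4 p))) u)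
  rotate-cong a u (facet≈ p)  = facet≈ (θ-cong a u p)
  rotate-cong a u top≈        = top≈

  rotate-isSymmetric : ∀ a u → IsSymmetric (rotate a u)
  rotate-isSymmetric a u = record
    { rank-f   = λ { bot → refl ; (vert _) → refl ; (edge _ _) → refl ; (poly _ _) → refl ; (facet _) → refl ; top → refl }
    ; cong     = rotate-cong mod-refl mod-refl
    ; incident = incident
    }
    where
    swap : ∀ s a → s + 1ℤ + a ≡ s + a + 1ℤ
    swap = solve-∀
    collect : ∀ e s a i m u → e * s * i + m + e * a * i + u ≡ e * (s + a) * i + (m + u)
    collect = solve-∀
    incident : ∀ {F G} → F ⋖ G → rotate a u F ⋖ rotate a u G
    incident bot⋖vert = bot⋖vert
    incident (vert⋖edge {s = s} r) = vert⋖edge (Sum.map (λ p → mod-+ p mod-refl)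
      (λ p → mod-trans (mod-+ p (mod-refl {a = a})) (≡⇒≡[] (swap s a))) r)
    incident (edge⋖poly {s} {m} {i} r) = edge⋖poly (mod-trans
      (mod-+ (mod-+ r (mod-refl {a = e * a * i})) (mod-refl {a = u}))
      (mod-trans (≡⇒≡[] (collect e s a i m u))
        (mod-+ (mod-*ˡ (e * (s + a)) (mod-sym (mod4-of-8 (θ-mod8 a u i)))) (mod-refl {a = m + u}))))
    incident (poly⋖facet {i} {j} r) = poly⋖facet (Sum.map (θ-cong (mod-refl {a = a}) (mod-refl {a = u}))
      (λ p → mod-trans (θ-cong (mod-refl {a = a}) (mod-refl {a = u}) p) (θ-next a u i j)) r)
    incident facet⋖top = facet⋖top

  rotate-+ : ∀ a u a′ u′ F → rotate a u (rotate a′ u′ F) ≈ rotate (a + a′) (u + u′) F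
  rotate-+ a u a′ u′ bot        = bot≈
  rotate-+ a u a′ u′ (vert v)   = vert≈ (≡⇒≡[] (+-exchange v a a′))
  rotate-+ a u a′ u′ (edge s m) = edge≈ (≡⇒≡[] (+-exchange s a a′)) (≡⇒≡[] (+-exchange m u u′))
  rotate-+ a u a′ u′ (poly i j) = poly≈ (θ-+ a u a′ u′ i)
    (mod-trans (mod-+ (mod-+ (mod-refl {a = j + e * a′ * i + u′}) (mod-*ˡ (e * a) (mod4-of-8 (θ-mod8 a′ u′ i)))) (mod-refl {a = u}))
      (≡⇒≡[] (solve (e ∷ a ∷ a′ ∷ i ∷ j ∷ u ∷ u′ ∷ []))))
  rotate-+ a u a′ u′ (facet c)  = facet≈ (θ-+ a u a′ u′ c)
  rotate-+ a u a′ u′ top        = top≈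

  rotate-0 : ∀ F → rotate 0ℤ 0ℤ F ≈ F
  rotate-0 bot        = bot≈
  rotate-0 (vert v)   = vert≈ (≡⇒≡[] (ℤ.+-identityʳ v))
  rotate-0 (edge s m) = edge≈ (≡⇒≡[] (ℤ.+-identityʳ s)) (≡⇒≡[] (ℤ.+-identityʳ m))
  rotate-0 (poly i j) = poly≈ (≡⇒≡[] (θ-0 i)) (≡⇒≡[] (solve (e ∷ i ∷ j ∷ [])))
  rotate-0 (facet c)  = facet≈ (≡⇒≡[] (θ-0 c))
  rotate-0 top        = top≈

  rotate-inverse : ∀ a u a′ u′ → a + a′ ≡ 0ℤ → u + u′ ≡ 0ℤ → ∀ F → rotate a u (rotate a′ u′ F) ≈ F
  rotate-inverse a u a′ u′ p q F = ≈-trans (rotate-+ a u a′ u′ F)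
    (≈-trans (rotate-cong (≡⇒≡[] p) (≡⇒≡[] q) (≈-refl {F})) (rotate-0 F))

  Rotate : ℤ → ℤ → PosetIsomorphism poset poset
  Rotate a u = automorphism (rotate a u) (rotate (- a) (- u)) (rotate-isSymmetric a u) (rotate-isSymmetric (- a) (- u))
    (rotate-inverse a u (- a) (- u) (ℤ.+-inverseʳ a) (ℤ.+-inverseʳ u))
    (rotate-inverse (- a) (- u) a u (ℤ.+-inverseˡ a) (ℤ.+-inverseˡ u))

  shift-cong : ∀ {b b′ F G} → b ≡[ + 32 * K ] b′ → F ≈ G → shift b F ≈ shift b′ G
  shift-cong b bot≈        = bot≈
  shift-cong b (vert≈ p)   = vert≈ p
  shift-cong b (edge≈ p q) = edge≈ p (mod-+ q (mod-neg (mod-* (mod-*ˡ e p) (mod4 b))))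
  shift-cong b (poly≈ p q) = poly≈ (mod-+ p b) q
  shift-cong b (facet≈ p)  = facet≈ (mod-+ p b)
  shift-cong b top≈        = top≈

  shift-isSymmetric : ∀ b → IsSymmetric (shift b)
  shift-isSymmetric b = record
    { rank-f   = λ { bot → refl ; (vert _) → refl ; (edge _ _) → refl ; (poly _ _) → refl ; (facet _) → refl ; top → refl }
    ; cong     = shift-cong mod-refl
    ; incident = incident
    }
    where
    collect : ∀ e s i m b → e * s * i + m ≡ e * s * (i + b) + (m - e * s * b)
    collect = solve-∀
    swap : ∀ i b x → i + 1ℤ + x + b ≡ i + b + 1ℤ + x
    swap = solve-∀
    incident : ∀ {F G} → F ⋖ G → shift b F ⋖ shift b G
    incident bot⋖vert = bot⋖vert
    incident (vert⋖edge r) = vert⋖edge r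
    incident (edge⋖poly {s} {m} {i} r) = edge⋖poly (mod-trans r (≡⇒≡[] (collect e s i m b)))
    incident (poly⋖facet {i} {j} r) = poly⋖facet (Sum.map (λ p → mod-+ p mod-refl)
      (λ p → mod-trans (mod-+ p (mod-refl {a = b})) (≡⇒≡[] (swap i b (+ 8 * K * j)))) r)
    incident facet⋖top = facet⋖top

  shift-+ : ∀ b b′ F → shift b (shift b′ F) ≈ shift (b + b′) F
  shift-+ b b′ bot        = bot≈
  shift-+ b b′ (vert v)   = ≈-refl
  shift-+ b b′ (edge s m) = edge≈ mod-refl (≡⇒≡[] (solve (e ∷ s ∷ m ∷ b ∷ b′ ∷ [])))
  shift-+ b b′ (poly i j) = poly≈ (≡⇒≡[] (+-exchange i b b′)) mod-refl
  shift-+ b b′ (facet c)  = facet≈ (≡⇒≡[] (+-exchange c b b′))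
  shift-+ b b′ top        = top≈

  shift-0 : ∀ F → shift 0ℤ F ≈ F
  shift-0 bot        = bot≈
  shift-0 (vert v)   = ≈-refl
  shift-0 (edge s m) = edge≈ mod-refl (≡⇒≡[] (solve (e ∷ s ∷ m ∷ [])))
  shift-0 (poly i j) = poly≈ (≡⇒≡[] (ℤ.+-identityʳ i)) mod-refl
  shift-0 (facet c)  = facet≈ (≡⇒≡[] (ℤ.+-identityʳ c))
  shift-0 top        = top≈

  shift-inverse : ∀ b b′ → b + b′ ≡ 0ℤ → ∀ F → shift b (shift b′ F) ≈ F
  shift-inverse b b′ p F = ≈-trans (shift-+ b b′ F) (≈-trans (shift-cong (≡⇒≡[] p) (≈-refl {F})) (shift-0 F))

  Shift : ℤ → PosetIsomorphism poset poset
  Shift b = automorphism (shift b) (shift (- b)) (shift-isSymmetric b) (shift-isSymmetric (- b))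
    (shift-inverse b (- b) (ℤ.+-inverseʳ b)) (shift-inverse (- b) b (ℤ.+-inverseˡ b))

  turn-cong : ∀ {F G} → F ≈ G → turn F ≈ turn G
  turn-cong bot≈        = bot≈
  turn-cong (vert≈ p)   = vert≈ (mod-+ (mod-refl {a = 1ℤ}) (mod-neg p))
  turn-cong (edge≈ p q) = edge≈ (mod-neg p) (mod-+ q (mod-neg (mod-*ˡ e p)))
  turn-cong (poly≈ p q) = poly≈ (mod-+ (mod-+ (mod-neg p) mod-refl) (mod-neg (scale q))) q
  turn-cong (facet≈ p)  = facet≈ (mod-neg p)
  turn-cong top≈        = top≈

  turn-isSymmetric : IsSymmetric turn
  turn-isSymmetric = record
    { rank-f   = λ { bot → refl ; (vert _) → refl ; (edge _ _) → refl ; (poly _ _) → refl ; (facet _) → refl ; top → refl }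
    ; cong     = turn-cong
    ; incident = incident
    }
    where
    flip : ∀ s → 1ℤ - s ≡ - s + 1ℤ
    flip = solve-∀
    incident : ∀ {F G} → F ⋖ G → turn F ⋖ turn G
    incident bot⋖vert = bot⋖vert
    incident (vert⋖edge {s = s} (inj₁ p)) = vert⋖edge (inj₂ (mod-trans (mod-+ (mod-refl {a = 1ℤ}) (mod-neg p)) (≡⇒≡[] (flip s))))
    incident (vert⋖edge {s = s} (inj₂ p)) = vert⋖edge (inj₁ (mod-trans (mod-+ (mod-refl {a = 1ℤ}) (mod-neg p)) (≡⇒≡[] (solve (s ∷ [])))))
    incident (edge⋖poly {s} {m} {i} {j} r) = edge⋖poly (mod-trans r (by (- (+ 2 * K * j * e * s)) (solve (K ∷ e ∷ s ∷ i ∷ m ∷ j ∷ []))))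
    incident (poly⋖facet {i} {j} (inj₁ p)) = poly⋖facet (inj₂ (mod-trans (mod-neg p) (≡⇒≡[] (solve (K ∷ i ∷ j ∷ [])))))
    incident (poly⋖facet {i} {j} (inj₂ p)) = poly⋖facet (inj₁ (mod-trans (mod-neg p) (≡⇒≡[] (solve (K ∷ i ∷ j ∷ [])))))
    incident facet⋖top = facet⋖top

  turn-involutive : ∀ F → turn (turn F) ≈ F
  turn-involutive bot        = bot≈
  turn-involutive (vert v)   = vert≈ (≡⇒≡[] (solve (v ∷ [])))
  turn-involutive (edge s m) = edge≈ (≡⇒≡[] (ℤ.neg-involutive s)) (≡⇒≡[] (solve (e ∷ s ∷ m ∷ [])))
  turn-involutive (poly i j) = poly≈ (≡⇒≡[] (solve (K ∷ i ∷ j ∷ []))) mod-refl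
  turn-involutive (facet c)  = facet≈ (≡⇒≡[] (ℤ.neg-involutive c))
  turn-involutive top        = top≈

  Turn : PosetIsomorphism poset poset
  Turn = automorphism turn turn turn-isSymmetric turn-isSymmetric turn-involutive turn-involutive

  θ-neg : ∀ a u c → - θ a u (- c) ≡ θ (- a) (u - e * a) c
  θ-neg a u c = ≡.trans (≡.cong (λ t → - (- c + + 8 * K * (e * a * t + u * - c))) (T-neg c)) (collect K e a u c (T c))
    where
    collect : ∀ K e a u c t → - (- c + + 8 * K * (e * a * (t + c) + u * - c)) ≡ c + + 8 * K * (e * - a * t + (u - e * a) * c)
    collect = solve-∀

  -- By `T-neg`, reversing the facets does not merely negate `a` but leaves the linear term - e a c.
  -- For a = -1 and u = 0 this term is what makes σ₂² equal to `rotate 0ℤ e`.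
  turn-rotate-turn : ∀ a u F → turn (rotate a u (turn F)) ≈ rotate (- a) (u - e * a) F
  turn-rotate-turn a u bot        = bot≈
  turn-rotate-turn a u (vert v)   = vert≈ (≡⇒≡[] (solve (v ∷ a ∷ [])))
  turn-rotate-turn a u (edge s m) = edge≈ (≡⇒≡[] (solve (s ∷ a ∷ []))) (≡⇒≡[] (solve (e ∷ s ∷ a ∷ u ∷ m ∷ [])))
  turn-rotate-turn a u (poly i j) = poly≈ i≡ j≡
    where
    i₁ = - i - 1ℤ - + 8 * K * j
    opposite : ∀ K i j → - i - 1ℤ - + 8 * K * j ≡ - (i + 1ℤ + + 8 * K * j)
    opposite = solve-∀
    cancel : ∀ K e a u i j x → x + 1ℤ + + 8 * K * (j + e * - a * i + (u - e * a)) - 1ℤ - + 8 * K * (j + e * a * (- i - 1ℤ - + 8 * K * j) + u)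
           ≡ x + + 2 * K * e * a * j * (+ 32 * K)
    cancel = solve-∀
    i≡ : - θ a u i₁ - 1ℤ - + 8 * K * (j + e * a * i₁ + u) ≡[ + 32 * K ] θ (- a) (u - e * a) i
    i≡ = mod-trans (mod-+ (mod-+ (mod-trans
        (≡⇒≡[] (≡.trans (≡.cong (λ x → - θ a u x) (opposite K i j)) (θ-neg a u (i + 1ℤ + + 8 * K * j))))
        (θ-next (- a) (u - e * a) i j)) (mod-refl {a = -1ℤ})) (mod-refl {a = - (+ 8 * K * (j + e * a * i₁ + u))}))
      (by (+ 2 * K * e * a * j) (cancel K e a u i j (θ (- a) (u - e * a) i)))
    simp : ∀ K e a u i j → j + e * a * (- i - 1ℤ - + 8 * K * j) + u ≡ j + e * - a * i + (u - e * a) + - (+ 2 * K * e * a * j) * + 4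
    simp = solve-∀
    j≡ : j + e * a * i₁ + u ≡[ + 4 ] j + e * - a * i + (u - e * a)
    j≡ = by (- (+ 2 * K * e * a * j)) (simp K e a u i j)
  turn-rotate-turn a u (facet c)  = facet≈ (≡⇒≡[] (θ-neg a u c))
  turn-rotate-turn a u top        = top≈

  turn-shift-turn : ∀ b F → turn (shift b (turn F)) ≈ shift (- b) F
  turn-shift-turn b bot        = bot≈
  turn-shift-turn b (vert v)   = turn-involutive (vert v)
  turn-shift-turn b (edge s m) = edge≈ (≡⇒≡[] (ℤ.neg-involutive s)) (≡⇒≡[] (solve (e ∷ s ∷ m ∷ b ∷ [])))
  turn-shift-turn b (poly i j) = poly≈ (≡⇒≡[] (solve (K ∷ i ∷ j ∷ b ∷ []))) mod-refl
  turn-shift-turn b (facet c)  = facet≈ (≡⇒≡[] (solve (c ∷ b ∷ [])))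
  turn-shift-turn b top        = top≈

  θ-suc : ∀ a c → θ a 0ℤ (c + 1ℤ) ≡ θ a (e * a) c + 1ℤ
  θ-suc a c = ≡.trans (≡.cong (λ t → c + 1ℤ + + 8 * K * (e * a * t + 0ℤ * (c + 1ℤ))) (T-suc c)) (collect K e a c (T c))
    where
    collect : ∀ K e a c t → c + 1ℤ + + 8 * K * (e * a * (t + c) + 0ℤ * (c + 1ℤ)) ≡ c + + 8 * K * (e * a * t + e * a * c) + 1ℤ
    collect = solve-∀

  -- A translation by 1 adds c to `T c`, so for a = 1 the rotation σ₁ commutes with σ₃ only up to
  -- the factor σ₂².
  rotate-shift : ∀ a F → rotate a 0ℤ (shift 1ℤ F) ≈ shift 1ℤ (rotate a (e * a) F)
  rotate-shift a bot        = bot≈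
  rotate-shift a (vert v)   = ≈-refl
  rotate-shift a (edge s m) = edge≈ mod-refl (≡⇒≡[] (solve (e ∷ a ∷ s ∷ m ∷ [])))
  rotate-shift a (poly i j) = poly≈ (≡⇒≡[] (θ-suc a i)) (≡⇒≡[] (solve (e ∷ a ∷ i ∷ j ∷ [])))
  rotate-shift a (facet c)  = facet≈ (≡⇒≡[] (θ-suc a c))
  rotate-shift a top        = top≈

  θ-shift : ∀ c → θ 0ℤ e (c + 1ℤ) ≡ θ 0ℤ e c + (1ℤ + e * (+ 8 * K))
  θ-shift c = simp K e c (T (c + 1ℤ)) (T c)
    where
    simp : ∀ K e i t t′ → i + 1ℤ + + 8 * K * (e * 0ℤ * t + e * (i + 1ℤ)) ≡ i + + 8 * K * (e * 0ℤ * t′ + e * i) + (1ℤ + e * (+ 8 * K))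
    simp = solve-∀

  -- `rotate 0ℤ e` multiplies the facets by 1 + 8 K e, so it conjugates the translation by 1 into
  -- the one by 1 + 8 K e. With 8 K = 2^(β-2) this is the relation between σ₃ and σ₂².
  rotate₀-shift : ∀ F → rotate 0ℤ e (shift 1ℤ F) ≈ shift (1ℤ + e * (+ 8 * K)) (rotate 0ℤ e F)
  rotate₀-shift bot        = bot≈
  rotate₀-shift (vert v)   = ≈-refl
  rotate₀-shift (edge s m) = edge≈ mod-refl (by (+ 2 * K * e * e * s) (solve (K ∷ e ∷ s ∷ m ∷ [])))
  rotate₀-shift (poly i j) = poly≈ (≡⇒≡[] (θ-shift i)) (≡⇒≡[] (solve (e ∷ i ∷ j ∷ [])))
  rotate₀-shift (facet c)  = facet≈ (≡⇒≡[] (θ-shift c))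
  rotate₀-shift top        = top≈

  private
    module Aut = Group (AutomorphismGroup poset)

  -- σ₂ is σ₁⁻¹ followed by `turn`, so that σ₁ σ₂ acts as `turn`.
  ⟦_⟧ᵍ : Fin 3 → Aut.Carrier
  ⟦ 0F ⟧ᵍ = Rotate 1ℤ 0ℤ
  ⟦ 1F ⟧ᵍ = Rotate -1ℤ 0ℤ Aut.∙ Turn
  ⟦ 2F ⟧ᵍ = Shift 1ℤ

  eval : Term (Fin 3) → Aut.Carrier
  eval (gen x) = ⟦ x ⟧ᵍ
  eval ε       = Aut.ε
  eval (s ∙ t) = eval s Aut.∙ eval t
  eval (t ⁻¹)  = eval t Aut.⁻¹

  act : Term (Fin 3) → Face → Face
  act t = PosetIsomorphism.⟦_⟧ (eval t)

  act-cong : ∀ t {F G} → F ≈ G → act t F ≈ act t G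
  act-cong t = PosetIsomorphism.cong (eval t)

  -- Products apply their left factor first, so the left inverse law is the one that concerns
  -- `act t` after `act (t ⁻¹)`.
  act-⁻¹ʳ : ∀ t F → act t (act (t ⁻¹) F) ≈ F
  act-⁻¹ʳ t = Aut.inverseˡ (eval t)

  act-⁻¹ˡ : ∀ t F → act (t ⁻¹) (act t F) ≈ F
  act-⁻¹ˡ t = Aut.inverseʳ (eval t)

  rotate² : ∀ F → act σ₂ (act σ₂ F) ≈ rotate 0ℤ e F
  rotate² F = ≈-trans (turn-rotate-turn -1ℤ 0ℤ (rotate -1ℤ 0ℤ F)) (≈-trans (rotate-+ 1ℤ (0ℤ - e * -1ℤ) -1ℤ 0ℤ F)
    (rotate-cong mod-refl (≡⇒≡[] (solve (e ∷ []))) ≈-refl))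

  σ₁σ₂≈turn : ∀ F → act (σ₁ ∙ σ₂) F ≈ turn F
  σ₁σ₂≈turn F = turn-cong (rotate-inverse -1ℤ 0ℤ 1ℤ 0ℤ refl refl F)

  act-σ₁^ : ∀ k F → act (σ₁ ^ k) F ≈ rotate (+ k) 0ℤ F
  act-σ₁^ zero    F = ≈-sym (rotate-0 F)
  act-σ₁^ (suc k) F = ≈-trans (act-σ₁^ k (rotate 1ℤ 0ℤ F)) (≈-trans (rotate-+ (+ k) 0ℤ 1ℤ 0ℤ F)
    (rotate-cong (≡⇒≡[] (ℤ.+-comm (+ k) 1ℤ)) mod-refl ≈-refl))

  act-σ₂²^ : ∀ k F → act ((σ₂ ^ 2) ^ k) F ≈ rotate 0ℤ (+ k * e) F
  act-σ₂²^ zero    F = ≈-trans (≈-sym (rotate-0 F)) (rotate-cong mod-refl (≡⇒≡[] (≡.sym (ℤ.*-zeroˡ e))) ≈-refl)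
  act-σ₂²^ (suc k) F = ≈-trans (act-cong ((σ₂ ^ 2) ^ k) (rotate² F)) (≈-trans (act-σ₂²^ k (rotate 0ℤ e F))
    (≈-trans (rotate-+ 0ℤ (+ k * e) 0ℤ e F) (rotate-cong mod-refl (≡⇒≡[] (simp (+ k) e)) ≈-refl)))
    where
    simp : ∀ k e → k * e + e ≡ (1ℤ + k) * e
    simp = solve-∀

  act-σ₃^ : ∀ k F → act (σ₃ ^ k) F ≈ shift (+ k) F
  act-σ₃^ zero    F = ≈-sym (shift-0 F)
  act-σ₃^ (suc k) F = ≈-trans (act-σ₃^ k (shift 1ℤ F)) (≈-trans (shift-+ (+ k) 1ℤ F)
    (shift-cong (≡⇒≡[] (ℤ.+-comm (+ k) 1ℤ)) ≈-refl))

  act-σ₃^ᶻ : ∀ k F → act (σ₃ ^ᶻ k) F ≈ shift k F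
  act-σ₃^ᶻ (+ k)    F = act-σ₃^ k F
  act-σ₃^ᶻ -[1+ k ] F = PosetIsomorphism.injective (eval (σ₃ ^ suc k)) (≈-trans (act-⁻¹ʳ (σ₃ ^ suc k) F)
    (≈-sym (≈-trans (act-σ₃^ (suc k) _) (shift-inverse (+ suc k) -[1+ k ] (ℤ.+-inverseʳ (+ suc k)) F))))

  module _ (β : ℕ) (2^β : + (2 ℕ.^ β) ≡ + 32 * K) (2^β∸2 : + (2 ℕ.^ (β ℕ.∸ 2)) ≡ + 8 * K) where

    -- σ₁σ₂ acts as the involution turn, and the other relations follow from those between rotate, shift and turn.
    rotation-holds : ∀ {s t} → RotationRelation 4 8 (2 ℕ.^ β) s t → ∀ F → act s F ≈ act t F
    rotation-holds σ₁-order F = ≈-trans (act-σ₁^ 4 F) (≈-trans (rotate-cong (by 1ℤ refl) mod-refl ≈-refl) (rotate-0 F))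
    rotation-holds σ₂-order F = ≈-trans (rotate² (s² (s² (s² F)))) (≈-trans (r-cong (rotate² (s² (s² F))))
      (≈-trans (r-cong (r-cong (rotate² (s² F)))) (≈-trans (r-cong (r-cong (r-cong (rotate² F)))) r⁴)))
      where
      s² : Face → Face
      s² G = act σ₂ (act σ₂ G)
      r : Face → Face
      r = rotate 0ℤ e
      r-cong : ∀ {F G} → F ≈ G → r F ≈ r G
      r-cong = rotate-cong mod-refl mod-refl
      r⁴ : r (r (r (r F))) ≈ F
      r⁴ = ≈-trans (r-cong (r-cong (rotate-+ 0ℤ e 0ℤ e F))) (≈-trans (r-cong (rotate-+ 0ℤ e 0ℤ (e + e) F))
        (≈-trans (rotate-+ 0ℤ e 0ℤ (e + (e + e)) F) (≈-trans (rotate-cong mod-refl (by e (solve (e ∷ []))) ≈-refl) (rotate-0 F))))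
    rotation-holds σ₃-order F = ≈-trans (act-σ₃^ (2 ℕ.^ β) F) (≈-trans (shift-cong (by 1ℤ (≡.trans 2^β (pad (+ 32 * K)))) ≈-refl) (shift-0 F))
      where
      pad : ∀ x → x ≡ 0ℤ + 1ℤ * x
      pad = solve-∀
    rotation-holds σ₁σ₂-order F = ≈-trans (σ₁σ₂≈turn (act (σ₁ ∙ σ₂) F)) (≈-trans (turn-cong (σ₁σ₂≈turn F)) (turn-involutive F))
    rotation-holds σ₂σ₃-order F =
      ≈-trans (shift-cong mod-refl (turn-cong (rotate-shift -1ℤ X)))
      -- Inserting `turn` twice makes the inner translation a conjugate by `turn`, that is the
      -- translation by -1, which cancels the outer one.
      (≈-trans (shift-cong mod-refl (turn-cong (shift-cong mod-refl (≈-sym (turn-involutive Y)))))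
      (≈-trans (shift-cong mod-refl (turn-shift-turn 1ℤ (turn Y)))
      (≈-trans (shift-inverse 1ℤ -1ℤ refl (turn Y))
      (≈-trans (turn-rotate-turn -1ℤ (e * -1ℤ) (rotate -1ℤ 0ℤ F))
      (rotate-inverse 1ℤ (e * -1ℤ - e * -1ℤ) -1ℤ 0ℤ refl (solve (e ∷ [])) F)))))
      where
      X = act σ₂ F
      Y = rotate -1ℤ (e * -1ℤ) X
    rotation-holds σ₁σ₂σ₃-order F =
      ≈-trans (shift-cong mod-refl (σ₁σ₂≈turn (shift 1ℤ (act (σ₁ ∙ σ₂) F))))
      (≈-trans (shift-cong mod-refl (turn-cong (shift-cong mod-refl (σ₁σ₂≈turn F))))
      (≈-trans (shift-cong mod-refl (turn-shift-turn 1ℤ F)) (shift-inverse 1ℤ -1ℤ refl F)))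

    relation-holds : ∀ {s t} → Λ₂-Relation β e s t → ∀ F → act s F ≈ act t F
    relation-holds (rotation r) F = rotation-holds r F
    relation-holds σ₂²σ₁ F = ≈-trans (rotate-cong mod-refl mod-refl (rotate² F)) (≈-trans (rotate-+ 1ℤ 0ℤ 0ℤ e F)
      (≈-trans (rotate-cong mod-refl (≡⇒≡[] (ℤ.+-comm 0ℤ e)) ≈-refl)
        (≈-sym (≈-trans (rotate² (rotate 1ℤ 0ℤ F)) (rotate-+ 0ℤ e 1ℤ 0ℤ F)))))
    relation-holds σ₃σ₂² F = ≈-trans (rotate² (shift 1ℤ F)) (≈-trans (rotate₀-shift F)
      (≈-sym (≈-trans (act-σ₃^ᶻ _ (act (σ₂ ^ 2) F)) (shift-cong (≡⇒≡[] (≡.cong (λ x → 1ℤ + e * x) 2^β∸2)) (rotate² F)))))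

    derivable-holds : ∀ {s t} → Derivable (Λ₂-Relation β e) s t → ∀ F → act s F ≈ act t F
    derivable-holds (relation r)          F = relation-holds r F
    derivable-holds Derivable.refl        F = ≈-refl
    derivable-holds (Derivable.sym d)     F = ≈-sym (derivable-holds d F)
    derivable-holds (Derivable.trans d d′) F = ≈-trans (derivable-holds d F) (derivable-holds d′ F)
    derivable-holds (∙-cong {s} {s′} {t} {t′} d d′) F = ≈-trans (act-cong t (derivable-holds d F)) (derivable-holds d′ (act s′ F))
    derivable-holds (⁻¹-cong {s} {t} d)   F = Aut.⁻¹-cong {eval s} {eval t} (derivable-holds d) F
    derivable-holds (Derivable.assoc s t u) F = ≈-refl
    derivable-holds (identityˡ t)         F = ≈-refl
    derivable-holds (identityʳ t)         F = ≈-refl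
    derivable-holds (inverseˡ t)          F = act-⁻¹ʳ t F
    derivable-holds (inverseʳ t)          F = act-⁻¹ˡ t F

-- Chirality

module Chirality (K e : ℤ) (e² : e * e ≡ 1ℤ) where
  open Automorphisms K e public

  P : Polytope 4
  P = polytope e²

  module P = Polytope P

  adjacent : ∀ Φ Ψ j → ¬ face Φ (middle j) ≈ face Ψ (middle j) →
             j ≡ 0F ⊎ face Φ 1F ≈ face Ψ 1F → j ≡ 1F ⊎ face Φ 2F ≈ face Ψ 2F →
             j ≡ 2F ⊎ face Φ 3F ≈ face Ψ 3F → j ≡ 3F ⊎ face Φ 4F ≈ face Ψ 4F → Adjacent j Φ Ψ
  adjacent Φ Ψ j ≉ p q r s = ≉ , except Φ Ψ j p q r s

  adjacent₀ : ∀ s m i b → Adjacent 0F (flag true s m i b) (flag false s m i b)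
  adjacent₀ s m i b = adjacent (flag true s m i b) (flag false s m i b) 0F
    (λ { (vert≈ p) → unit-shift 0ℤ (mod-sym p) }) (inj₁ refl) (inj₂ ≈-refl) (inj₂ ≈-refl) (inj₂ ≈-refl)

  adjacent₃ : ∀ a s m i → Adjacent 3F (flag a s m i false) (flag a s m i true)
  adjacent₃ a s m i = adjacent (flag a s m i false) (flag a s m i true) 3F
    (λ { (facet≈ p) → next≢ i (e * s * i + m) (mod4 p) })
    (inj₂ ≈-refl) (inj₂ ≈-refl) (inj₂ ≈-refl) (inj₁ refl)

  adjacent₂ : ∀ a s m i i′ → i′ ≡[ + 32 * K ] i + 1ℤ + + 8 * K * (e * s * i + m) →
              Adjacent 2F (flag a s m i true) (flag a s m i′ false)
  adjacent₂ a s m i i′ p = adjacent (flag a s m i true) (flag a s m i′ false) 2F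
    (λ { (poly≈ q _) → next≢ i (e * s * i + m) (mod4 (mod-trans q p)) })
    (inj₂ ≈-refl) (inj₂ ≈-refl) (inj₁ refl) (inj₂ (facet≈ (mod-sym p)))

  adjacent₁ : ∀ s m i b s′ m′ → s′ ≡[ + 4 ] s + 1ℤ → e * s * i + m ≡[ + 4 ] e * s′ * i + m′ →
              Adjacent 1F (flag true s m i b) (flag false s′ m′ i b)
  adjacent₁ s m i b s′ m′ p j≡ = adjacent (flag true s m i b) (flag false s′ m′ i b) 1F
    (λ { (edge≈ q _) → unit-shift 0ℤ (mod-trans q p) })
    (inj₂ (vert≈ (mod-sym p))) (inj₁ refl) (inj₂ (poly≈ mod-refl j≡)) (inj₂ (facet≈ (facetOf-cong b mod-refl j≡)))

  -- The base flag has the second vertex of its edge, so that its neighbour in rank 1 has the edge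
  -- (1 , 0) and σ₁ increases s. Its neighbour Φ₁ in rank 0 represents the other orbit.
  Φ₀ Φ₁ : Flag
  Φ₀ = flag true 0ℤ 0ℤ 0ℤ false
  Φ₁ = flag false 0ℤ 0ℤ 0ℤ false

  Φ₀^ : Fin 4 → Flag
  Φ₀^ 0F = Φ₁
  Φ₀^ 1F = flag false 1ℤ 0ℤ 0ℤ false
  Φ₀^ 2F = flag true 0ℤ 0ℤ -1ℤ true
  Φ₀^ 3F = flag true 0ℤ 0ℤ 0ℤ true

  Φ₀^-adjacent : ∀ j → Adjacent j Φ₀ (Φ₀^ j)
  Φ₀^-adjacent 0F = adjacent₀ 0ℤ 0ℤ 0ℤ false
  Φ₀^-adjacent 1F = adjacent₁ 0ℤ 0ℤ 0ℤ false 1ℤ 0ℤ mod-refl (≡⇒≡[] (solve (e ∷ [])))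
  Φ₀^-adjacent 2F = FlagPaths.adjacent-sym rankedPoset (Φ₀^ 2F) Φ₀
    (adjacent₂ true 0ℤ 0ℤ -1ℤ 0ℤ (≡⇒≡[] (solve (K ∷ e ∷ []))))
  Φ₀^-adjacent 3F = adjacent₃ true 0ℤ 0ℤ 0ℤ

  maps-via : ∀ t Φ Ψ → act t (face Φ 0F) ≈ face Ψ 0F → act t (face Φ 1F) ≈ face Ψ 1F →
             act t (face Φ 2F) ≈ face Ψ 2F → act t (face Φ 3F) ≈ face Ψ 3F →
             act t (face Φ 4F) ≈ face Ψ 4F → act t (face Φ 5F) ≈ face Ψ 5F → P.Maps (eval t) Φ Ψ
  maps-via t Φ Ψ p₀ p₁ p₂ p₃ p₄ p₅ 0F = p₀
  maps-via t Φ Ψ p₀ p₁ p₂ p₃ p₄ p₅ 1F = p₁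
  maps-via t Φ Ψ p₀ p₁ p₂ p₃ p₄ p₅ 2F = p₂
  maps-via t Φ Ψ p₀ p₁ p₂ p₃ p₄ p₅ 3F = p₃
  maps-via t Φ Ψ p₀ p₁ p₂ p₃ p₄ p₅ 4F = p₄
  maps-via t Φ Ψ p₀ p₁ p₂ p₃ p₄ p₅ 5F = p₅

  adjacent-word : Fin 4 → Term (Fin 3)
  adjacent-word 0F = ε
  adjacent-word 1F = σ₁
  adjacent-word 2F = σ₁ ∙ σ₂
  adjacent-word 3F = σ₁ ∙ σ₂ ∙ σ₃

  adjacent-word-maps : ∀ j → P.Maps (eval (adjacent-word j)) Φ₁ (Φ₀^ j)
  adjacent-word-maps 0F k = ≈-refl
  adjacent-word-maps 1F = maps-via σ₁ Φ₁ (Φ₀^ 1F) bot≈ ≈-refl ≈-refl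
    (poly≈ (≡⇒≡[] (θ-1 K e)) (≡⇒≡[] (solve (e ∷ [])))) (facet≈ (≡⇒≡[] (θ-1 K e))) top≈
    where
    θ-1 : ∀ K e → 0ℤ + + 8 * K * (e * 1ℤ * 0ℤ + 0ℤ * 0ℤ) ≡ 0ℤ
    θ-1 = solve-∀
  adjacent-word-maps 2F k = ≈-trans (σ₁σ₂≈turn (face Φ₁ k)) (turned k)
    where
    turned : ∀ k → turn (face Φ₁ k) ≈ face (Φ₀^ 2F) k
    turned 0F = bot≈
    turned 1F = ≈-refl
    turned 2F = edge≈ mod-refl (≡⇒≡[] (solve (e ∷ [])))
    turned 3F = poly≈ (≡⇒≡[] (solve (K ∷ e ∷ []))) (≡⇒≡[] (solve (e ∷ [])))
    turned 4F = facet≈ (≡⇒≡[] (simp K e))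
      where
      simp : ∀ K e → - 0ℤ ≡ -1ℤ + 1ℤ + + 8 * K * (e * 0ℤ * -1ℤ + 0ℤ)
      simp = solve-∀
    turned 5F = top≈
  adjacent-word-maps 3F k = ≈-trans (shift-cong mod-refl (adjacent-word-maps 2F k)) (shifted k)
    where
    shifted : ∀ k → shift 1ℤ (face (Φ₀^ 2F) k) ≈ face (Φ₀^ 3F) k
    shifted 0F = bot≈
    shifted 1F = ≈-refl
    shifted 2F = edge≈ mod-refl (≡⇒≡[] (solve (e ∷ [])))
    shifted 3F = poly≈ mod-refl (≡⇒≡[] (solve (e ∷ [])))
    shifted 4F = facet≈ (≡⇒≡[] (simp K e))
      where
      simp : ∀ K e → -1ℤ + 1ℤ + + 8 * K * (e * 0ℤ * -1ℤ + 0ℤ) + 1ℤ ≡ 0ℤ + 1ℤ + + 8 * K * (e * 0ℤ * 0ℤ + 0ℤ)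
      simp = solve-∀
    shifted 5F = top≈

  -- Orbits under words in σ₁, σ₂, σ₃ only. That these words account for all automorphisms follows
  -- later, once Φ₀ and Φ₁ are known to lie in different orbits.
  Reach : Rel Flag 0ℓ
  Reach Φ Ψ = ∃[ t ] P.Maps (eval t) Φ Ψ

  -- An automorphism that takes Φ₀ to Φ takes the j-adjacent flag of Φ₀ to Ψ, and `adjacent-word j`
  -- leads there from Φ₁. So each adjacency step passes between the two classes.
  reach₀-adjacent : ∀ Φ Ψ j → Adjacent j Φ Ψ → Reach Φ₀ Φ → Reach Φ₁ Ψ
  reach₀-adjacent Φ Ψ j adj (t , maps) = adjacent-word j ∙ t , λ k →
    ≈-trans (act-cong t (adjacent-word-maps j k))
      (maps-adjacent P (eval t) Φ₀ Φ (Φ₀^ j) Ψ j maps (Φ₀^-adjacent j) adj k)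

  reach₁-adjacent : ∀ Φ Ψ j → Adjacent j Φ Ψ → Reach Φ₁ Φ → Reach Φ₀ Ψ
  reach₁-adjacent Φ Ψ j adj (t , maps) = u ∙ t , maps-adjacent P (eval (u ∙ t)) (Φ₀^ j) Φ Φ₀ Ψ j
    (λ k → ≈-trans (act-cong t (≈-trans (act-cong u (≈-sym (adjacent-word-maps j k))) (act-⁻¹ˡ (adjacent-word j) (face Φ₁ k)))) (maps k))
    (FlagPaths.adjacent-sym rankedPoset Φ₀ (Φ₀^ j) (Φ₀^-adjacent j)) adj
    where u = adjacent-word j ⁻¹

  reach : ∀ Ψ → Reach Φ₀ Ψ ⊎ Reach Φ₁ Ψ
  reach Ψ = go (PolytopeProperties.connected P Φ₀ Ψ) (inj₁ (ε , λ _ → ≈-refl))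
    where
    go : ∀ {J Φ} → Path J Φ Ψ → Reach Φ₀ Φ ⊎ Reach Φ₁ Φ → Reach Φ₀ Ψ ⊎ Reach Φ₁ Ψ
    go (done p) (inj₁ (t , maps)) = inj₁ (t , λ k → ≈-trans (maps k) (p k))
    go (done p) (inj₂ (t , maps)) = inj₂ (t , λ k → ≈-trans (maps k) (p k))
    go {Φ = Φ} (step {Ω = Ω} j _ adj ps) (inj₁ r) = go ps (inj₂ (reach₀-adjacent Φ Ω j adj r))
    go {Φ = Φ} (step {Ω = Ω} j _ adj ps) (inj₂ r) = go ps (inj₁ (reach₁-adjacent Φ Ω j adj r))

  rigid : ∀ α β → P.Maps α Φ₀ (automorphism-flag P β Φ₀) → ∀ F → PosetIsomorphism.⟦_⟧ α F ≈ PosetIsomorphism.⟦_⟧ β F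
  rigid α β maps F = ≈-trans (≈-sym (Aut.inverseˡ β (PosetIsomorphism.⟦_⟧ α F))) (PosetIsomorphism.cong β
    (agree-everywhere (automorphism-isFlagMap P (α Aut.∙ β Aut.⁻¹)) (id-isFlagMap P) (λ _ → refl) inFlag Φ₀
      (λ k → ≈-trans (PosetIsomorphism.cong (β Aut.⁻¹) (maps k)) (Aut.inverseʳ β (face Φ₀ k))) F))
    where
    module Aut = Group P.Aut
    open Rigidity P P

  standardGenerators : AreStandardGenerators P Φ₀ (eval ∘ gen)
  standardGenerators 0F = Φ₀^ 1F , flag true 1ℤ 0ℤ 0ℤ false , Φ₀^-adjacent 1F ,
    FlagPaths.adjacent-sym rankedPoset (flag true 1ℤ 0ℤ 0ℤ false) (Φ₀^ 1F) (adjacent₀ 1ℤ 0ℤ 0ℤ false) ,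
    maps-via σ₁ Φ₀ (flag true 1ℤ 0ℤ 0ℤ false) bot≈ ≈-refl ≈-refl
      (poly≈ (≡⇒≡[] (s₁ K e)) (≡⇒≡[] (solve (e ∷ [])))) (facet≈ (≡⇒≡[] (s₁ K e))) top≈
    where
    s₁ : ∀ K e → 0ℤ + + 8 * K * (e * 1ℤ * 0ℤ + 0ℤ * 0ℤ) ≡ 0ℤ
    s₁ = solve-∀
  standardGenerators 1F = Φ₀^ 2F , Ψ , Φ₀^-adjacent 2F ,
    adjacent₁ 0ℤ 0ℤ -1ℤ true 1ℤ e mod-refl (≡⇒≡[] (solve (e ∷ []))) ,
    maps-via σ₂ Φ₀ Ψ bot≈ ≈-refl (edge≈ mod-refl (≡⇒≡[] (solve (e ∷ [])))) (poly≈ (≡⇒≡[] (s₂ K e)) (≡⇒≡[] (solve (e ∷ []))))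
      (facet≈ (≡⇒≡[] (s₄ K e))) top≈
    where
    Ψ = flag false 1ℤ e -1ℤ true
    s₂ : ∀ K e → - (0ℤ + + 8 * K * (e * -1ℤ * 0ℤ + 0ℤ * 0ℤ)) - 1ℤ - + 8 * K * (e * 0ℤ * 0ℤ + 0ℤ + e * -1ℤ * 0ℤ + 0ℤ) ≡ -1ℤ
    s₂ = solve-∀
    s₄ : ∀ K e → - (0ℤ + + 8 * K * (e * -1ℤ * 0ℤ + 0ℤ * 0ℤ)) ≡ -1ℤ + 1ℤ + + 8 * K * (e * 1ℤ * -1ℤ + e)
    s₄ = solve-∀
  standardGenerators 2F = Φ₀^ 3F , flag true 0ℤ 0ℤ 1ℤ false , Φ₀^-adjacent 3F ,
    adjacent₂ true 0ℤ 0ℤ 0ℤ 1ℤ (≡⇒≡[] (s₁ K e)) ,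
    maps-via σ₃ Φ₀ (flag true 0ℤ 0ℤ 1ℤ false) bot≈ ≈-refl (edge≈ mod-refl (≡⇒≡[] (solve (e ∷ [])))) (poly≈ mod-refl (≡⇒≡[] (solve (e ∷ []))))
      ≈-refl top≈
    where
    s₁ : ∀ K e → 1ℤ ≡ 0ℤ + 1ℤ + + 8 * K * (e * 0ℤ * 0ℤ + 0ℤ)
    s₁ = solve-∀

  module _ .{{_ : ℤ.NonZero K}} where

    -- The difference is 16 K e; if it were a multiple of 32 K, then e would be even, against e e =
    -- 1.
    16Ke≢0 : ¬ + 2 + + 8 * K * e ≡[ + 32 * K ] + 2 + + 8 * K * - e
    16Ke≢0 (by q eq) = 1≢2x {q * (q * + 2)} (≡.trans (≡.sym e²) (≡.trans (≡.cong₂ _*_ e≡2q e≡2q) (square q)))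
      where
      square : ∀ q → q * + 2 * (q * + 2) ≡ q * (q * + 2) * + 2
      square = solve-∀
      left : ∀ K e → + 2 + + 8 * K * e - (+ 2 + + 8 * K * - e) ≡ K * (+ 16 * e)
      left = solve-∀
      e≡2q : e ≡ q * + 2
      e≡2q = ℤ.*-cancelˡ-≡ (+ 16) e (q * + 2) (ℤ.*-cancelˡ-≡ K (+ 16 * e) (+ 16 * (q * + 2))
        (≡.trans (≡.sym (left K e)) (≡.trans (≡.cong (_- (+ 2 + + 8 * K * - e)) eq) (solve (K ∷ e ∷ q ∷ [])))))

    -- An automorphism that swaps the two vertices of the edge (0 , 0) and fixes the other faces of Φ₀ fixes all
    -- facets, because it fixes the n-gon around that edge; but it exchanges the n-gons around the edges (1 , 0)
    -- and (-1 , 0), which visit the facets in different orders.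
    ¬sameOrbit : ¬ P.SameOrbit Φ₀ Φ₁
    ¬sameOrbit (α , maps) = absurd (≈-trans (≈-sym (fixed (+ 2 + + 8 * K * e)))
        (≈-trans (PosetIsomorphism.cong α (facet≈ (≡⇒≡[] (eq₁ K e)))) (≈-trans (detour 4F) (facet≈ (≡⇒≡[] (eq₂ K e))))))
      where
      eq₁ : ∀ K e → + 2 + + 8 * K * e ≡ 1ℤ + 1ℤ + + 8 * K * (e * 1ℤ * 1ℤ + 0ℤ)
      eq₁ = solve-∀
      eq₂ : ∀ K e → 1ℤ + 1ℤ + + 8 * K * (e * -1ℤ * 1ℤ + 0ℤ) ≡ + 2 + + 8 * K * - e
      eq₂ = solve-∀
      absurd : ¬ facet (+ 2 + + 8 * K * e) ≈ facet (+ 2 + + 8 * K * - e)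
      absurd (facet≈ p) = 16Ke≢0 p
      sym′ = λ {j} → FlagPaths.adjacent-sym rankedPoset {j}
      along : ∀ Φ Φ′ Ψ Ψ′ j → P.Maps α Φ Φ′ → Adjacent j Φ Ψ → Adjacent j Φ′ Ψ′ → P.Maps α Ψ Ψ′
      along = maps-adjacent P α
      next : ∀ a z → Adjacent 2F (flag a 0ℤ 0ℤ z true) (flag a 0ℤ 0ℤ (z + 1ℤ) false)
      next a z = adjacent₂ a 0ℤ 0ℤ z (z + 1ℤ) (≡⇒≡[] (solve (K ∷ e ∷ z ∷ [])))
      line : ∀ z → P.Maps α (flag true 0ℤ 0ℤ z false) (flag false 0ℤ 0ℤ z false)
      line = ℤ-induction (λ z → P.Maps α (flag true 0ℤ 0ℤ z false) (flag false 0ℤ 0ℤ z false)) maps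
        (λ z m → along (flag true 0ℤ 0ℤ z true) (flag false 0ℤ 0ℤ z true) (flag true 0ℤ 0ℤ (z + 1ℤ) false) (flag false 0ℤ 0ℤ (z + 1ℤ) false) 2F
          (along (flag true 0ℤ 0ℤ z false) (flag false 0ℤ 0ℤ z false) (flag true 0ℤ 0ℤ z true) (flag false 0ℤ 0ℤ z true) 3F m
            (adjacent₃ true 0ℤ 0ℤ z) (adjacent₃ false 0ℤ 0ℤ z))
          (next true z) (next false z))
        (λ z m → along (flag true 0ℤ 0ℤ z true) (flag false 0ℤ 0ℤ z true) (flag true 0ℤ 0ℤ z false) (flag false 0ℤ 0ℤ z false) 3F
          (along (flag true 0ℤ 0ℤ (z + 1ℤ) false) (flag false 0ℤ 0ℤ (z + 1ℤ) false) (flag true 0ℤ 0ℤ z true) (flag false 0ℤ 0ℤ z true) 2F m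
            (sym′ (flag true 0ℤ 0ℤ z true) (flag true 0ℤ 0ℤ (z + 1ℤ) false) (next true z))
            (sym′ (flag false 0ℤ 0ℤ z true) (flag false 0ℤ 0ℤ (z + 1ℤ) false) (next false z)))
          (sym′ (flag true 0ℤ 0ℤ z false) (flag true 0ℤ 0ℤ z true) (adjacent₃ true 0ℤ 0ℤ z))
          (sym′ (flag false 0ℤ 0ℤ z false) (flag false 0ℤ 0ℤ z true) (adjacent₃ false 0ℤ 0ℤ z)))
      fixed : ∀ c → PosetIsomorphism.⟦_⟧ α (facet c) ≈ facet c
      fixed c = line c 4F
      A : ℤ → Bool → Flag
      A i b = flag false 1ℤ 0ℤ i b
      B : ℤ → Bool → Flag
      B i b = flag true -1ℤ 0ℤ i b
      -- After steps of ranks 1, 3, 2, 3 the two walks have reached position 2 of their n-gons, the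
      -- first position where T is not zero and the order of the facets differs.
      detour : P.Maps α (A 1ℤ true) (B 1ℤ true)
      detour = along (A 1ℤ false) (B 1ℤ false) (A 1ℤ true) (B 1ℤ true) 3F
        (along (A 0ℤ true) (B 0ℤ true) (A 1ℤ false) (B 1ℤ false) 2F
          (along (A 0ℤ false) (B 0ℤ false) (A 0ℤ true) (B 0ℤ true) 3F
            (along Φ₀ Φ₁ (A 0ℤ false) (B 0ℤ false) 1F maps (Φ₀^-adjacent 1F)
              (sym′ (B 0ℤ false) Φ₁ (adjacent₁ -1ℤ 0ℤ 0ℤ false 0ℤ 0ℤ mod-refl (≡⇒≡[] (solve (e ∷ []))))))
            (adjacent₃ false 1ℤ 0ℤ 0ℤ) (adjacent₃ true -1ℤ 0ℤ 0ℤ))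
          (adjacent₂ false 1ℤ 0ℤ 0ℤ 1ℤ (≡⇒≡[] (solve (K ∷ e ∷ [])))) (adjacent₂ true -1ℤ 0ℤ 0ℤ 1ℤ (≡⇒≡[] (solve (K ∷ e ∷ [])))))
        (adjacent₃ false 1ℤ 0ℤ 1ℤ) (adjacent₃ true -1ℤ 0ℤ 1ℤ)

    isChiral : IsChiral P
    isChiral = (Φ₀ , Φ₁ , ¬sameOrbit , λ Ψ → Sum.map (orbit {Φ₀} {Ψ}) (orbit {Φ₁} {Ψ}) (reach Ψ)) , adjacent-apart
      where
      open PolytopeProperties P using (sameOrbit-sym; sameOrbit-trans)
      orbit : ∀ {Φ Ψ} → Reach Φ Ψ → P.SameOrbit Φ Ψ
      orbit (t , maps) = eval t , maps
      adjacent-apart : ∀ j Φ Ψ → Adjacent j Φ Ψ → ¬ P.SameOrbit Φ Ψ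
      adjacent-apart j Φ Ψ adj same = [ from₀ , from₁ ]′ (reach Φ)
        where
        from₀ : Reach Φ₀ Φ → ⊥
        from₀ r = ¬sameOrbit (sameOrbit-trans Φ₀ Φ Φ₁ (orbit {Φ₀} {Φ} r)
          (sameOrbit-trans Φ Ψ Φ₁ same (sameOrbit-sym Φ₁ Ψ (orbit {Φ₁} {Ψ} (reach₀-adjacent Φ Ψ j adj r)))))
        from₁ : Reach Φ₁ Φ → ⊥
        from₁ r = ¬sameOrbit (sameOrbit-trans Φ₀ Ψ Φ₁ (orbit {Φ₀} {Ψ} (reach₁-adjacent Φ Ψ j adj r))
          (sameOrbit-trans Ψ Φ Φ₁ (sameOrbit-sym Φ Ψ same) (sameOrbit-sym Φ₁ Φ (orbit {Φ₁} {Φ} r))))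

-- The presented group

module NormalForm (β : ℕ) (e : ℤ) where

  private
    module G = Group (Λ₂ β e)
  open import Relation.Binary.Reasoning.Setoid G.setoid
  open import Algebra.Properties.Group (Λ₂ β e) using (inverseˡ-unique; inverseʳ-unique)

  W : Set
  W = Term (Fin 3)

  infix 4 _~_
  _~_ : Rel W 0ℓ
  _~_ = Derivable (Λ₂-Relation β e)

  pattern ~refl = Derivable.refl

  ~sym : ∀ {s t} → s ~ t → t ~ s
  ~sym = Derivable.sym

  ~trans : ∀ {s t u} → s ~ t → t ~ u → s ~ u
  ~trans = Derivable.trans

  ~assoc : ∀ s t u → (s ∙ t) ∙ u ~ s ∙ (t ∙ u)
  ~assoc = Derivable.assoc

  congˡ : ∀ {s s′} t → s ~ s′ → s ∙ t ~ s′ ∙ t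
  congˡ t p = ∙-cong p ~refl

  congʳ : ∀ {s s′} t → s ~ s′ → t ∙ s ~ t ∙ s′
  congʳ t p = ∙-cong ~refl p

  pow-suc : ∀ g k → g ^ k ∙ g ~ g ^ suc k
  pow-suc g zero    = ~trans (identityˡ g) (~sym (identityʳ g))
  pow-suc g (suc k) = ~trans (~assoc g (g ^ k) g) (congʳ g (pow-suc g k))

  pow-+ : ∀ g k l → g ^ (k ℕ.+ l) ~ g ^ k ∙ g ^ l
  pow-+ g zero    l = ~sym (identityˡ _)
  pow-+ g (suc k) l = ~trans (congʳ g (pow-+ g k l)) (~sym (~assoc g (g ^ k) (g ^ l)))

  pow-multiple : ∀ g m → g ^ m ~ ε → ∀ q → g ^ (q ℕ.* m) ~ ε
  pow-multiple g m p zero    = ~refl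
  pow-multiple g m p (suc q) = ~trans (pow-+ g m (q ℕ.* m)) (~trans (∙-cong p (pow-multiple g m p q)) (identityˡ ε))

  commute-pow : ∀ g h k → g ∙ h ~ h ∙ g → g ^ k ∙ h ~ h ∙ g ^ k
  commute-pow g h zero    p = ~trans (identityˡ h) (~sym (identityʳ h))
  commute-pow g h (suc k) p = begin
    (g ∙ g ^ k) ∙ h ≈⟨ ~assoc g (g ^ k) h ⟩
    g ∙ (g ^ k ∙ h) ≈⟨ congʳ g (commute-pow g h k p) ⟩
    g ∙ (h ∙ g ^ k) ≈⟨ ~sym (~assoc g h (g ^ k)) ⟩
    (g ∙ h) ∙ g ^ k ≈⟨ congˡ (g ^ k) p ⟩
    (h ∙ g) ∙ g ^ k ≈⟨ ~assoc h g (g ^ k) ⟩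
    h ∙ (g ∙ g ^ k) ∎

  inverse-pow : ∀ g k → g ^ suc k ~ ε → g ⁻¹ ~ g ^ k
  inverse-pow g k p = ~sym (inverseʳ-unique g (g ^ k) p)

  -- Natural exponents keep signs out of the normal form: if g has order dividing m + 1, then gᵏ⁺¹
  -- has the inverse g^((k+1) m).
  pow-ℤ : ∀ g m → g ^ suc m ~ ε → ∀ k → ∃[ l ] g ^ᶻ k ~ g ^ l
  pow-ℤ g m p (+ k)    = k , ~refl
  pow-ℤ g m p -[1+ k ] = suc k ℕ.* m , ~sym (inverseʳ-unique (g ^ suc k) (g ^ (suc k ℕ.* m))
    (~trans (~sym (pow-+ g (suc k) (suc k ℕ.* m))) (≡.subst (λ l → g ^ l ~ ε) (ℕ.*-suc (suc k) m) (pow-multiple g (suc m) p (suc k)))))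

  x y z w : W
  x = σ₁
  y = σ₂
  z = σ₃
  w = σ₂ ^ 2

  n₋ : ℕ
  n₋ = ℕ.pred (2 ℕ.^ β)

  z-order : z ^ suc n₋ ~ ε
  z-order = ≡.subst (λ k → z ^ k ~ ε) (≡.sym (ℕ.suc-pred (2 ℕ.^ β) {{ℕ.m^n≢0 2 β}})) (relation (rotation σ₃-order))

  x-order : x ^ 4 ~ ε
  x-order = relation (rotation σ₁-order)

  y-order : y ^ 8 ~ ε
  y-order = relation (rotation σ₂-order)

  square : ∀ g → g ^ 2 ~ g ∙ g
  square g = congʳ g (identityʳ g)

  w≈yy : w ~ y ∙ y
  w≈yy = square y

  pow-2* : ∀ g k → (g ^ 2) ^ k ~ g ^ (k ℕ.* 2)
  pow-2* g zero    = ~refl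
  pow-2* g (suc k) = ~trans (congʳ (g ^ 2) (pow-2* g k)) (~sym (pow-+ g 2 (k ℕ.* 2)))

  w-order : w ^ 4 ~ ε
  w-order = ~trans (pow-2* y 4) y-order

  wx : w ∙ x ~ x ∙ w
  wx = relation σ₂²σ₁

  y⁻¹ : y ⁻¹ ~ w ^ 3 ∙ y
  y⁻¹ = begin
    y ⁻¹          ≈⟨ inverse-pow y 7 y-order ⟩
    y ^ 7         ≈⟨ ~sym (pow-suc y 6) ⟩
    y ^ 6 ∙ y     ≈⟨ congˡ y (~sym (pow-2* y 3)) ⟩
    w ^ 3 ∙ y     ∎

  flip : ∀ g h → (g ∙ h) ^ 2 ~ ε → h ∙ g ~ g ⁻¹ ∙ h ⁻¹
  flip g h p = ~trans (~sym (identityˡ _)) (~trans (congˡ (h ∙ g) (~sym (inverseˡ g))) (~trans (~assoc (g ⁻¹) g (h ∙ g))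
    (congʳ (g ⁻¹) (inverseˡ-unique (g ∙ (h ∙ g)) h (begin
      (g ∙ (h ∙ g)) ∙ h ≈⟨ congˡ h (~sym (~assoc g h g)) ⟩
      ((g ∙ h) ∙ g) ∙ h ≈⟨ ~assoc (g ∙ h) g h ⟩
      (g ∙ h) ∙ (g ∙ h) ≈⟨ ~sym (square (g ∙ h)) ⟩
      (g ∙ h) ^ 2       ≈⟨ p ⟩
      ε                 ∎)))))

  yx : y ∙ x ~ x ^ 3 ∙ (w ^ 3 ∙ y)
  yx = ~trans (flip x y (relation (rotation σ₁σ₂-order))) (∙-cong (inverse-pow x 3 x-order) y⁻¹)

  yz≈z⁻¹y⁻¹ : y ∙ z ~ z ⁻¹ ∙ y ⁻¹
  yz≈z⁻¹y⁻¹ = inverse-product y z (relation (rotation σ₂σ₃-order))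
    where
    inverse-product : ∀ g h → (g ∙ h) ^ 2 ~ ε → g ∙ h ~ h ⁻¹ ∙ g ⁻¹
    inverse-product g h p = begin
      g ∙ h                             ≈⟨ ~sym (identityˡ _) ⟩
      ε ∙ (g ∙ h)                       ≈⟨ congˡ _ (~sym (inverseˡ h)) ⟩
      (h ⁻¹ ∙ h) ∙ (g ∙ h)              ≈⟨ ~assoc (h ⁻¹) h (g ∙ h) ⟩
      h ⁻¹ ∙ (h ∙ (g ∙ h))              ≈⟨ congʳ (h ⁻¹) (inverseʳ-unique g (h ∙ (g ∙ h))
                                            (~trans (~sym (~assoc g h (g ∙ h))) (~trans (~sym (square (g ∙ h))) p))) ⟩
      h ⁻¹ ∙ g ⁻¹                       ∎

  yz : y ∙ z ~ z ^ n₋ ∙ (w ^ 3 ∙ y)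
  yz = ~trans yz≈z⁻¹y⁻¹ (∙-cong (inverse-pow z n₋ z-order) y⁻¹)

  -- The last two rotation relations give z x = (x y) (z⁻¹ y⁻¹) = (x y) (y z), where y y = w can be
  -- moved past x.
  zx : z ∙ x ~ w ∙ (x ∙ z)
  zx = begin
    z ∙ x                       ≈⟨ ~sym (identityˡ _) ⟩
    ε ∙ (z ∙ x)                 ≈⟨ congˡ _ (~sym (inverseʳ y)) ⟩
    (y ∙ y ⁻¹) ∙ (z ∙ x)        ≈⟨ ~assoc y (y ⁻¹) (z ∙ x) ⟩
    y ∙ (y ⁻¹ ∙ (z ∙ x))        ≈⟨ congʳ y inner ⟩
    y ∙ (y ∙ (x ∙ z))           ≈⟨ ~sym (~assoc y y (x ∙ z)) ⟩
    (y ∙ y) ∙ (x ∙ z)           ≈⟨ congˡ _ (~sym w≈yy) ⟩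
    w ∙ (x ∙ z)                 ∎
    where
    -- z (x y) = (x y)⁻¹ z⁻¹ and (x y)⁻¹ = x y
    zxy : z ∙ (x ∙ y) ~ (x ∙ y) ∙ z ⁻¹
    zxy = ~trans (flip (x ∙ y) z (relation (rotation σ₁σ₂σ₃-order)))
      (congˡ (z ⁻¹) (~sym (inverseˡ-unique (x ∙ y) (x ∙ y) (~trans (~sym (square (x ∙ y))) (relation (rotation σ₁σ₂-order))))))
    zyx : z ∙ x ~ (x ∙ y) ∙ (z ⁻¹ ∙ y ⁻¹)
    zyx = begin
      z ∙ x                         ≈⟨ ~sym (identityʳ _) ⟩
      (z ∙ x) ∙ ε                   ≈⟨ congʳ _ (~sym (inverseʳ y)) ⟩
      (z ∙ x) ∙ (y ∙ y ⁻¹)          ≈⟨ ~sym (~assoc (z ∙ x) y (y ⁻¹)) ⟩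
      ((z ∙ x) ∙ y) ∙ y ⁻¹          ≈⟨ congˡ _ (~assoc z x y) ⟩
      (z ∙ (x ∙ y)) ∙ y ⁻¹          ≈⟨ congˡ _ zxy ⟩
      ((x ∙ y) ∙ z ⁻¹) ∙ y ⁻¹       ≈⟨ ~assoc (x ∙ y) (z ⁻¹) (y ⁻¹) ⟩
      (x ∙ y) ∙ (z ⁻¹ ∙ y ⁻¹)       ∎
    inner : y ⁻¹ ∙ (z ∙ x) ~ y ∙ (x ∙ z)
    inner = begin
      y ⁻¹ ∙ (z ∙ x)                ≈⟨ congʳ _ zyx ⟩
      y ⁻¹ ∙ ((x ∙ y) ∙ (z ⁻¹ ∙ y ⁻¹)) ≈⟨ congʳ _ (congʳ _ (~sym yz≈z⁻¹y⁻¹)) ⟩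
      y ⁻¹ ∙ ((x ∙ y) ∙ (y ∙ z))    ≈⟨ congʳ _ (~assoc x y (y ∙ z)) ⟩
      y ⁻¹ ∙ (x ∙ (y ∙ (y ∙ z)))    ≈⟨ congʳ _ (congʳ x (~sym (~assoc y y z))) ⟩
      y ⁻¹ ∙ (x ∙ ((y ∙ y) ∙ z))    ≈⟨ congʳ _ (congʳ x (congˡ z (~sym w≈yy))) ⟩
      y ⁻¹ ∙ (x ∙ (w ∙ z))          ≈⟨ congʳ _ (~sym (~assoc x w z)) ⟩
      y ⁻¹ ∙ ((x ∙ w) ∙ z)          ≈⟨ congʳ _ (congˡ z (~sym wx)) ⟩
      y ⁻¹ ∙ ((w ∙ x) ∙ z)          ≈⟨ congʳ _ (~assoc w x z) ⟩
      y ⁻¹ ∙ (w ∙ (x ∙ z))          ≈⟨ congʳ _ (congˡ _ w≈yy) ⟩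
      y ⁻¹ ∙ ((y ∙ y) ∙ (x ∙ z))    ≈⟨ congʳ _ (~assoc y y _) ⟩
      y ⁻¹ ∙ (y ∙ (y ∙ (x ∙ z)))    ≈⟨ ~sym (~assoc (y ⁻¹) y _) ⟩
      (y ⁻¹ ∙ y) ∙ (y ∙ (x ∙ z))    ≈⟨ congˡ _ (inverseˡ y) ⟩
      ε ∙ (y ∙ (x ∙ z))             ≈⟨ identityˡ _ ⟩
      y ∙ (x ∙ z)                   ∎

  xz : x ∙ z ~ w ^ 3 ∙ (z ∙ x)
  xz = begin
    x ∙ z                  ≈⟨ ~sym (identityˡ _) ⟩
    ε ∙ (x ∙ z)            ≈⟨ congˡ _ (~sym (~trans (pow-suc w 3) w-order)) ⟩
    (w ^ 3 ∙ w) ∙ (x ∙ z)  ≈⟨ ~assoc (w ^ 3) w (x ∙ z) ⟩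
    w ^ 3 ∙ (w ∙ (x ∙ z))  ≈⟨ congʳ (w ^ 3) (~sym zx) ⟩
    w ^ 3 ∙ (z ∙ x)        ∎

  -- For the normal form it is enough that some natural exponent exists; its value comes from the
  -- relation and is not tracked.
  zw : ∃[ l ] z ∙ w ~ w ∙ z ^ l
  zw with pow-ℤ z n₋ z-order (1ℤ + e * + (2 ℕ.^ (β ℕ.∸ 2)))
  ... | l , p = l , ~trans (relation σ₃σ₂²) (congʳ w p)

  zᵇw : ∀ b → ∃[ b′ ] z ^ b ∙ w ~ w ∙ z ^ b′
  zᵇw zero    = 0 , ~trans (identityˡ w) (~sym (identityʳ w))
  zᵇw (suc b) with zᵇw b | zw
  ... | b′ , p | l , q = l ℕ.+ b′ , (begin
    (z ∙ z ^ b) ∙ w        ≈⟨ ~assoc z (z ^ b) w ⟩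
    z ∙ (z ^ b ∙ w)        ≈⟨ congʳ z p ⟩
    z ∙ (w ∙ z ^ b′)       ≈⟨ ~sym (~assoc z w (z ^ b′)) ⟩
    (z ∙ w) ∙ z ^ b′       ≈⟨ congˡ _ q ⟩
    (w ∙ z ^ l) ∙ z ^ b′   ≈⟨ ~assoc w (z ^ l) (z ^ b′) ⟩
    w ∙ (z ^ l ∙ z ^ b′)   ≈⟨ congʳ w (~sym (pow-+ z l b′)) ⟩
    w ∙ z ^ (l ℕ.+ b′)     ∎)

  -- Each exchange of x with z costs a factor w³, which commutes with x and is collected on the
  -- left.
  xⁱz : ∀ i → ∃[ c ] x ^ i ∙ z ~ w ^ c ∙ (z ∙ x ^ i)
  xⁱz zero    = 0 , ~trans (identityˡ z) (~sym (~trans (identityˡ _) (identityʳ z)))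
  xⁱz (suc i) with xⁱz i
  ... | c , p = c ℕ.+ 3 , (begin
    (x ∙ x ^ i) ∙ z                   ≈⟨ ~assoc x (x ^ i) z ⟩
    x ∙ (x ^ i ∙ z)                   ≈⟨ congʳ x p ⟩
    x ∙ (w ^ c ∙ (z ∙ x ^ i))         ≈⟨ ~sym (~assoc x (w ^ c) _) ⟩
    (x ∙ w ^ c) ∙ (z ∙ x ^ i)         ≈⟨ congˡ _ (~sym (commute-pow w x c wx)) ⟩
    (w ^ c ∙ x) ∙ (z ∙ x ^ i)         ≈⟨ ~assoc (w ^ c) x _ ⟩
    w ^ c ∙ (x ∙ (z ∙ x ^ i))         ≈⟨ congʳ _ (~sym (~assoc x z _)) ⟩
    w ^ c ∙ ((x ∙ z) ∙ x ^ i)         ≈⟨ congʳ _ (congˡ _ xz) ⟩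
    w ^ c ∙ ((w ^ 3 ∙ (z ∙ x)) ∙ x ^ i) ≈⟨ congʳ _ (~assoc (w ^ 3) _ _) ⟩
    w ^ c ∙ (w ^ 3 ∙ ((z ∙ x) ∙ x ^ i)) ≈⟨ ~sym (~assoc (w ^ c) (w ^ 3) _) ⟩
    (w ^ c ∙ w ^ 3) ∙ ((z ∙ x) ∙ x ^ i) ≈⟨ ∙-cong (~sym (pow-+ w c 3)) (~assoc z x (x ^ i)) ⟩
    w ^ (c ℕ.+ 3) ∙ (z ∙ (x ∙ x ^ i)) ∎)

  -- The elements wᵃ zᵇ xⁱ form the subgroup of index two that preserves the cyclic order of the vertices.
  N₀ : W → Set
  N₀ t = ∃[ a ] ∃[ b ] ∃[ i ] t ~ w ^ a ∙ (z ^ b ∙ x ^ i)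

  -- Every term arises from ε by right multiplication, so a saturated set that contains ε and is
  -- closed under the generators and their inverses contains all terms.
  Closed : (W → Set) → W → Set
  Closed S g = ∀ {t} → S t → S (t ∙ g)

  record Saturated (S : W → Set) : Set where
    field resp : ∀ {s t} → s ~ t → S s → S t

    closed-ε : Closed S ε
    closed-ε s = resp (~sym (identityʳ _)) s

    closed-∙ : ∀ {g h} → Closed S g → Closed S h → Closed S (g ∙ h)
    closed-∙ cg ch s = resp (~assoc _ _ _) (ch (cg s))

    closed-~ : ∀ {g h} → g ~ h → Closed S g → Closed S h
    closed-~ p cg s = resp (congʳ _ p) (cg s)

    closed-^ : ∀ {g} k → Closed S g → Closed S (g ^ k)
    closed-^ zero    cg = closed-ε
    closed-^ (suc k) cg = closed-∙ cg (closed-^ k cg)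

  N₀-saturated : Saturated N₀
  N₀-saturated = record { resp = λ p (a , b , i , q) → a , b , i , ~trans (~sym p) q }

  N₀-x : Closed N₀ x
  N₀-x {t} (a , b , i , p) = a , b , suc i , (begin
    t ∙ x                             ≈⟨ congˡ x p ⟩
    (w ^ a ∙ (z ^ b ∙ x ^ i)) ∙ x     ≈⟨ ~assoc _ _ x ⟩
    w ^ a ∙ ((z ^ b ∙ x ^ i) ∙ x)     ≈⟨ congʳ _ (~assoc _ _ x) ⟩
    w ^ a ∙ (z ^ b ∙ (x ^ i ∙ x))     ≈⟨ congʳ _ (congʳ _ (pow-suc x i)) ⟩
    w ^ a ∙ (z ^ b ∙ x ^ suc i)       ∎)

  insert-w : ∀ a b → ∃[ a′ ] ∃[ b′ ] (w ^ a ∙ z ^ b) ∙ w ~ w ^ a′ ∙ z ^ b′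
  insert-w a b with zᵇw b
  ... | b′ , p = suc a , b′ , (begin
    (w ^ a ∙ z ^ b) ∙ w     ≈⟨ ~assoc _ _ w ⟩
    w ^ a ∙ (z ^ b ∙ w)     ≈⟨ congʳ _ p ⟩
    w ^ a ∙ (w ∙ z ^ b′)    ≈⟨ ~sym (~assoc _ w _) ⟩
    (w ^ a ∙ w) ∙ z ^ b′    ≈⟨ congˡ _ (pow-suc w a) ⟩
    w ^ suc a ∙ z ^ b′      ∎)

  insert-wᶜ : ∀ c a b → ∃[ a′ ] ∃[ b′ ] (w ^ a ∙ z ^ b) ∙ w ^ c ~ w ^ a′ ∙ z ^ b′
  insert-wᶜ zero    a b = a , b , identityʳ _
  insert-wᶜ (suc c) a b with insert-w a b
  ... | a₁ , b₁ , p with insert-wᶜ c a₁ b₁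
  ...   | a₂ , b₂ , q = a₂ , b₂ , ~trans (~sym (~assoc _ w (w ^ c))) (~trans (congˡ _ p) q)

  N₀-w : Closed N₀ w
  N₀-w {t} (a , b , i , p) with insert-w a b
  ... | a′ , b′ , q = a′ , b′ , i , (begin
    t ∙ w                             ≈⟨ congˡ w (~trans p (~sym (~assoc _ _ _))) ⟩
    ((w ^ a ∙ z ^ b) ∙ x ^ i) ∙ w     ≈⟨ ~assoc _ _ w ⟩
    (w ^ a ∙ z ^ b) ∙ (x ^ i ∙ w)     ≈⟨ congʳ _ (commute-pow x w i (~sym wx)) ⟩
    (w ^ a ∙ z ^ b) ∙ (w ∙ x ^ i)     ≈⟨ ~sym (~assoc _ w _) ⟩
    ((w ^ a ∙ z ^ b) ∙ w) ∙ x ^ i     ≈⟨ congˡ _ q ⟩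
    (w ^ a′ ∙ z ^ b′) ∙ x ^ i         ≈⟨ ~assoc _ _ _ ⟩
    w ^ a′ ∙ (z ^ b′ ∙ x ^ i)         ∎)

  N₀-z : Closed N₀ z
  N₀-z {t} (a , b , i , p) with xⁱz i
  ... | c , q with insert-wᶜ c a b
  ...   | a′ , b′ , r = a′ , suc b′ , i , (begin
    t ∙ z                                     ≈⟨ congˡ z (~trans p (~sym (~assoc _ _ _))) ⟩
    ((w ^ a ∙ z ^ b) ∙ x ^ i) ∙ z             ≈⟨ ~assoc _ _ z ⟩
    (w ^ a ∙ z ^ b) ∙ (x ^ i ∙ z)             ≈⟨ congʳ _ q ⟩
    (w ^ a ∙ z ^ b) ∙ (w ^ c ∙ (z ∙ x ^ i))   ≈⟨ ~sym (~assoc _ (w ^ c) _) ⟩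
    ((w ^ a ∙ z ^ b) ∙ w ^ c) ∙ (z ∙ x ^ i)   ≈⟨ congˡ _ r ⟩
    (w ^ a′ ∙ z ^ b′) ∙ (z ∙ x ^ i)           ≈⟨ ~assoc _ _ _ ⟩
    w ^ a′ ∙ (z ^ b′ ∙ (z ∙ x ^ i))           ≈⟨ congʳ _ (~sym (~assoc _ z _)) ⟩
    w ^ a′ ∙ ((z ^ b′ ∙ z) ∙ x ^ i)           ≈⟨ congʳ _ (congˡ _ (pow-suc z b′)) ⟩
    w ^ a′ ∙ (z ^ suc b′ ∙ x ^ i)             ∎)

  module N₀ = Saturated N₀-saturated

  N : W → Set
  N t = N₀ t ⊎ (∃[ s ] N₀ s × t ~ s ∙ y)

  N-saturated : Saturated N
  N-saturated = record { resp = λ p → Sum.map (N₀.resp p) (λ (s , m , q) → s , m , ~trans (~sym p) q) }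

  module N = Saturated N-saturated

  -- On the coset of y, right multiplication by g becomes right multiplication of the factor in `N₀`
  -- by h; so closure of `N₀` under g and h suffices.
  y-past : ∀ {g h} → y ∙ g ~ h ∙ y → Closed N₀ g → Closed N₀ h → Closed N g
  y-past p cg ch (inj₁ m) = inj₁ (cg m)
  y-past {g} {h} p cg ch {t} (inj₂ (s , m , q)) = inj₂ (s ∙ h , ch m , (begin
    t ∙ g         ≈⟨ congˡ g q ⟩
    (s ∙ y) ∙ g   ≈⟨ ~assoc s y g ⟩
    s ∙ (y ∙ g)   ≈⟨ congʳ s p ⟩
    s ∙ (h ∙ y)   ≈⟨ ~sym (~assoc s h y) ⟩
    (s ∙ h) ∙ y   ∎))

  N-x : Closed N x
  N-x = y-past {x} {x ^ 3 ∙ w ^ 3} (~trans yx (~sym (~assoc _ _ y))) N₀-x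
    (N₀.closed-∙ {x ^ 3} {w ^ 3} (N₀.closed-^ {x} 3 N₀-x) (N₀.closed-^ {w} 3 N₀-w))

  N-z : Closed N z
  N-z = y-past {z} {z ^ n₋ ∙ w ^ 3} (~trans yz (~sym (~assoc _ _ y))) N₀-z
    (N₀.closed-∙ {z ^ n₋} {w ^ 3} (N₀.closed-^ {z} n₋ N₀-z) (N₀.closed-^ {w} 3 N₀-w))

  N-y : Closed N y
  N-y (inj₁ m) = inj₂ (_ , m , ~refl)
  N-y {t} (inj₂ (s , m , q)) = inj₁ (N₀.resp {s ∙ w} (~sym (begin
    t ∙ y         ≈⟨ congˡ y q ⟩
    (s ∙ y) ∙ y   ≈⟨ ~assoc s y y ⟩
    s ∙ (y ∙ y)   ≈⟨ congʳ s (~sym w≈yy) ⟩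
    s ∙ w         ∎)) (N₀-w m))

  -- Inverses are formal in terms, so the induction has to carry t and t⁻¹ together.
  closed : ∀ t → Closed N t × Closed N (t ⁻¹)
  closed (gen 0F) = N-x , N.closed-~ (~sym (inverse-pow x 3 x-order)) (N.closed-^ {x} 3 N-x)
  closed (gen 1F) = N-y , N.closed-~ (~sym (inverse-pow y 7 y-order)) (N.closed-^ {y} 7 N-y)
  closed (gen 2F) = N-z , N.closed-~ (~sym (inverse-pow z n₋ z-order)) (N.closed-^ {z} n₋ N-z)
  closed ε        = N.closed-ε , N.closed-~ (inverseʳ-unique ε ε (identityˡ ε)) N.closed-ε
  closed (s ∙ t)  = N.closed-∙ {s} {t} (proj₁ (closed s)) (proj₁ (closed t))
                  , N.closed-~ {t ⁻¹ ∙ s ⁻¹} (inverseʳ-unique (s ∙ t) (t ⁻¹ ∙ s ⁻¹) cancel)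
                      (N.closed-∙ {t ⁻¹} {s ⁻¹} (proj₂ (closed t)) (proj₂ (closed s)))
    where
    cancel : (s ∙ t) ∙ (t ⁻¹ ∙ s ⁻¹) ~ ε
    cancel = begin
      (s ∙ t) ∙ (t ⁻¹ ∙ s ⁻¹)   ≈⟨ ~assoc s t _ ⟩
      s ∙ (t ∙ (t ⁻¹ ∙ s ⁻¹))   ≈⟨ congʳ s (~sym (~assoc t (t ⁻¹) (s ⁻¹))) ⟩
      s ∙ ((t ∙ t ⁻¹) ∙ s ⁻¹)   ≈⟨ congʳ s (congˡ _ (inverseʳ t)) ⟩
      s ∙ (ε ∙ s ⁻¹)            ≈⟨ congʳ s (identityˡ _) ⟩
      s ∙ s ⁻¹                  ≈⟨ inverseʳ s ⟩
      ε                         ∎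
  closed (t ⁻¹)   = proj₂ (closed t)
                  , N.closed-~ {t} (inverseʳ-unique (t ⁻¹) t (inverseˡ t)) (proj₁ (closed t))

  normal-form : ∀ t → N t
  normal-form t = N.resp (identityˡ t) (proj₁ (closed t) {ε} (inj₁ (0 , 0 , 0 , ~sym (~trans (identityˡ _) (identityˡ ε)))))

  pow-order : ∀ g m → g ^ m ~ ε → ∀ k → + k ≡[ + m ] 0ℤ → g ^ k ~ ε
  pow-order g m p k (by q eq) = ≡.subst (λ l → g ^ l ~ ε) (≡.sym k≡) (pow-multiple g m p ℤ.∣ q ∣)
    where
    k≡ : k ≡ ℤ.∣ q ∣ ℕ.* m
    k≡ = ≡.trans (≡.cong ℤ.∣_∣ (≡.trans eq (ℤ.+-identityˡ (q * + m)))) (ℤ.abs-* q (+ m))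

-- The action of the presented group is faithful and gives all automorphisms

module AutomorphismGroupOfP (β : ℕ) (K e : ℤ) .{{_ : ℤ.NonZero K}} (e² : e * e ≡ 1ℤ)
  (2^β : + (2 ℕ.^ β) ≡ + 32 * K) (2^β∸2 : + (2 ℕ.^ (β ℕ.∸ 2)) ≡ + 8 * K) where
  open Chirality K e e²
  open NormalForm β e

  act-N₀ : ∀ a b i F → act (w ^ a ∙ (z ^ b ∙ x ^ i)) F ≈ rotate (+ i) 0ℤ (shift (+ b) (rotate 0ℤ (+ a * e) F))
  act-N₀ a b i F = ≈-trans (act-σ₁^ i _) (rotate-cong mod-refl mod-refl
    (≈-trans (act-σ₃^ b _) (shift-cong mod-refl (act-σ₂²^ a F))))

  -- The exponents of a normal form can be read off: i from the vertex 0, then b from the facet 0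
  -- and a from the edge (0 , 0). A final y would make the action on the vertices v ↦ 2 - i - v, and
  -- this cannot fix both 0 and 1 modulo 4.
  kernel-trivial : ∀ t → (∀ F → act t F ≈ F) → t ~ ε
  kernel-trivial t fixes with normal-form t
  ... | inj₁ (a , b , i , p) = ~trans p (∙-cong′ wᵃ (∙-cong′ zᵇ xⁱ))
    where
    ∙-cong′ : ∀ {s u} → s ~ ε → u ~ ε → s ∙ u ~ ε
    ∙-cong′ p q = ~trans (∙-cong p q) (identityˡ ε)
    moves : ∀ F → rotate (+ i) 0ℤ (shift (+ b) (rotate 0ℤ (+ a * e) F)) ≈ F
    moves F = ≈-trans (≈-sym (act-N₀ a b i F)) (≈-trans (≈-sym (derivable-holds β 2^β 2^β∸2 p F)) (fixes F))
    i≡0 : + i ≡[ + 4 ] 0ℤ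
    i≡0 = case moves (vert 0ℤ) of λ where
      (vert≈ q) → mod-trans (≡⇒≡[] (≡.sym (ℤ.+-identityˡ (+ i)))) q
    moves′ : ∀ F → shift (+ b) (rotate 0ℤ (+ a * e) F) ≈ F
    moves′ F = ≈-trans (≈-sym (≈-trans (rotate-cong i≡0 mod-refl ≈-refl) (rotate-0 _))) (moves F)
    b≡0 : + b ≡[ + 32 * K ] 0ℤ
    b≡0 = from (moves′ (facet 0ℤ))
      where
      simp : ∀ K e a b → b ≡ 0ℤ + + 8 * K * (e * 0ℤ * 0ℤ + a * e * 0ℤ) + b
      simp = solve-∀
      from : shift (+ b) (rotate 0ℤ (+ a * e) (facet 0ℤ)) ≈ facet 0ℤ → + b ≡[ + 32 * K ] 0ℤ
      from (facet≈ q) = mod-trans (≡⇒≡[] (simp K e (+ a) (+ b))) q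
    a≡0 : + a ≡[ + 4 ] 0ℤ
    a≡0 = from (moves′ (edge 0ℤ 0ℤ))
      where
      simp : ∀ e a b → a * (e * e) ≡ e * (0ℤ + a * e - e * (0ℤ + 0ℤ) * b)
      simp = solve-∀
      from : shift (+ b) (rotate 0ℤ (+ a * e) (edge 0ℤ 0ℤ)) ≈ edge 0ℤ 0ℤ → + a ≡[ + 4 ] 0ℤ
      from (edge≈ _ q) = mod-trans
        (≡⇒≡[] (≡.trans (≡.sym (ℤ.*-identityʳ (+ a))) (≡.trans (≡.cong (λ x → + a * x) (≡.sym e²)) (simp e (+ a) (+ b)))))
        (mod-trans (mod-*ˡ e q) (≡⇒≡[] (ℤ.*-zeroʳ e)))
    wᵃ : w ^ a ~ ε
    wᵃ = pow-order w 4 w-order a a≡0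
    zᵇ : z ^ b ~ ε
    zᵇ = pow-order z (2 ℕ.^ β) (relation (rotation σ₃-order)) b (≡.subst (λ d → + b ≡[ d ] 0ℤ) (≡.sym 2^β) b≡0)
    xⁱ : x ^ i ~ ε
    xⁱ = pow-order x 4 x-order i i≡0
  ... | inj₂ (s , (a , b , i , p) , q) = ⊥-elim (2≢0 (mod-trans (≡⇒≡[] (simp (+ i)))
        (mod-+ (mod-+ (at 0ℤ) (mod-neg (at 1ℤ))) mod-refl)))
    where
    moves : ∀ v → vert (1ℤ - (v + 0ℤ + + i + -1ℤ)) ≈ vert v
    moves v = ≈-trans (≈-sym (act-cong y (act-N₀ a b i (vert v))))
      (≈-trans (≈-sym (derivable-holds β 2^β 2^β∸2 (~trans q (congˡ y p)) (vert v))) (fixes (vert v)))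
    at : ∀ v → 1ℤ - (v + 0ℤ + + i + -1ℤ) ≡[ + 4 ] v
    at v = case moves v of λ { (vert≈ r) → r }
    simp : ∀ i → + 2 ≡ 1ℤ - (0ℤ + 0ℤ + i + -1ℤ) + - (1ℤ - (1ℤ + 0ℤ + i + -1ℤ)) + 1ℤ
    simp = solve-∀

  isAutomorphismGroup : IsAutomorphismGroup (Λ₂ β e) gen P
  isAutomorphismGroup = Φ₀ , eval , record
    { isGroupMonomorphism = record
      { isGroupHomomorphism = record
        { isMonoidHomomorphism = record
          { isMagmaHomomorphism = record
            { isRelHomomorphism = record { cong = λ p → derivable-holds β 2^β 2^β∸2 p }
            ; homo = λ _ _ _ → ≈-refl
            }
          ; ε-homo = λ _ → ≈-refl
          }
        ; ⁻¹-homo = λ _ _ → ≈-refl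
        }
      ; injective = λ {s} {t} p → injective s t p
      }
    ; surjective = λ α → proj₁ (preimage α) , λ {t} p F →
        ≈-trans (derivable-holds β 2^β 2^β∸2 p F) (proj₂ (preimage α) F)
    } , standardGenerators
    where
    open import Algebra.Properties.Group (Λ₂ β e) using (x∙y⁻¹≈ε⇒x≈y)

    injective : ∀ s t → (∀ F → act s F ≈ act t F) → s ~ t
    injective s t p = x∙y⁻¹≈ε⇒x≈y s t (kernel-trivial (s ∙ t ⁻¹)
      λ F → ≈-trans (act-cong (t ⁻¹) (p F)) (act-⁻¹ˡ t F))

    preimage : ∀ α → ∃[ t ] (∀ F → act t F ≈ PosetIsomorphism.⟦_⟧ α F)
    preimage α = reached (reach Ψ)
      where
      Ψ : Flag
      Ψ = automorphism-flag P α Φ₀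
      reached : Reach Φ₀ Ψ ⊎ Reach Φ₁ Ψ → ∃[ t ] (∀ F → act t F ≈ PosetIsomorphism.⟦_⟧ α F)
      reached (inj₁ (t , maps)) = t , rigid (eval t) α maps
      -- If α took Φ₀ into the class of Φ₁, the two flags would share an orbit.
      reached (inj₂ (t , maps)) = contradiction
        (PolytopeProperties.sameOrbit-trans P Φ₀ Ψ Φ₁ (α , λ k → ≈-refl)
          (PolytopeProperties.sameOrbit-sym P Φ₁ Ψ (eval t , maps))) ¬sameOrbit

-- Type and tightness

module PolytopeType (K e : ℤ) (e² : e * e ≡ 1ℤ) (n : ℕ) .{{_ : NonZero n}} (n≡32K : + n ≡ + 32 * K) where
  open Flags K e

  P : Polytope 4
  P = polytope e²

  vert-of : ∀ {F} → toℕ (rank F) ≡ 1 → ∃[ v ] F ≡ vert v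
  vert-of {vert v} _ = v , refl

  edge-of : ∀ {F} → toℕ (rank F) ≡ 2 → ∃[ s ] ∃[ m ] F ≡ edge s m
  edge-of {edge s m} _ = s , m , refl

  poly-of : ∀ {F} → toℕ (rank F) ≡ 3 → ∃[ i ] ∃[ j ] F ≡ poly i j
  poly-of {poly i j} _ = i , j , refl

  facet-of : ∀ {F} → toℕ (rank F) ≡ 4 → ∃[ c ] F ≡ facet c
  facet-of {facet c} _ = c , refl

  module Section = PolygonalSection rankedPoset ≼-rank ≼∧rank≡⇒≈

  polygons : HasPolygonalSections P 0 4
  polygons bot (poly i j) F≤G _ _ = polygonal ν η
    (λ h h′ p → case vert-of (level h) of λ { (_ , refl) → case p of λ { (vert≈ q) → q } })
    ν-injective
    (λ h h′ p → case edge-of (level h) of λ { (_ , _ , refl) → case p of λ { (edge≈ q _) → q } })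
    η-injective
    incident⁺
    incident⁻
    (λ z → vert z , in-section (cover bot⋖vert) (far (s≤s (s≤s (s≤s z≤n)))) refl , mod-refl)
    (λ z → edge z (j - e * z * i) , in-section (far (s≤s (s≤s z≤n))) (cover (edge⋖poly (≡⇒≡[] (remainder j (e * z * i))))) refl , mod-refl)
    where
    open Section 4 0 F≤G refl refl
    open In
    ν η : Face → ℤ
    ν (vert v) = v
    ν _        = 0ℤ
    η (edge s m) = s
    η _          = 0ℤ
    ν-injective : ∀ {H H′} → In 1 H → In 1 H′ → ν H ≡[ + 4 ] ν H′ → H ≈ H′
    ν-injective h h′ p with vert-of (level h) | vert-of (level h′)
    ... | v , refl | v′ , refl = vert≈ p
    η-injective : ∀ {H H′} → In 2 H → In 2 H′ → η H ≡[ + 4 ] η H′ → H ≈ H′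
    η-injective h h′ p with edge-of (level h) | edge-of (level h′)
    ... | s , m , refl | s′ , m′ , refl with ≼⇒⋖ (below h) refl | ≼⇒⋖ (below h′) refl
    ...   | edge⋖poly q | edge⋖poly q′ = edge≈ p (mod-trans (≡⇒≡[] (cancel-summand (e * s * i) m))
      (mod-trans (mod-+ (mod-trans (mod-sym q) q′) (mod-neg (mod-* (mod-*ˡ e p) (mod-refl {a = i}))))
        (≡⇒≡[] (≡.sym (cancel-summand (e * s′ * i) m′)))))
    incident⁺ : ∀ {H H′} → In 1 H → In 2 H′ → H ≼ H′ → ν H ≡[ + 4 ] η H′ ⊎ ν H ≡[ + 4 ] η H′ + 1ℤ
    incident⁺ h h′ H≤H′ with vert-of (level h) | edge-of (level h′)
    ... | v , refl | s , m , refl with ≼⇒⋖ H≤H′ refl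
    ...   | vert⋖edge p = p
    incident⁻ : ∀ {H H′} → In 1 H → In 2 H′ → ν H ≡[ + 4 ] η H′ ⊎ ν H ≡[ + 4 ] η H′ + 1ℤ → H ≼ H′
    incident⁻ h h′ p with vert-of (level h) | edge-of (level h′)
    ... | v , refl | s , m , refl = cover (vert⋖edge p)

  -- The inverse κ = θ (- s) (- m) straightens the walk around the edge: the polygon (i , j) gets
  -- position κ i, and its facets have κ-values κ i and κ i + 1.
  edge-polygons : HasPolygonalSections P 2 n
  edge-polygons (edge s m) top F≤G _ _ = polygonal ν η
    (λ h h′ p → case poly-of (level h) of λ { (_ , _ , refl) → case p of λ { (poly≈ q _) → toN (κ-cong q) } })
    ν-injective
    (λ h h′ p → case facet-of (level h) of λ { (_ , refl) → case p of λ { (facet≈ q) → mod-+ (toN (κ-cong q)) mod-refl } })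
    η-injective
    incident⁺
    incident⁻
    (λ z → poly (θ s m z) (e * s * θ s m z + m) ,
      in-section (cover (edge⋖poly mod-refl)) (far (s≤s (s≤s (s≤s (s≤s (s≤s z≤n)))))) refl , toN (κθ z))
    (λ z → facet (θ s m (z + 1ℤ)) ,
      in-section (far (s≤s (s≤s (s≤s (s≤s z≤n))))) (cover facet⋖top) refl ,
      toN (mod-trans (mod-+ (κθ (z + 1ℤ)) mod-refl) (≡⇒≡[] (+1-1 z))))
    where
    open Section n 2 F≤G refl refl
    open In
    toN : ∀ {a b} → a ≡[ + 32 * K ] b → a ≡[ + n ] b
    toN = ≡.subst (λ d → _ ≡[ d ] _) (≡.sym n≡32K)
    fromN : ∀ {a b} → a ≡[ + n ] b → a ≡[ + 32 * K ] b
    fromN = ≡.subst (λ d → _ ≡[ d ] _) n≡32K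
    κ : ℤ → ℤ
    κ = θ (- s) (- m)
    κ-cong : ∀ {c c′} → c ≡[ + 32 * K ] c′ → κ c ≡[ + 32 * K ] κ c′
    κ-cong = θ-cong (mod-refl {a = - s}) (mod-refl {a = - m})
    κ-injective : ∀ {c c′} → κ c ≡[ + 32 * K ] κ c′ → c ≡[ + 32 * K ] c′
    κ-injective {c} {c′} p = mod-trans (mod-sym (θ-inverse s m c))
      (mod-trans (θ-cong (mod-refl {a = s}) (mod-refl {a = m}) p) (θ-inverse s m c′))
    κθ : ∀ z → κ (θ s m z) ≡[ + 32 * K ] z
    κθ z = mod-trans (θ-+ (- s) (- m) s m z)
      (≡⇒≡[] (≡.trans (≡.cong₂ (λ x y → θ x y z) (ℤ.+-inverseˡ s) (ℤ.+-inverseˡ m)) (θ-0 z)))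
    κ-next : ∀ i j → j ≡[ + 4 ] e * s * i + m → κ (i + 1ℤ + + 8 * K * j) ≡[ + 32 * K ] κ i + 1ℤ
    κ-next i j p = mod-trans (θ-next (- s) (- m) i j) (mod-trans
      (mod-+ (mod-refl {a = κ i + 1ℤ}) (scale (mod-trans (mod-+ (mod-+ p (mod-refl {a = e * - s * i})) (mod-refl {a = - m})) (≡⇒≡[] (vanish e s i m)))))
      (≡⇒≡[] (drop K (κ i + 1ℤ))))
      where
      vanish : ∀ e s i m → e * s * i + m + e * - s * i + - m ≡ 0ℤ
      vanish = solve-∀
      drop : ∀ K x → x + + 8 * K * 0ℤ ≡ x
      drop = solve-∀
    +1-1 : ∀ z → z + 1ℤ - 1ℤ ≡ z
    +1-1 = solve-∀
    -1+1 : ∀ z → z - 1ℤ + 1ℤ ≡ z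
    -1+1 = solve-∀
    ν η : Face → ℤ
    ν (poly i j) = κ i
    ν _          = 0ℤ
    -- The facet c joins the polygons at positions κ c - 1 and κ c, while edge number k of a polygon
    -- joins the vertices k and k + 1; hence the offset.
    η (facet c)  = κ c - 1ℤ
    η _          = 0ℤ
    ν-injective : ∀ {H H′} → In 1 H → In 1 H′ → ν H ≡[ + n ] ν H′ → H ≈ H′
    ν-injective h h′ p with poly-of (level h) | poly-of (level h′)
    ... | i , j , refl | i′ , j′ , refl with ≼⇒⋖ (above h) refl | ≼⇒⋖ (above h′) refl
    ...   | edge⋖poly q | edge⋖poly q′ = poly≈ i≡ (mod-trans q (mod-trans (side-cong (mod-refl {a = s}) i≡ (mod-refl {a = m})) (mod-sym q′)))
      where i≡ = κ-injective (fromN p)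
    η-injective : ∀ {H H′} → In 2 H → In 2 H′ → η H ≡[ + n ] η H′ → H ≈ H′
    η-injective h h′ p with facet-of (level h) | facet-of (level h′)
    ... | c , refl | c′ , refl = facet≈ (κ-injective (mod-trans (≡⇒≡[] (≡.sym (-1+1 (κ c))))
      (mod-trans (mod-+ (fromN p) mod-refl) (≡⇒≡[] (-1+1 (κ c′))))))
    incident⁺ : ∀ {H H′} → In 1 H → In 2 H′ → H ≼ H′ → ν H ≡[ + n ] η H′ ⊎ ν H ≡[ + n ] η H′ + 1ℤ
    incident⁺ h h′ H≤H′ with poly-of (level h) | facet-of (level h′)
    ... | i , j , refl | c , refl with ≼⇒⋖ (above h) refl | ≼⇒⋖ H≤H′ refl
    ...   | edge⋖poly q | poly⋖facet (inj₁ p) = inj₂ (toN (mod-trans (κ-cong (mod-sym p)) (≡⇒≡[] (≡.sym (-1+1 (κ c))))))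
    ...   | edge⋖poly q | poly⋖facet (inj₂ p) = inj₁ (toN (mod-trans (≡⇒≡[] (≡.sym (+1-1 (κ i))))
      (mod-+ (mod-sym (mod-trans (κ-cong p) (κ-next i j q))) mod-refl)))
    incident⁻ : ∀ {H H′} → In 1 H → In 2 H′ → ν H ≡[ + n ] η H′ ⊎ ν H ≡[ + n ] η H′ + 1ℤ → H ≼ H′
    incident⁻ h h′ p with poly-of (level h) | facet-of (level h′)
    ... | i , j , refl | c , refl with ≼⇒⋖ (above h) refl | p
    ...   | edge⋖poly q | inj₂ r = cover (poly⋖facet (inj₁ (κ-injective
      (mod-trans (≡⇒≡[] (≡.sym (-1+1 (κ c)))) (mod-sym (fromN r))))))
    ...   | edge⋖poly q | inj₁ r = cover (poly⋖facet (inj₂ (κ-injective (mod-trans (≡⇒≡[] (≡.sym (-1+1 (κ c))))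
      (mod-trans (mod-+ (mod-sym (fromN r)) mod-refl) (mod-sym (κ-next i j q)))))))

  bit : Bool → ℤ
  bit false = 0ℤ
  bit true  = 1ℤ

  double : ∀ {a b} → a ≡[ + 4 ] b → + 2 * a ≡[ + 8 ] + 2 * b
  double {_} {b} (by q refl) = by q (solve (b ∷ q ∷ []))

  undouble : ∀ {a b} → + 2 * a ≡[ + 8 ] + 2 * b → a ≡[ + 4 ] b
  undouble {a} {b} (by q eq) = by q (halve (≡.trans eq (solve (b ∷ q ∷ []))))

  odd≢even : ∀ {x y} → ¬ + 2 * x + 1ℤ ≡[ + 8 ] + 2 * y
  odd≢even {x} {y} (by q eq) = 1≢2x {y + q * + 4 - x} (≡.trans (one x) (≡.trans (≡.cong (_- + 2 * x) eq) (solve (x ∷ y ∷ q ∷ []))))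
    where
    one : ∀ x → 1ℤ ≡ + 2 * x + 1ℤ - + 2 * x
    one = solve-∀

  e[ea] : ∀ a → e * (e * a) ≡ a
  e[ea] a = ≡.trans (≡.sym (ℤ.*-assoc e e a)) (≡.trans (≡.cong (_* a) e²) (ℤ.*-identityˡ a))

  e-cancel : ∀ {a b} → e * a ≡[ + 4 ] e * b → a ≡[ + 4 ] b
  e-cancel {a} {b} p = mod-trans (≡⇒≡[] (≡.sym (e[ea] a))) (mod-trans (mod-*ˡ e p) (≡⇒≡[] (e[ea] b)))

  vertex-figures : HasPolygonalSections P 1 8
  vertex-figures (vert v) (facet c) F≤G _ _ = polygonal ν η
    ν-cong ν-injective η-cong η-injective incident⁺ incident⁻ ν-surjective η-surjective
    where
    open Section 8 1 F≤G refl refl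
    open In

    -- τ tells whether v is the first or the second vertex of an edge, υ whether c is the first or
    -- the second facet of a polygon; both are the parities of the positions in the 8-gon.
    τ : ℤ → Bool
    τ s with mod-dec {+ 4} v s
    ... | yes _ = false
    ... | no _  = true

    υ : ℤ → Bool
    υ i with mod-dec {+ 32 * K} c i
    ... | yes _ = false
    ... | no _  = true

    τ-spec : ∀ s → v ≡[ + 4 ] s ⊎ v ≡[ + 4 ] s + 1ℤ → v ≡[ + 4 ] vertexOf (τ s) s
    τ-spec s r with mod-dec {+ 4} v s | r
    ... | yes p | _      = p
    ... | no ¬p | inj₁ p = contradiction p ¬p
    ... | no ¬p | inj₂ p = p

    τ-unique : ∀ t s → v ≡[ + 4 ] vertexOf t s → τ s ≡ t
    τ-unique t s r with mod-dec {+ 4} v s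
    τ-unique false s r | yes p = refl
    τ-unique true  s r | yes p = contradiction (mod-trans (mod-sym p) r) (unit-shift 0ℤ)
    τ-unique false s r | no ¬p = contradiction r ¬p
    τ-unique true  s r | no ¬p = refl

    υ-spec : ∀ i j → c ≡[ + 32 * K ] i ⊎ c ≡[ + 32 * K ] i + 1ℤ + + 8 * K * j → c ≡[ + 32 * K ] facetOf (υ i) i j
    υ-spec i j r with mod-dec {+ 32 * K} c i | r
    ... | yes p | _      = p
    ... | no ¬p | inj₁ p = contradiction p ¬p
    ... | no ¬p | inj₂ p = p

    υ-unique : ∀ t i j → c ≡[ + 32 * K ] facetOf t i j → υ i ≡ t
    υ-unique t i j r with mod-dec {+ 32 * K} c i
    υ-unique false i j r | yes p = refl
    υ-unique true  i j r | yes p = contradiction (mod4 (mod-trans (mod-sym p) r)) (next≢ i j)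
    υ-unique false i j r | no ¬p = contradiction r ¬p
    υ-unique true  i j r | no ¬p = refl

    side : ∀ t s → v ≡[ + 4 ] vertexOf t s → s ≡[ + 4 ] v - bit t
    side false s p = mod-trans (mod-sym p) (≡⇒≡[] (≡.sym (ℤ.+-identityʳ v)))
    side true  s p = mod-trans (≡⇒≡[] (successor s)) (mod-+ (mod-sym p) mod-refl)

    height : ∀ t i j → c ≡[ + 32 * K ] facetOf t i j → i ≡[ + 4 ] c - bit t
    height false i j p = mod-trans (mod-sym (mod4 p)) (≡⇒≡[] (≡.sym (ℤ.+-identityʳ c)))
    height true  i j p = mod-trans (by (- (+ 2 * K * j)) (back K i j)) (mod-+ (mod-sym (mod4 p)) mod-refl)
      where
      back : ∀ K i j → i ≡ i + 1ℤ + + 8 * K * j - 1ℤ + - (+ 2 * K * j) * + 4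
      back = solve-∀

    -- These positions turn incidence into a step of 0 or 1. For an edge with s ≡ v - t on a polygon
    -- with i ≡ c - u, substituting for j and using e e = 1 makes `position t m` minus
    -- `position′ u j` equal to t + u - 2 t u, the exclusive or of the bits.
    position : Bool → ℤ → ℤ
    position t m = + 2 * (e * m - bit t * c) + bit t

    position′ : Bool → ℤ → ℤ
    position′ t j = + 2 * (e * j - v * (c - bit t) - bit t) + bit t

    ν η : Face → ℤ
    ν (edge s m) = position (τ s) m
    ν _          = 0ℤ
    η (poly i j) = position′ (υ i) j
    η _          = 0ℤ

    same-parity : ∀ t t′ {x y} → + 2 * x + bit t ≡[ + 8 ] + 2 * y + bit t′ → t ≡ t′
    same-parity false false p = refl
    same-parity true  true  p = refl
    same-parity true  false {x} {y} p = contradiction (mod-trans p (≡⇒≡[] (ℤ.+-identityʳ (+ 2 * y)))) (odd≢even {x} {y})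
    same-parity false true  {x} {y} p = contradiction (mod-trans (mod-sym p) (≡⇒≡[] (ℤ.+-identityʳ (+ 2 * x)))) (odd≢even {y} {x})

    cancel-bit : ∀ b {x y} → + 2 * x + b ≡[ + 8 ] + 2 * y + b → x ≡[ + 4 ] y
    cancel-bit b {x} {y} p = undouble (mod-trans (≡⇒≡[] (back (+ 2 * x) b)) (mod-trans (mod-+ p (mod-refl {a = - b})) (≡⇒≡[] (≡.sym (back (+ 2 * y) b)))))
      where
      back : ∀ x b → x ≡ x + b - b
      back = solve-∀

    uncancel : ∀ x {a b} → a - x ≡[ + 4 ] b - x → a ≡[ + 4 ] b
    uncancel x {a} {b} p = mod-trans (≡⇒≡[] (back a x)) (mod-trans (mod-+ p (mod-refl {a = x})) (≡⇒≡[] (≡.sym (back b x))))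
      where
      back : ∀ a x → a ≡ a - x + x
      back = solve-∀

    position-cong : ∀ t {m m′} → m ≡[ + 4 ] m′ → position t m ≡[ + 8 ] position t m′
    position-cong t p = mod-+ (double (mod-+ (mod-*ˡ e p) (mod-refl {a = - (bit t * c)}))) (mod-refl {a = bit t})

    position′-cong : ∀ t {j j′} → j ≡[ + 4 ] j′ → position′ t j ≡[ + 8 ] position′ t j′
    position′-cong t p = mod-+ (double (mod-+ (mod-+ (mod-*ˡ e p) (mod-refl {a = - (v * (c - bit t))})) (mod-refl {a = - bit t}))) (mod-refl {a = bit t})

    edge-in : ∀ {s m} → In 1 (edge s m) → v ≡[ + 4 ] vertexOf (τ s) s
    edge-in {s} h with ≼⇒⋖ (above h) refl
    ... | vert⋖edge r = τ-spec s r

    poly-in : ∀ {i j} → In 2 (poly i j) → c ≡[ + 32 * K ] facetOf (υ i) i j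
    poly-in {i} {j} h with ≼⇒⋖ (below h) refl
    ... | poly⋖facet r = υ-spec i j r

    ν-cong : ∀ {H H′} → In 1 H → In 1 H′ → H ≈ H′ → ν H ≡[ + 8 ] ν H′
    ν-cong h h′ p with edge-of (level h) | edge-of (level h′)
    ... | s , m , refl | s′ , m′ , refl with p
    ...   | edge≈ s≡ m≡ = ≡.subst (λ t → position t m ≡[ + 8 ] position (τ s′) m′)
      (≡.sym (τ-unique (τ s′) s (mod-trans (edge-in h′) (vertexOf-cong (τ s′) (mod-sym s≡))))) (position-cong (τ s′) m≡)

    ν-injective : ∀ {H H′} → In 1 H → In 1 H′ → ν H ≡[ + 8 ] ν H′ → H ≈ H′
    ν-injective h h′ p with edge-of (level h) | edge-of (level h′)
    ... | s , m , refl | s′ , m′ , refl = go (τ s) (τ s′) (edge-in h) (edge-in h′) p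
      where
      go : ∀ t t′ → v ≡[ + 4 ] vertexOf t s → v ≡[ + 4 ] vertexOf t′ s′ → position t m ≡[ + 8 ] position t′ m′ → edge s m ≈ edge s′ m′
      go t t′ q q′ p with same-parity t t′ {e * m - bit t * c} {e * m′ - bit t′ * c} p
      ... | refl = edge≈ (mod-trans (side t s q) (mod-sym (side t s′ q′)))
        (e-cancel (uncancel (bit t * c) (cancel-bit (bit t) p)))

    η-cong : ∀ {H H′} → In 2 H → In 2 H′ → H ≈ H′ → η H ≡[ + 8 ] η H′
    η-cong h h′ p with poly-of (level h) | poly-of (level h′)
    ... | i , j , refl | i′ , j′ , refl with p
    ...   | poly≈ i≡ j≡ = ≡.subst (λ t → position′ t j ≡[ + 8 ] position′ (υ i′) j′)
      (≡.sym (υ-unique (υ i′) i j (mod-trans (poly-in h′) (facetOf-cong (υ i′) (mod-sym i≡) (mod-sym j≡))))) (position′-cong (υ i′) j≡)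

    η-injective : ∀ {H H′} → In 2 H → In 2 H′ → η H ≡[ + 8 ] η H′ → H ≈ H′
    η-injective h h′ p with poly-of (level h) | poly-of (level h′)
    ... | i , j , refl | i′ , j′ , refl = go (υ i) (υ i′) (poly-in h) (poly-in h′) p
      where
      first : ∀ t → j ≡[ + 4 ] j′ → c ≡[ + 32 * K ] facetOf t i j → c ≡[ + 32 * K ] facetOf t i′ j′ → i ≡[ + 32 * K ] i′
      first false j≡ q q′ = mod-trans (mod-sym q) q′
      first true  j≡ q q′ = mod-trans (≡⇒≡[] (back K i j)) (mod-trans
        (mod-+ (mod-+ (mod-trans (mod-sym q) q′) (mod-refl {a = -1ℤ})) (mod-neg (scale j≡))) (≡⇒≡[] (≡.sym (back K i′ j′))))
        where
        back : ∀ K i j → i ≡ i + 1ℤ + + 8 * K * j + -1ℤ - + 8 * K * j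
        back = solve-∀
      go : ∀ t t′ → c ≡[ + 32 * K ] facetOf t i j → c ≡[ + 32 * K ] facetOf t′ i′ j′ → position′ t j ≡[ + 8 ] position′ t′ j′ → poly i j ≈ poly i′ j′
      go t t′ q q′ p with same-parity t t′ {e * j - v * (c - bit t) - bit t} {e * j′ - v * (c - bit t′) - bit t′} p
      ... | refl = poly≈ (first t j≡ q q′) j≡
        where
        j≡ : j ≡[ + 4 ] j′
        j≡ = e-cancel (uncancel (v * (c - bit t)) (uncancel (bit t) (cancel-bit (bit t) p)))

    -- 2 e (j - (e s i + m)) for s = v - t and i = c - u, in terms of the two positions
    balance : ∀ t u m j → + 2 * (e * j) - + 2 * (e * (e * (v - t) * (c - u) + m)) ≡
      (+ 2 * (e * j - v * (c - u) - u) + u) - (+ 2 * (e * m - t * c) + t) + (t + u - + 2 * (t * u))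
    balance t u m j = ≡.trans (expand e v c t u m j)
      (≡.trans (≡.cong (λ x → + 2 * (e * j) - + 2 * (x * ((v - t) * (c - u)) + e * m)) e²) (solve (e ∷ v ∷ c ∷ t ∷ u ∷ m ∷ j ∷ [])))
      where
      expand : ∀ e v c t u m j → + 2 * (e * j) - + 2 * (e * (e * (v - t) * (c - u) + m)) ≡
        + 2 * (e * j) - + 2 * (e * e * ((v - t) * (c - u)) + e * m)
      expand = solve-∀

    _xor_ : Bool → Bool → Bool
    false xor u = u
    true  xor u = not u

    bit-xor : ∀ t u → bit t + bit u - + 2 * (bit t * bit u) ≡ bit (t xor u)
    bit-xor false false = refl
    bit-xor false true  = refl
    bit-xor true  false = refl
    bit-xor true  true  = refl

    incident⇒position : ∀ t u m j → j ≡[ + 4 ] e * (v - bit t) * (c - bit u) + m →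
      position t m ≡[ + 8 ] position′ u j + bit (t xor u)
    incident⇒position t u m j p = mod-trans (≡⇒≡[] (forward (position t m) (position′ u j) b))
      (mod-trans (mod-+ (mod-refl {a = position′ u j + b}) (mod-neg zero-sum)) (≡⇒≡[] (ℤ.+-identityʳ _)))
      where
      b = bit (t xor u)
      forward : ∀ x y b → x ≡ y + b + - (y - x + b)
      forward = solve-∀
      zero-sum : position′ u j - position t m + b ≡[ + 8 ] 0ℤ
      zero-sum = mod-trans (≡⇒≡[] (≡.trans (≡.cong (λ x → position′ u j - position t m + x) (≡.sym (bit-xor t u))) (≡.sym (balance (bit t) (bit u) m j))))
        (mod-trans (mod-+ (double (mod-*ˡ e p)) mod-refl) (≡⇒≡[] (ℤ.+-inverseʳ (+ 2 * (e * (e * (v - bit t) * (c - bit u) + m))))))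

    position⇒incident : ∀ t u m j → position t m ≡[ + 8 ] position′ u j + bit (t xor u) →
      j ≡[ + 4 ] e * (v - bit t) * (c - bit u) + m
    position⇒incident t u m j p = e-cancel (undouble (mod-trans (≡⇒≡[] (split X Y))
      (mod-trans (mod-+ (mod-trans (≡⇒≡[] (≡.trans (balance (bit t) (bit u) m j) (≡.cong (λ x → position′ u j - position t m + x) (bit-xor t u)))) zero-sum)
        (mod-refl {a = Y})) (≡⇒≡[] (ℤ.+-identityˡ Y)))))
      where
      b = bit (t xor u)
      X = + 2 * (e * j)
      Y = + 2 * (e * (e * (v - bit t) * (c - bit u) + m))
      split : ∀ x y → x ≡ x - y + y
      split = solve-∀
      simp : ∀ y b → y - (y + b) + b ≡ 0ℤ
      simp = solve-∀
      zero-sum : position′ u j - position t m + b ≡[ + 8 ] 0ℤ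
      zero-sum = mod-trans (mod-+ (mod-+ (mod-refl {a = position′ u j}) (mod-neg p)) (mod-refl {a = b})) (≡⇒≡[] (simp (position′ u j) b))

    one-of-two : ∀ t {x y} → x ≡[ + 8 ] y + bit t → x ≡[ + 8 ] y ⊎ x ≡[ + 8 ] y + 1ℤ
    one-of-two false {y = y} p = inj₁ (mod-trans p (≡⇒≡[] (ℤ.+-identityʳ y)))
    one-of-two true  p = inj₂ p

    -- Modulo 2 the positions are t and u, so their parities decide which of the two steps it is.
    which-of-two : ∀ t u m j → position t m ≡[ + 8 ] position′ u j ⊎ position t m ≡[ + 8 ] position′ u j + 1ℤ →
                   position t m ≡[ + 8 ] position′ u j + bit (t xor u)
    which-of-two t u m j (inj₁ p) with same-parity t u {e * m - bit t * c} {e * j - v * (c - bit u) - bit u} p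
    ... | refl = mod-trans p (≡⇒≡[] (≡.sym (≡.trans (≡.cong (λ x → position′ u j + x) (xor-self t)) (ℤ.+-identityʳ _))))
      where
      xor-self : ∀ t → bit (t xor t) ≡ 0ℤ
      xor-self false = refl
      xor-self true  = refl
    which-of-two false false m j (inj₂ p) = contradiction
      (mod-trans (≡⇒≡[] (≡.cong (_+ 1ℤ) (≡.sym (ℤ.+-identityʳ (+ 2 * (e * j - v * (c - 0ℤ) - 0ℤ))))))
        (mod-trans (mod-sym p) (≡⇒≡[] (ℤ.+-identityʳ (+ 2 * (e * m - 0ℤ * c))))))
      (odd≢even {e * j - v * (c - 0ℤ) - 0ℤ} {e * m - 0ℤ * c})
    which-of-two false true  m j (inj₂ p) = p
    which-of-two true  false m j (inj₂ p) = p
    which-of-two true  true  m j (inj₂ p) = contradiction (mod-trans p (≡⇒≡[] (carry (e * j - v * (c - 1ℤ) - 1ℤ))))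
      (odd≢even {e * m - 1ℤ * c} {e * j - v * (c - 1ℤ) - 1ℤ + 1ℤ})
      where
      carry : ∀ x → + 2 * x + 1ℤ + 1ℤ ≡ + 2 * (x + 1ℤ)
      carry = solve-∀

    reduce : ∀ t u {s m i j} → v ≡[ + 4 ] vertexOf t s → c ≡[ + 32 * K ] facetOf u i j →
             e * s * i + m ≡[ + 4 ] e * (v - bit t) * (c - bit u) + m
    reduce t u {s} {m} {i} {j} q r = mod-+ (mod-* (mod-*ˡ e (side t s q)) (height u i j r)) (mod-refl {a = m})

    incident⁺ : ∀ {H H′} → In 1 H → In 2 H′ → H ≼ H′ → ν H ≡[ + 8 ] η H′ ⊎ ν H ≡[ + 8 ] η H′ + 1ℤ
    incident⁺ h h′ H≤H′ with edge-of (level h) | poly-of (level h′)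
    ... | s , m , refl | i , j , refl with ≼⇒⋖ H≤H′ refl
    ...   | edge⋖poly p = one-of-two (τ s xor υ i) (incident⇒position (τ s) (υ i) m j
      (mod-trans p (reduce (τ s) (υ i) (edge-in h) (poly-in h′))))

    incident⁻ : ∀ {H H′} → In 1 H → In 2 H′ → ν H ≡[ + 8 ] η H′ ⊎ ν H ≡[ + 8 ] η H′ + 1ℤ → H ≼ H′
    incident⁻ h h′ p with edge-of (level h) | poly-of (level h′)
    ... | s , m , refl | i , j , refl = cover (edge⋖poly (mod-trans
      (position⇒incident (τ s) (υ i) m j (which-of-two (τ s) (υ i) m j p))
      (mod-sym (reduce (τ s) (υ i) (edge-in h) (poly-in h′)))))

    bits : ∀ z → ∃[ t ] ∃[ q ] z ≡ + 2 * q + bit t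
    bits z with parity z
    ... | even q = false , q , ≡.trans (ℤ.*-comm q (+ 2)) (≡.sym (ℤ.+-identityʳ (+ 2 * q)))
    ... | odd q  = true , q , regroup q
      where
      regroup : ∀ q → 1ℤ + q * + 2 ≡ + 2 * q + 1ℤ
      regroup = solve-∀

    ν-surjective : ∀ z → ∃[ H ] In 1 H × ν H ≡[ + 8 ] z
    ν-surjective z with bits z
    ... | t , q , refl = edge (v - bit t) m , in-section (cover (vert⋖edge (incident t))) (far (s≤s (s≤s (s≤s (s≤s z≤n))))) refl
      , ≡.subst (λ t′ → position t′ m ≡[ + 8 ] + 2 * q + bit t) (≡.sym (τ-unique t (v - bit t) (at t)))
          (≡⇒≡[] (≡.cong (λ x → + 2 * x + bit t) (≡.trans (≡.cong (_- bit t * c) (e[ea] (q + bit t * c))) (back q (bit t * c)))))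
      where
      m = e * (q + bit t * c)
      back : ∀ q x → q + x - x ≡ q
      back = solve-∀
      first : ∀ v → v ≡ v - 0ℤ
      first = solve-∀
      at : ∀ t → v ≡[ + 4 ] vertexOf t (v - bit t)
      at false = ≡⇒≡[] (first v)
      at true  = ≡⇒≡[] (predecessor v)
      incident : ∀ t → v ≡[ + 4 ] v - bit t ⊎ v ≡[ + 4 ] v - bit t + 1ℤ
      incident false = inj₁ (≡⇒≡[] (first v))
      incident true  = inj₂ (≡⇒≡[] (predecessor v))

    η-surjective : ∀ z → ∃[ H ] In 2 H × η H ≡[ + 8 ] z
    η-surjective z with bits z
    ... | t , q , refl = poly (i t) j , in-section (far (s≤s (s≤s (s≤s z≤n)))) (cover (poly⋖facet (incident t))) refl
      , ≡.subst (λ t′ → position′ t′ j ≡[ + 8 ] + 2 * q + bit t) (≡.sym (υ-unique t (i t) j (at t)))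
          (≡⇒≡[] (≡.cong (λ x → + 2 * x + bit t) (≡.trans
            (≡.cong (λ x → x - v * (c - bit t) - bit t) (e[ea] (q + bit t + v * (c - bit t)))) (back q (bit t) (v * (c - bit t))))))
      where
      j = e * (q + bit t + v * (c - bit t))
      i : Bool → ℤ
      i false = c
      i true  = c - 1ℤ - + 8 * K * j
      back : ∀ q b x → q + b + x - x - b ≡ q
      back = solve-∀
      at : ∀ t → c ≡[ + 32 * K ] facetOf t (i t) j
      at false = mod-refl
      at true  = ≡⇒≡[] (below-next c j)
      incident : ∀ t → c ≡[ + 32 * K ] i t ⊎ c ≡[ + 32 * K ] i t + 1ℤ + + 8 * K * j
      incident false = inj₁ mod-refl
      incident true  = inj₂ (≡⇒≡[] (below-next c j))

  hasType : HasType P 4 8 n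
  hasType = polygons , vertex-figures , edge-polygons

  -- Counting the flags

  private
    module R₄ = Residue 4
    module Rₙ = Residue n

  toN : ∀ {a b} → a ≡[ + 32 * K ] b → a ≡[ + n ] b
  toN = ≡.subst (λ d → _ ≡[ d ] _) (≡.sym n≡32K)

  fromN : ∀ {a b} → a ≡[ + n ] b → a ≡[ + 32 * K ] b
  fromN = ≡.subst (λ d → _ ≡[ d ] _) n≡32K

  digit : Bool → Fin 2
  digit false = 0F
  digit true  = 1F

  undigit : Fin 2 → Bool
  undigit 0F = false
  undigit 1F = true

  digit-undigit : ∀ d → digit (undigit d) ≡ d
  digit-undigit 0F = refl
  digit-undigit 1F = refl

  undigit-digit : ∀ a → undigit (digit a) ≡ a
  undigit-digit false = refl
  undigit-digit true  = refl

  -- The factors 2 · 4 are the vertex and the index s of the edge; the factor 8 splits as 4 · 2, the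
  -- index m of the edge and the choice of a facet.
  pack : Fin 2 → Fin 4 → Fin 4 → Fin n → Fin 2 → Fin (2 ℕ.* 4 ℕ.* 8 ℕ.* n)
  pack a s m i b = Fin.combine (Fin.combine (Fin.combine a s) (Fin.combine {4} {2} m b)) i

  code : Bool → ℤ → ℤ → ℤ → Bool → Fin (2 ℕ.* 4 ℕ.* 8 ℕ.* n)
  code a s m i b = pack (digit a) (R₄.residue s) (R₄.residue m) (Rₙ.residue i) (digit b)

  fromDigits : Fin 2 → Fin 4 → Fin 4 → Fin n → Fin 2 → Flag
  fromDigits a s m i b = flag (undigit a) (+ toℕ s) (+ toℕ m) (+ toℕ i) (undigit b)

  decode₁ : Fin n → Fin 2 × Fin 4 → Fin 4 × Fin 2 → Flag
  decode₁ i (a , s) (m , b) = fromDigits a s m i b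

  decode₂ : Fin n → Fin (2 ℕ.* 4) × Fin 8 → Flag
  decode₂ i (as , mb) = decode₁ i (Fin.remQuot {2} 4 as) (Fin.remQuot {4} 2 mb)

  decode₃ : Fin (2 ℕ.* 4 ℕ.* 8) × Fin n → Flag
  decode₃ (asmb , i) = decode₂ i (Fin.remQuot {2 ℕ.* 4} 8 asmb)

  decode : Fin (2 ℕ.* 4 ℕ.* 8 ℕ.* n) → Flag
  decode k = decode₃ (Fin.remQuot {2 ℕ.* 4 ℕ.* 8} n k)

  decode-pack : ∀ a s m i b → decode (pack a s m i b) ≡ fromDigits a s m i b
  decode-pack a s m i b =
    ≡.trans (≡.cong decode₃ (Fin.remQuot-combine {2 ℕ.* 4 ℕ.* 8} {n} (Fin.combine as mb) i))
      (≡.trans (≡.cong (decode₂ i) (Fin.remQuot-combine {2 ℕ.* 4} {8} as mb))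
        (≡.cong₂ (decode₁ i) (Fin.remQuot-combine {2} {4} a s) (Fin.remQuot-combine {4} {2} m b)))
    where
    as = Fin.combine a s
    mb = Fin.combine {4} {2} m b

  digits : ∀ k → ∃[ a ] ∃[ s ] ∃[ m ] ∃[ i ] ∃[ b ] k ≡ pack a s m i b
  digits k = proj₁ as , proj₂ as , proj₁ mb , proj₂ xi , proj₂ mb , ≡.sym
    (≡.trans (≡.cong (λ x → Fin.combine x (proj₂ xi))
      (≡.trans (≡.cong₂ Fin.combine (Fin.combine-remQuot {2} 4 (proj₁ yz)) (Fin.combine-remQuot {4} 2 (proj₂ yz)))
        (Fin.combine-remQuot {2 ℕ.* 4} 8 (proj₁ xi))))
      (Fin.combine-remQuot {2 ℕ.* 4 ℕ.* 8} n k))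
    where
    xi = Fin.remQuot {2 ℕ.* 4 ℕ.* 8} n k
    yz = Fin.remQuot {2 ℕ.* 4} 8 (proj₁ xi)
    as = Fin.remQuot {2} 4 (proj₁ yz)
    mb = Fin.remQuot {4} 2 (proj₂ yz)

  flag-cong : ∀ {s s′ m m′ i i′} a b → s ≡[ + 4 ] s′ → m ≡[ + 4 ] m′ → i ≡[ + 32 * K ] i′ → flag a s m i b ≈ᶠ flag a s′ m′ i′ b
  flag-cong {s} {s′} {m} {m′} {i} {i′} a b p q r = flag-≈ {flag a s m i b} {flag a s′ m′ i′ b}
    (vert≈ (vertexOf-cong a p)) (edge≈ p q) (poly≈ r (side-cong p r q)) (facet≈ (facetOf-cong b r (side-cong p r q)))

  vertexOf-injective : ∀ a a′ {s s′} → vertexOf a s ≡[ + 4 ] vertexOf a′ s′ → s ≡[ + 4 ] s′ → a ≡ a′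
  vertexOf-injective false false p q = refl
  vertexOf-injective true  true  p q = refl
  vertexOf-injective false true  p q = contradiction (mod-trans (mod-sym q) p) (unit-shift 0ℤ)
  vertexOf-injective true  false p q = contradiction (mod-trans q (mod-sym p)) (unit-shift 0ℤ)

  facetOf-injective : ∀ b b′ {i i′} j j′ → facetOf b i j ≡[ + 32 * K ] facetOf b′ i′ j′ → i ≡[ + 32 * K ] i′ → b ≡ b′
  facetOf-injective false false j j′ p q = refl
  facetOf-injective true  true  j j′ p q = refl
  facetOf-injective false true {i} {i′} j j′ p q = contradiction (mod4 (mod-trans (mod-sym q) p)) (next≢ i′ j′)
  facetOf-injective true false {i} {i′} j j′ p q = contradiction (mod4 (mod-trans q (mod-sym p))) (next≢ i j)

  code-cong : ∀ a s m i b a′ s′ m′ i′ b′ → flag a s m i b ≈ᶠ flag a′ s′ m′ i′ b′ → code a s m i b ≡ code a′ s′ m′ i′ b′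
  code-cong a s m i b a′ s′ m′ i′ b′ p with p 1F | p 2F | p 3F | p 4F
  ... | vert≈ v≡ | edge≈ s≡ m≡ | poly≈ i≡ _ | facet≈ c≡ =
    ≡.cong₂ Fin.combine (≡.cong₂ Fin.combine
      (≡.cong₂ Fin.combine (≡.cong digit (vertexOf-injective a a′ v≡ s≡)) (R₄.residue-cong s≡))
      (≡.cong₂ (Fin.combine {4} {2}) (R₄.residue-cong m≡) (≡.cong digit (facetOf-injective b b′ _ _ c≡ i≡))))
      (Rₙ.residue-cong (toN i≡))

  decode-code : ∀ a s m i b → decode (code a s m i b) ≈ᶠ flag a s m i b
  decode-code a s m i b k = ≡.subst (λ Ψ → face Ψ k ≈ face (flag a s m i b) k)
    (≡.sym (≡.trans (decode-pack (digit a) (R₄.residue s) (R₄.residue m) (Rₙ.residue i) (digit b))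
      (≡.cong₂ (λ a′ b′ → flag a′ (+ toℕ (R₄.residue s)) (+ toℕ (R₄.residue m)) (+ toℕ (Rₙ.residue i)) b′) (undigit-digit a) (undigit-digit b))))
    (flag-cong a b (R₄.toℕ-residue s) (R₄.toℕ-residue m) (fromN (Rₙ.toℕ-residue i)) k)

  encode : ∀ {Φ} → Coordinates Φ → Fin (2 ℕ.* 4 ℕ.* 8 ℕ.* n)
  encode (a , s , m , i , b , _) = code a s m i b

  encode-cong : ∀ {Φ Ψ} → Φ ≈ᶠ Ψ → (c : Coordinates Φ) (d : Coordinates Ψ) → encode {Φ} c ≡ encode {Ψ} d
  encode-cong p (a , s , m , i , b , q) (a′ , s′ , m′ , i′ , b′ , q′) =
    code-cong a s m i b a′ s′ m′ i′ b′ λ k → ≈-trans (≈-sym (q k)) (≈-trans (p k) (q′ k))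

  decode-encode : ∀ Φ (c : Coordinates Φ) → decode (encode {Φ} c) ≈ᶠ Φ
  decode-encode Φ (a , s , m , i , b , q) k = ≈-trans (decode-code a s m i b k) (≈-sym (q k))

  encode-decode : ∀ k Φ (c : Coordinates Φ) → Φ ≈ᶠ decode k → encode {Φ} c ≡ k
  encode-decode k Φ c p = recode (digits k)
    where
    recode : ∃[ a ] ∃[ s ] ∃[ m ] ∃[ i ] ∃[ b ] k ≡ pack a s m i b → encode {Φ} c ≡ k
    recode (a , s , m , i , b , k≡) = ≡.trans
      (encode-cong {Φ} {Φ} (λ _ → ≈-refl) c (undigit a , + toℕ s , + toℕ m , + toℕ i , undigit b , λ l →
        ≡.subst (λ Ψ → face Φ l ≈ face Ψ l) (≡.trans (≡.cong decode k≡) (decode-pack a s m i b)) (p l)))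
      (≡.trans (≡.cong₂ Fin.combine (≡.cong₂ Fin.combine
        (≡.cong₂ Fin.combine (digit-undigit a) (R₄.residue-toℕ s))
        (≡.cong₂ (Fin.combine {4} {2}) (R₄.residue-toℕ m) (digit-undigit b))) (Rₙ.residue-toℕ i)) (≡.sym k≡))

  isTight : IsTight P
  isTight = 4 , 8 , n , hasType , record
    { to        = decode
    ; from      = λ Φ → encode {Φ} (coordinates Φ)
    ; to-cong   = λ { refl k → ≈-refl }
    ; from-cong = λ {Φ} {Ψ} p → encode-cong {Φ} {Ψ} p (coordinates Φ) (coordinates Ψ)
    ; inverse   = (λ { {Φ} refl → decode-encode Φ (coordinates Φ) })
                , (λ {k} {Φ} p → encode-decode k Φ (coordinates Φ) p)
    }

-- Atomicity

module Atomicity (K e : ℤ) .{{_ : ℤ.NonZero K}} (e² : e * e ≡ 1ℤ)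
  (order-two : ∀ d → ¬ d ≡[ + 32 * K ] 0ℤ → ∃[ q ] q * d ≡[ + 32 * K ] + 16 * K) where
  open Chirality K e e²

  automorphism-rank : ∀ α F → rank (PosetIsomorphism.⟦_⟧ α F) ≡ rank F
  automorphism-rank α F with inFlag F
  ... | Φ , k , p = ≡.trans (rank-cong (PosetIsomorphism.cong α (≈-sym p)))
    (≡.trans (face-rank (automorphism-flag P α Φ) k) (≡.trans (≡.sym (face-rank Φ k)) (rank-cong p)))

  module Kernel (Q : Polytope 4) (chiral : IsChiral Q) (π : Covering P Q) where
    private
      module Q = Polytope Q
      module QP = PolytopeProperties Q
      module π = Covering π

    π₀ : Face → Q.Face
    π₀ = π.⟦_⟧

    infix 4 _∼_
    _∼_ : Rel Face 0ℓ
    F ∼ G = π₀ F Q.≈ π₀ G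

    ∼-sym : ∀ F G → F ∼ G → G ∼ F
    ∼-sym _ _ = Q.Eq.sym

    ∼-trans : ∀ F G H → F ∼ G → G ∼ H → F ∼ H
    ∼-trans _ _ _ = Q.Eq.trans

    ∼-resp : ∀ {F F′ G G′} → F ≈ F′ → G ≈ G′ → F ∼ G → F′ ∼ G′
    ∼-resp p q r = Q.Eq.trans (Q.Eq.sym (π.cong p)) (Q.Eq.trans r (π.cong q))

    ∼-rank : ∀ F G → F ∼ G → rank F ≡ rank G
    ∼-rank F G p = ≡.trans (≡.sym (π.rank-preserving F)) (≡.trans (Q.rank-cong p) (π.rank-preserving G))

    open Rigidity P Q using (IsFlagMap; covering-isFlagMap; iso∘map; agree-everywhere)

    π-isFlagMap : IsFlagMap π₀
    π-isFlagMap = covering-isFlagMap π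

    π-strict : ∀ {F G} → F ⋖ G → π₀ F Q.< π₀ G
    π-strict c = IsFlagMap.strict π-isFlagMap (⋖⇒< c)

    -- Automorphisms of P in the group generated by σ₁, σ₂, σ₃ descend to Q because Q is chiral.
    Descends : (Face → Face) → Set
    Descends f = ∃[ α ] (∀ F → PosetIsomorphism.⟦_⟧ {Q.poset} {Q.poset} α (π₀ F) Q.≈ π₀ (f F))

    -- A standard generator moves Φ₀ by two adjacency steps, so the chirality of Q yields an
    -- automorphism α with the same effect on the image of Φ₀. The maps α after π and π after the
    -- generator agree on Φ₀ and hence, by rigidity, everywhere.
    generator-descends : ∀ k → Descends (act (gen k))
    generator-descends k with standardGenerators k
    ... | Φ′ , Φ″ , adj , adj′ , maps with QP.chiral-even chiral (suc k) (inject₁ k) (π.mapFlag Φ₀) (π.mapFlag Φ′) (π.mapFlag Φ″)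
          (π.adjacency-preserving (suc k) Φ₀ Φ′ adj) (π.adjacency-preserving (inject₁ k) Φ′ Φ″ adj′)
    ...   | α , mapsα = α , agree-everywhere (iso∘map π-isFlagMap α) lifted
              (λ F → ≡.trans (π.rank-preserving _) (automorphism-rank γ F)) inFlag Φ₀
              (λ l → Q.Eq.trans (mapsα l) (π.cong (≈-sym (maps l))))
      where
      γ = eval (gen k)
      lifted : IsFlagMap (π₀ ∘ act (gen k))
      lifted = record
        { cong     = λ p → π.cong (act-cong (gen k) p)
        ; strict   = λ F<G → IsFlagMap.strict π-isFlagMap (Rigidity.IsFlagMap.strict (automorphism-isFlagMap P γ) F<G)
        ; separate = λ j Φ Ψ (Φ≉Ψ , same) → IsFlagMap.separate π-isFlagMap j (automorphism-flag P γ Φ) (automorphism-flag P γ Ψ)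
            ((λ p → Φ≉Ψ (PosetIsomorphism.injective γ p)) , λ l l≢ → act-cong (gen k) (same l l≢))
        }

    descends : ∀ t → Descends (act t)
    descends (gen k) = generator-descends k
    descends ε       = Group.ε Q.Aut , λ _ → Q.Eq.refl
    descends (s ∙ t) with descends s | descends t
    ... | α , p | β , q = Group._∙_ Q.Aut α β , λ F → Q.Eq.trans (PosetIsomorphism.cong β (p F)) (q (act s F))
    descends (t ⁻¹) with descends t
    ... | α , p = α ⁻¹′ , λ F → PosetIsomorphism.injective α (Q.Eq.trans (Group.inverseˡ Q.Aut α (π₀ F))
      (Q.Eq.sym (Q.Eq.trans (p (act (t ⁻¹) F)) (π.cong (act-⁻¹ʳ t F)))))
      where _⁻¹′ = Group._⁻¹ Q.Aut

    Invariant : (Face → Face) → Set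
    Invariant f = ∀ F G → F ∼ G → f F ∼ f G

    invariant-act : ∀ t → Invariant (act t)
    invariant-act t F G p with descends t
    ... | α , q = Q.Eq.trans (Q.Eq.sym (q F)) (Q.Eq.trans (PosetIsomorphism.cong α p) (q G))

    invariant-≈ : ∀ {f g} → (∀ F → f F ≈ g F) → Invariant f → Invariant g
    invariant-≈ p inv F G q = ∼-resp (p F) (p G) (inv F G q)

    invariant-∘ : ∀ {f g} → Invariant f → Invariant g → Invariant (f ∘ g)
    invariant-∘ {f} {g} p q F G r = p (g F) (g G) (q F G r)

    down-up : ∀ z → z + 1ℤ + -1ℤ ≡ z
    down-up = solve-∀

    -- `rotate a u` is the product of σ₁ᵃ and a power of σ₂²; the exponent of the latter is u e,
    -- because σ₂² adds e to the second parameter and e e = 1.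
    rotate-invariant : ∀ a u → Invariant (rotate a u)
    rotate-invariant a u = invariant-≈ (λ F → ≈-trans (rotate-+ a 0ℤ 0ℤ u F)
        (rotate-cong (≡⇒≡[] (ℤ.+-identityʳ a)) (≡⇒≡[] (ℤ.+-identityˡ u)) ≈-refl))
      (invariant-∘ {rotate a 0ℤ} {rotate 0ℤ u} (first a)
        (invariant-≈ (λ F → rotate-cong mod-refl (≡⇒≡[] u≡) ≈-refl) (second (u * e))))
      where
      u≡ : u * e * e ≡ u
      u≡ = ≡.trans (ℤ.*-assoc u e e) (≡.trans (≡.cong (λ x → u * x) e²) (ℤ.*-identityʳ u))
      first : ∀ a → Invariant (rotate a 0ℤ)
      first = ℤ-induction (λ a → Invariant (rotate a 0ℤ)) (invariant-≈ (λ F → ≈-sym (rotate-0 F)) (invariant-act ε))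
        (λ a inv → invariant-≈ (rotate-+ a 0ℤ 1ℤ 0ℤ) (invariant-∘ {rotate a 0ℤ} {rotate 1ℤ 0ℤ} inv (invariant-act σ₁)))
        (λ a inv → invariant-≈ (λ F → ≈-trans (rotate-+ (a + 1ℤ) 0ℤ -1ℤ 0ℤ F) (rotate-cong (≡⇒≡[] (down-up a)) mod-refl ≈-refl))
          (invariant-∘ {rotate (a + 1ℤ) 0ℤ} {rotate -1ℤ 0ℤ} inv (invariant-act (σ₁ ⁻¹))))
      inverse : ∀ F → act ((σ₂ ^ 2) ⁻¹) F ≈ rotate 0ℤ (- e) F
      inverse F = PosetIsomorphism.injective (eval (σ₂ ^ 2)) (≈-trans (act-⁻¹ʳ (σ₂ ^ 2) F)
        (≈-sym (≈-trans (rotate² (rotate 0ℤ (- e) F)) (rotate-inverse 0ℤ e 0ℤ (- e) refl (ℤ.+-inverseʳ e) F))))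
      up-eq : ∀ z e → z * e + e ≡ (z + 1ℤ) * e
      up-eq = solve-∀
      down-eq : ∀ z e → (z + 1ℤ) * e + - e ≡ z * e
      down-eq = solve-∀
      second : ∀ z → Invariant (rotate 0ℤ (z * e))
      second = ℤ-induction (λ z → Invariant (rotate 0ℤ (z * e)))
        (invariant-≈ (λ F → ≈-trans (≈-sym (rotate-0 F)) (rotate-cong mod-refl (≡⇒≡[] (≡.sym (ℤ.*-zeroˡ e))) ≈-refl)) (invariant-act ε))
        (λ z inv → invariant-≈ (λ F → ≈-trans (rotate-+ 0ℤ (z * e) 0ℤ e F) (rotate-cong mod-refl (≡⇒≡[] (up-eq z e)) ≈-refl))
          (invariant-∘ {rotate 0ℤ (z * e)} {rotate 0ℤ e} inv (invariant-≈ rotate² (invariant-act (σ₂ ^ 2)))))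
        (λ z inv → invariant-≈ (λ F → ≈-trans (rotate-+ 0ℤ ((z + 1ℤ) * e) 0ℤ (- e) F) (rotate-cong mod-refl (≡⇒≡[] (down-eq z e)) ≈-refl))
          (invariant-∘ {rotate 0ℤ ((z + 1ℤ) * e)} {rotate 0ℤ (- e)} inv (invariant-≈ inverse (invariant-act ((σ₂ ^ 2) ⁻¹)))))

    shift-invariant : ∀ b → Invariant (shift b)
    shift-invariant = ℤ-induction (λ b → Invariant (shift b)) (invariant-≈ (λ F → ≈-sym (shift-0 F)) (invariant-act ε))
      (λ b inv → invariant-≈ (shift-+ b 1ℤ) (invariant-∘ {shift b} {shift 1ℤ} inv (invariant-act σ₃)))
      (λ b inv → invariant-≈ (λ F → ≈-trans (shift-+ (b + 1ℤ) -1ℤ F) (shift-cong (≡⇒≡[] (down-up b)) ≈-refl))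
        (invariant-∘ {shift (b + 1ℤ)} {shift -1ℤ} inv (invariant-act (σ₃ ⁻¹))))

    turn-invariant : Invariant turn
    turn-invariant = invariant-≈ σ₁σ₂≈turn (invariant-act (σ₁ ∙ σ₂))

    -- Faces that stay apart, and the group of identified facets

    apart : ∀ Φ Ψ j → Adjacent j Φ Ψ → ¬ face Φ (middle j) ∼ face Ψ (middle j)
    apart Φ Ψ j adj = proj₁ (π.adjacency-preserving j Φ Ψ adj)

    verts-apart : ∀ s → ¬ vert s ∼ vert (s + 1ℤ)
    verts-apart s p = apart (flag true s 0ℤ 0ℤ false) (flag false s 0ℤ 0ℤ false) 0F (adjacent₀ s 0ℤ 0ℤ false) (∼-sym (vert s) (vert (s + 1ℤ)) p)

    edges-apart : ∀ s m s′ m′ i → s′ ≡[ + 4 ] s + 1ℤ → e * s * i + m ≡[ + 4 ] e * s′ * i + m′ → ¬ edge s m ∼ edge s′ m′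
    edges-apart s m s′ m′ i p q = apart (flag true s m i false) (flag false s′ m′ i false) 1F (adjacent₁ s m i false s′ m′ p q)

    polys-apart : ∀ s m i i′ → i′ ≡[ + 32 * K ] i + 1ℤ + + 8 * K * (e * s * i + m) →
                  ¬ poly i (e * s * i + m) ∼ poly i′ (e * s * i′ + m)
    polys-apart s m i i′ p = apart (flag false s m i true) (flag false s m i′ false) 2F (adjacent₂ false s m i i′ p)

    facets-apart : ∀ i j → ¬ facet i ∼ facet (i + 1ℤ + + 8 * K * j)
    facets-apart i j p = apart (flag false 0ℤ j i false) (flag false 0ℤ j i true) 3F (adjacent₃ false 0ℤ j i)
      (∼-resp ≈-refl (facet≈ (≡⇒≡[] (simp K e i j))) p)
      where
      simp : ∀ K e i j → i + 1ℤ + + 8 * K * j ≡ i + 1ℤ + + 8 * K * (e * 0ℤ * i + j)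
      simp = solve-∀

    -- A and B keep distinct images, so these fill the diamond between the images of L and U. This
    -- turns order relations in Q into identifications of faces of P.
    squeeze : ∀ {L U A B} C → L ⋖ A → A ⋖ U → L ⋖ B → B ⋖ U → ¬ A ∼ B → π₀ L Q.< π₀ C → π₀ C Q.< π₀ U → C ∼ A ⊎ C ∼ B
    squeeze {L} {U} C LA AU LB BU A≁B LC CU = QP.between
      ( IsFlagMap.strict π-isFlagMap (PolytopeProperties.≼∧rank<⇒≺ P (≼-trans (cover LA) (cover AU)) L<U)
      , ≡.trans (≡.cong toℕ (π.rank-preserving U)) (≡.trans U≡ (≡.cong (λ r → 2 ℕ.+ toℕ r) (≡.sym (π.rank-preserving L)))))
      A≁B (π-strict LA , π-strict AU) (π-strict LB , π-strict BU) (LC , CU)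
      where
      U≡ : toℕ (rank U) ≡ 2 ℕ.+ toℕ (rank L)
      U≡ = ≡.trans (rank-⋖ AU) (≡.cong suc (rank-⋖ LA))
      L<U : toℕ (rank L) ℕ.< toℕ (rank U)
      L<U = ≡.subst (toℕ (rank L) ℕ.<_) (≡.sym U≡) (ℕ.n≤1+n _)

    -- Powers of σ₃ translate the facets and preserve the kernel, so facets c and d are identified
    -- precisely when `H (d - c)` holds, and H is a subgroup of ℤ that contains 32 K.
    H : ℤ → Set
    H d = facet 0ℤ ∼ facet d

    H-resp : ∀ {d d′} → d ≡[ + 32 * K ] d′ → H d → H d′
    H-resp p = ∼-resp ≈-refl (facet≈ p)

    H-translate : ∀ c d → H d → facet c ∼ facet (d + c)
    H-translate c d h = ∼-resp (facet≈ (≡⇒≡[] (ℤ.+-identityˡ c))) ≈-refl (shift-invariant c (facet 0ℤ) (facet d) h)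

    H-difference : ∀ c d → facet c ∼ facet d → H (d - c)
    H-difference c d p = ∼-resp (facet≈ (≡⇒≡[] (ℤ.+-inverseʳ c))) ≈-refl (shift-invariant (- c) (facet c) (facet d) p)

    H-+ : ∀ c d → H c → H d → H (d + c)
    H-+ c d h h′ = ∼-trans (facet 0ℤ) (facet c) (facet (d + c)) h (H-translate c d h′)

    H-- : ∀ c d → H c → H d → H (d - c)
    H-- c d h h′ = H-difference c d (∼-trans (facet c) (facet 0ℤ) (facet d) (∼-sym (facet 0ℤ) (facet c) h) h′)

    H-* : ∀ d → H d → ∀ q → H (q * d)
    H-* d h = ℤ-induction (λ q → H (q * d)) (H-resp (≡⇒≡[] (≡.sym (ℤ.*-zeroˡ d))) Q.Eq.refl)
      (λ q h′ → H-resp (≡⇒≡[] (up q d)) (H-+ d (q * d) h h′))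
      (λ q h′ → H-resp (≡⇒≡[] (down q d)) (H-- d ((q + 1ℤ) * d) h h′))
      where
      up : ∀ q d → q * d + d ≡ (q + 1ℤ) * d
      up = solve-∀
      down : ∀ q d → (q + 1ℤ) * d - d ≡ q * d
      down = solve-∀

    ¬H1 : ¬ H 1ℤ
    ¬H1 h = facets-apart 0ℤ 0ℤ (H-resp (≡⇒≡[] (simp K)) h)
      where
      simp : ∀ K → 1ℤ ≡ 0ℤ + 1ℤ + + 8 * K * 0ℤ
      simp = solve-∀

    -- Both facets of the second polygon are squeezed above the first one, and facets of one polygon
    -- stay apart; so the two pairs correspond, either in order or crossed.
    polys-facets : ∀ i j i′ j′ → poly i j ∼ poly i′ j′ →
      (facet i ∼ facet i′ × facet (i + 1ℤ + + 8 * K * j) ∼ facet (i′ + 1ℤ + + 8 * K * j′)) ⊎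
      (facet i ∼ facet (i′ + 1ℤ + + 8 * K * j′) × facet (i + 1ℤ + + 8 * K * j) ∼ facet i′)
    polys-facets i j i′ j′ p = decide (locate′ (facet i′) (poly⋖facet (inj₁ mod-refl)))
        (locate′ (facet (i′ + 1ℤ + + 8 * K * j′)) (poly⋖facet (inj₂ mod-refl)))
      where
      i⁺ = i + 1ℤ + + 8 * K * j
      i′⁺ = i′ + 1ℤ + + 8 * K * j′
      locate′ : ∀ C → poly i′ j′ ⋖ C → C ∼ facet i ⊎ C ∼ facet i⁺
      locate′ (facet c) cov = squeeze (facet c) (poly⋖facet {i} {j} (inj₁ mod-refl)) facet⋖top (poly⋖facet (inj₂ mod-refl)) facet⋖top
        (facets-apart i j) (QP.≺-respˡ (Q.Eq.sym p) (π-strict cov)) (π-strict facet⋖top)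
      decide : facet i′ ∼ facet i ⊎ facet i′ ∼ facet i⁺ → facet i′⁺ ∼ facet i ⊎ facet i′⁺ ∼ facet i⁺ →
        (facet i ∼ facet i′ × facet i⁺ ∼ facet i′⁺) ⊎ (facet i ∼ facet i′⁺ × facet i⁺ ∼ facet i′)
      decide (inj₁ a) (inj₁ b) = contradiction (Q.Eq.trans a (Q.Eq.sym b)) (facets-apart i′ j′)
      decide (inj₂ a) (inj₂ b) = contradiction (Q.Eq.trans a (Q.Eq.sym b)) (facets-apart i′ j′)
      decide (inj₁ a) (inj₂ b) = inj₁ (Q.Eq.sym a , Q.Eq.sym b)
      decide (inj₂ a) (inj₁ b) = inj₂ (Q.Eq.sym b , Q.Eq.sym a)

    -- Subtracting one difference of identified facets from the other eliminates i and i′.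
    H-sum : ∀ i j i′ j′ → facet i ∼ facet (i′ + 1ℤ + + 8 * K * j′) → facet (i + 1ℤ + + 8 * K * j) ∼ facet i′ →
            H (+ 2 + + 8 * K * (j + j′))
    H-sum i j i′ j′ p q = H-resp (≡⇒≡[] (simp K i j i′ j′))
      (H-- (i′ - (i + 1ℤ + + 8 * K * j)) (i′ + 1ℤ + + 8 * K * j′ - i)
        (H-difference (i + 1ℤ + + 8 * K * j) i′ q) (H-difference i (i′ + 1ℤ + + 8 * K * j′) p))
      where
      simp : ∀ K i j i′ j′ → i′ + 1ℤ + + 8 * K * j′ - i - (i′ - (i + 1ℤ + + 8 * K * j)) ≡ + 2 + + 8 * K * (j + j′)
      simp = solve-∀

    Nontrivial : Set
    Nontrivial = ∃[ d ] ¬ d ≡[ + 32 * K ] 0ℤ × H d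

    unscale : ∀ {a b} → + 8 * K * a ≡[ + 32 * K ] + 8 * K * b → a ≡[ + 4 ] b
    unscale {a} {b} (by q eq) = by q (ℤ.*-cancelˡ-≡ K a (b + q * + 4) (ℤ.*-cancelˡ-≡ (+ 8) (K * a) (K * (b + q * + 4))
      (≡.trans (left K a) (≡.trans eq (solve (K ∷ b ∷ q ∷ []))))))
      where
      left : ∀ K a → + 8 * (K * a) ≡ + 8 * K * a
      left = solve-∀

    difference : ∀ {d a b} → a - b ≡[ d ] 0ℤ → a ≡[ d ] b
    difference {d} {a} {b} p = mod-trans (≡⇒≡[] (split a b)) (mod-trans (mod-+ p (mod-refl {a = b})) (≡⇒≡[] (ℤ.+-identityˡ b)))
      where
      split : ∀ a b → a ≡ a - b + b
      split = solve-∀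

    -- A crossed correspondence of the facets yields an element of H that is 2 modulo 4. A straight
    -- one yields i′ - i; if this vanishes, the second facets differ by 8 K (j′ - j), and j and j′
    -- are different modulo 4.
    polys-nontrivial : ∀ i j i′ j′ → poly i j ∼ poly i′ j′ → ¬ poly i j ≈ poly i′ j′ → Nontrivial
    polys-nontrivial i j i′ j′ p ≉ = [ straight , crossed ]′ (polys-facets i j i′ j′ p)
      where
      low : ∀ K x → + 2 ≡ + 2 + + 8 * K * x + - (+ 2 * K * x) * + 4
      low = solve-∀
      crossed : facet i ∼ facet (i′ + 1ℤ + + 8 * K * j′) × facet (i + 1ℤ + + 8 * K * j) ∼ facet i′ → Nontrivial
      crossed (q , r) = + 2 + + 8 * K * (j + j′)
        , (λ z → 2≢0 (mod-trans (by (- (+ 2 * K * (j + j′))) (low K (j + j′))) (mod4 z)))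
        , H-sum i j i′ j′ q r
      regroup : ∀ K i j i′ j′ → + 8 * K * j′ - + 8 * K * j ≡ i′ + 1ℤ + + 8 * K * j′ - (i + 1ℤ + + 8 * K * j) + - (i′ - i)
      regroup = solve-∀
      straight : facet i ∼ facet i′ × facet (i + 1ℤ + + 8 * K * j) ∼ facet (i′ + 1ℤ + + 8 * K * j′) → Nontrivial
      straight (q , r) = choose (mod-dec (i′ - i) 0ℤ)
        where
        choose : Dec (i′ - i ≡[ + 32 * K ] 0ℤ) → Nontrivial
        choose (no d≢0)  = i′ - i , d≢0 , H-difference i i′ q
        choose (yes d≡0) = i′ + 1ℤ + + 8 * K * j′ - (i + 1ℤ + + 8 * K * j)
          , (λ z → ≉ (poly≈ (mod-sym (difference d≡0)) (mod-sym (unscale (difference (mod-trans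
                (≡⇒≡[] (regroup K i j i′ j′)) (mod-+ z (mod-neg d≡0))))))))
          , H-difference (i + 1ℤ + + 8 * K * j) (i′ + 1ℤ + + 8 * K * j′) r

    previous : ℤ → ℤ → ℤ → ℤ
    previous s m c = c - 1ℤ - + 8 * K * (e * s * (c - 1ℤ) + m)

    previous-next : ∀ s m c → c ≡[ + 32 * K ] previous s m c + 1ℤ + + 8 * K * (e * s * previous s m c + m)
    previous-next s m c = mod-trans (≡⇒≡[] (below-next c j)) (mod-+ (mod-refl {a = previous s m c + 1ℤ})
      (scale (mod-+ (mod-*ˡ (e * s) (mod-sym (below-mod4 c j))) (mod-refl {a = m}))))
      where
      j = e * s * (c - 1ℤ) + m

    between-edge-facet : ∀ s m c C → π₀ (edge s m) Q.< π₀ C → π₀ C Q.< π₀ (facet c) →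
      C ∼ poly (previous s m c) (e * s * previous s m c + m) ⊎ C ∼ poly c (e * s * c + m)
    between-edge-facet s m c C lo hi = squeeze C (edge⋖poly mod-refl) (poly⋖facet (inj₂ (previous-next s m c)))
      (edge⋖poly mod-refl) (poly⋖facet (inj₁ mod-refl)) (polys-apart s m (previous s m c) c (previous-next s m c)) lo hi

    -- The polygon of (s′ , m′) with first facet c is squeezed between (s , m) and c. Unless it is
    -- identified with a different polygon, e s′ c + m′ ≡ e s c + m; the cases c = 0 and c = 1 then
    -- give m ≡ m′ and s ≡ s′.
    edges-nontrivial : ∀ s m s′ m′ → edge s m ∼ edge s′ m′ → ¬ edge s m ≈ edge s′ m′ → Nontrivial
    edges-nontrivial s m s′ m′ p ≉ = go (at 0ℤ) (at 1ℤ)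
      where
      at : ∀ c → Nontrivial ⊎ e * s′ * c + m′ ≡[ + 4 ] e * s * c + m
      at c = [ inj₁ ∘ lower-poly , (λ q → upper-poly q (mod-dec (e * s′ * c + m′) (e * s * c + m))) ]′
        (between-edge-facet s m c (poly c (e * s′ * c + m′))
          (QP.≺-respˡ (Q.Eq.sym p) (π-strict (edge⋖poly mod-refl))) (π-strict (poly⋖facet (inj₁ mod-refl))))
        where
        j = e * s * (c - 1ℤ) + m
        lower-poly : poly c (e * s′ * c + m′) ∼ poly (previous s m c) (e * s * previous s m c + m) → Nontrivial
        lower-poly q = polys-nontrivial c (e * s′ * c + m′) (previous s m c) (e * s * previous s m c + m) q λ { (poly≈ r _) →
          below≢ c j (mod4 (mod-sym r)) }
        upper-poly : poly c (e * s′ * c + m′) ∼ poly c (e * s * c + m) → Dec (e * s′ * c + m′ ≡[ + 4 ] e * s * c + m) →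
                     Nontrivial ⊎ e * s′ * c + m′ ≡[ + 4 ] e * s * c + m
        upper-poly q (yes r) = inj₂ r
        upper-poly q (no ¬r) = inj₁ (polys-nontrivial c (e * s′ * c + m′) c (e * s * c + m) q λ { (poly≈ _ r) → ¬r r })
      go : Nontrivial ⊎ e * s′ * 0ℤ + m′ ≡[ + 4 ] e * s * 0ℤ + m → Nontrivial ⊎ e * s′ * 1ℤ + m′ ≡[ + 4 ] e * s * 1ℤ + m → Nontrivial
      go (inj₁ n) _        = n
      go (inj₂ _) (inj₁ n) = n
      go (inj₂ q) (inj₂ r) = contradiction (edge≈ s≡ m≡) ≉
        where
        zero′ : ∀ e s m → e * s * 0ℤ + m ≡ m
        zero′ = solve-∀
        m≡ : m ≡[ + 4 ] m′
        m≡ = mod-sym (mod-trans (≡⇒≡[] (≡.sym (zero′ e s′ m′))) (mod-trans q (≡⇒≡[] (zero′ e s m))))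
        first : ∀ e s m → e * e * s ≡ e * (e * s * 1ℤ + m - m)
        first = solve-∀
        e[es] : ∀ s → s ≡ e * e * s
        e[es] s = ≡.trans (≡.sym (ℤ.*-identityˡ s)) (≡.cong (_* s) (≡.sym e²))
        s≡ : s ≡[ + 4 ] s′
        s≡ = mod-trans (≡⇒≡[] (≡.trans (e[es] s) (first e s m))) (mod-trans (mod-*ˡ e (mod-+ (mod-sym r) (mod-neg m≡)))
          (≡⇒≡[] (≡.sym (≡.trans (e[es] s′) (first e s′ m′)))))

    -- All edges (s , 0) lie on the polygon (0 , 0). Squeezing (v′ , 0) between v and this polygon
    -- identifies it with another edge, unless it is the edge (v - 1 , 0) itself; but then v′ and v
    -- are the two ends of an edge, which stay apart.
    verts-nontrivial : ∀ v v′ → vert v ∼ vert v′ → ¬ vert v ≈ vert v′ → Nontrivial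
    verts-nontrivial v v′ p ≉ = [ first , (λ q → second q (mod-dec v′ (v - 1ℤ))) ]′
      (squeeze {vert v} {poly 0ℤ 0ℤ} {edge v 0ℤ} {edge (v - 1ℤ) 0ℤ} (edge v′ 0ℤ)
        (vert⋖edge (inj₁ mod-refl)) (edge⋖poly (at v)) (vert⋖edge (inj₂ (≡⇒≡[] (predecessor v)))) (edge⋖poly (at (v - 1ℤ)))
        (λ q → edges-apart (v - 1ℤ) 0ℤ v 0ℤ 0ℤ (≡⇒≡[] (predecessor v)) (mod-trans (mod-sym (at (v - 1ℤ))) (at v)) (∼-sym (edge v 0ℤ) (edge (v - 1ℤ) 0ℤ) q))
        (QP.≺-respˡ (Q.Eq.sym p) (π-strict (vert⋖edge (inj₁ mod-refl)))) (π-strict (edge⋖poly (at v′))))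
      where
      zero′ : ∀ e s → 0ℤ ≡ e * s * 0ℤ + 0ℤ
      zero′ = solve-∀
      at : ∀ s → 0ℤ ≡[ + 4 ] e * s * 0ℤ + 0ℤ
      at s = ≡⇒≡[] (zero′ e s)
      first : edge v′ 0ℤ ∼ edge v 0ℤ → Nontrivial
      first q = edges-nontrivial v′ 0ℤ v 0ℤ q λ { (edge≈ r _) → ≉ (vert≈ (mod-sym r)) }
      second : edge v′ 0ℤ ∼ edge (v - 1ℤ) 0ℤ → Dec (v′ ≡[ + 4 ] v - 1ℤ) → Nontrivial
      second q (no ¬r) = edges-nontrivial v′ 0ℤ (v - 1ℤ) 0ℤ q λ { (edge≈ r _) → ¬r r }
      second q (yes r) = contradiction (∼-resp (vert≈ r) (vert≈ (≡⇒≡[] (predecessor v))) (∼-sym (vert v) (vert v′) p)) (verts-apart (v - 1ℤ))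

    nontrivial : ∀ F G → F ∼ G → ¬ F ≈ G → Nontrivial
    nontrivial F G p ≉ = go F G (∼-rank F G p) p ≉
      where
      go : ∀ F G → rank F ≡ rank G → F ∼ G → ¬ F ≈ G → Nontrivial
      go bot        bot          _ p ≉ = contradiction bot≈ ≉
      go (vert v)   (vert v′)    _ p ≉ = verts-nontrivial v v′ p ≉
      go (edge s m) (edge s′ m′) _ p ≉ = edges-nontrivial s m s′ m′ p ≉
      go (poly i j) (poly i′ j′) _ p ≉ = polys-nontrivial i j i′ j′ p ≉
      go (facet c)  (facet d)    _ p ≉ = d - c , (λ z → ≉ (facet≈ (mod-sym (difference z)))) , H-difference c d p
      go top        top          _ p ≉ = contradiction top≈ ≉

    -- If the facets 0 and 4 d are identified, then so are the polygons (0 , 0) and (4 d , 0): otherwise (0 , 0) would be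
    -- identified with (4 d + 1 , 0), hence with (1 , 0).
    polys-translate : ∀ d y → (+ 4 * d + 1ℤ) * y ≡[ + 32 * K ] 1ℤ → H (+ 4 * d) → ∀ i j w → poly i j ∼ poly (i + + 4 * d * w) j
    polys-translate d y unit h i j w = ∼-resp (poly≈ (≡⇒≡[] (origin K e i j)) (≡⇒≡[] (origin′ e j)))
        -- The rotation that produces the index j corrects 4 d w by 8 K j (4 d w), and the factor 4
        -- makes this a multiple of 32 K.
        (poly≈ (by (d * w * j) (far′ K e i j d w (T (w * (+ 4 * d))))) (≡⇒≡[] (far″ e j (w * (+ 4 * d)))))
        (shift-invariant i (rotate 0ℤ j (poly 0ℤ 0ℤ)) (rotate 0ℤ j (poly (w * (+ 4 * d)) 0ℤ))
          (rotate-invariant 0ℤ j (poly 0ℤ 0ℤ) (poly (w * (+ 4 * d)) 0ℤ) (G-* (+ 4 * d) base w)))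
      where
      origin : ∀ K e i j → 0ℤ + + 8 * K * (e * 0ℤ * 0ℤ + j * 0ℤ) + i ≡ i
      origin = solve-∀
      origin′ : ∀ e j → 0ℤ + e * 0ℤ * 0ℤ + j ≡ j
      origin′ = solve-∀
      far′ : ∀ K e i j d w t → w * (+ 4 * d) + + 8 * K * (e * 0ℤ * t + j * (w * (+ 4 * d))) + i ≡ i + + 4 * d * w + d * w * j * (+ 32 * K)
      far′ = solve-∀
      far″ : ∀ e j x → 0ℤ + e * 0ℤ * x + j ≡ j
      far″ = solve-∀
      G : ℤ → Set
      G x = poly 0ℤ 0ℤ ∼ poly x 0ℤ
      G-* : ∀ x → G x → ∀ q → G (q * x)
      G-* x g = ℤ-induction (λ q → G (q * x)) (∼-resp ≈-refl (poly≈ (≡⇒≡[] (≡.sym (ℤ.*-zeroˡ x))) mod-refl) Q.Eq.refl)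
        (λ q g′ → ∼-resp ≈-refl (poly≈ (≡⇒≡[] (up q x)) mod-refl)
          (Q.Eq.trans g′ (∼-resp (poly≈ (≡⇒≡[] (ℤ.+-identityˡ (q * x))) mod-refl) ≈-refl (shift-invariant (q * x) (poly 0ℤ 0ℤ) (poly x 0ℤ) g))))
        (λ q g′ → Q.Eq.trans g′ (∼-resp (poly≈ (≡⇒≡[] (up q x)) mod-refl) (poly≈ (≡⇒≡[] (ℤ.+-identityˡ (q * x))) mod-refl)
          (Q.Eq.sym (shift-invariant (q * x) (poly 0ℤ 0ℤ) (poly x 0ℤ) g))))
        where
        up : ∀ q x → x + q * x ≡ (q + 1ℤ) * x
        up = solve-∀
      zero′ : ∀ e x → 0ℤ ≡ e * 0ℤ * x + 0ℤ
      zero′ = solve-∀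
      last : ∀ K e → 0ℤ - 1ℤ - + 8 * K * (e * 0ℤ * (0ℤ - 1ℤ) + 0ℤ) + 1ℤ ≡ 0ℤ
      last = solve-∀
      p₋ : ℤ
      p₋ = previous 0ℤ 0ℤ 0ℤ
      base : G (+ 4 * d)
      base = [ collapsing , (λ q → ∼-resp (poly≈ mod-refl (≡⇒≡[] (≡.sym (zero′ e 0ℤ)))) ≈-refl (Q.Eq.sym q)) ]′
        (between-edge-facet 0ℤ 0ℤ 0ℤ (poly (+ 4 * d) 0ℤ) (π-strict (edge⋖poly (≡⇒≡[] (zero′ e (+ 4 * d)))))
          (QP.≺-respʳ (Q.Eq.sym h) (π-strict (poly⋖facet (inj₁ mod-refl)))))
        where
        -- Translation by 1 identifies (0 , 0) with (4 d + 1 , 0). Repeating this y times, y being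
        -- the inverse of 4 d + 1, identifies it with (1 , 0), which is next to it around the edge
        -- (0 , 0).
        collapsing : poly (+ 4 * d) 0ℤ ∼ poly p₋ (e * 0ℤ * p₋ + 0ℤ) → G (+ 4 * d)
        collapsing q = contradiction
          (∼-resp (poly≈ mod-refl (≡⇒≡[] (zero′ e 0ℤ))) (poly≈ (mod-trans (≡⇒≡[] (ℤ.*-comm y (+ 4 * d + 1ℤ))) unit) (≡⇒≡[] (zero′ e 1ℤ)))
            (G-* (+ 4 * d + 1ℤ) (∼-resp (poly≈ (≡⇒≡[] (last K e)) (≡⇒≡[] (≡.sym (zero′ e p₋)))) ≈-refl
              (shift-invariant 1ℤ (poly p₋ (e * 0ℤ * p₋ + 0ℤ)) (poly (+ 4 * d) 0ℤ) (Q.Eq.sym q))) y))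
          (polys-apart 0ℤ 0ℤ 0ℤ 1ℤ (≡⇒≡[] (solve (K ∷ e ∷ []))))

    rank-π : ∀ F → toℕ (Q.rank (π₀ F)) ≡ toℕ (rank F)
    rank-π F = ≡.cong toℕ (π.rank-preserving F)

    π-≺ : ∀ F G → π₀ F Q.≤ π₀ G → toℕ (rank F) ℕ.< toℕ (rank G) → π₀ F Q.< π₀ G
    π-≺ F G le lt = QP.≼∧rank<⇒≺ le (≡.subst₂ ℕ._<_ (≡.sym (rank-π F)) (≡.sym (rank-π G)) lt)

    -- Monotonicity of ranks alone would only refute that the images differ. Both lie in the diamond
    -- between the images of L and U, whose two faces make the identification constructive.
    same-rank : ∀ {L U} F G → L ⋖ F → G ⋖ U → toℕ (rank F) ≡ toℕ (rank G) → π₀ F Q.≤ π₀ G → F ∼ G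
    same-rank {L} {U} F G LF GU eq le with Q.diamond
        (π-≺ L U (Q.trans (proj₁ (π-strict LF)) (Q.trans le (proj₁ (π-strict GU)))) (≡.subst (toℕ (rank L) ℕ.<_) (≡.sym U≡) (ℕ.n≤1+n _)))
        (≡.trans (rank-π U) (≡.trans U≡ (≡.cong (2 ℕ.+_) (≡.sym (rank-π L)))))
      where
      U≡ : toℕ (rank U) ≡ 2 ℕ.+ toℕ (rank L)
      U≡ = ≡.trans (rank-⋖ GU) (≡.cong suc (≡.trans (≡.sym eq) (rank-⋖ LF)))
    ... | H₁ , H₂ , H₁≉H₂ , _ , _ , only with
          only (π₀ F) (π-strict LF) (π-≺ F U (Q.trans le (proj₁ (π-strict GU))) (ℕ.≤-trans (s≤s (ℕ.≤-reflexive eq)) (ℕ.≤-reflexive (≡.sym (rank-⋖ GU)))))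
        | only (π₀ G) (π-≺ L G (Q.trans (proj₁ (π-strict LF)) le) (ℕ.≤-trans (ℕ.≤-reflexive (≡.sym (rank-⋖ LF))) (ℕ.≤-reflexive eq))) (π-strict GU)
    ...   | inj₁ a | inj₁ b = Q.Eq.trans a (Q.Eq.sym b)
    ...   | inj₂ a | inj₂ b = Q.Eq.trans a (Q.Eq.sym b)
    ...   | inj₁ a | inj₂ b = contradiction (Q.rank-mono (le , λ p → H₁≉H₂ (Q.Eq.trans (Q.Eq.sym a) (Q.Eq.trans p b))))
              (ℕ.<-irrefl (≡.trans (rank-π F) (≡.trans eq (≡.sym (rank-π G)))))
    ...   | inj₂ a | inj₁ b = contradiction (Q.rank-mono (le , λ p → H₁≉H₂ (Q.Eq.trans (Q.Eq.sym b) (Q.Eq.trans (Q.Eq.sym p) a))))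
              (ℕ.<-irrefl (≡.trans (rank-π F) (≡.trans eq (≡.sym (rank-π G)))))

    -- Lifting order relations from the quotient

    record Lifted (F G : Face) : Set where
      constructor through
      field
        F′ G′ : Face
        F∼F′  : F ∼ F′
        F′≼G′ : F′ ≼ G′
        G′∼G  : G′ ∼ G

    lift-equal : ∀ F G → rank F ≡ rank G → π₀ F Q.≤ π₀ G → F ∼ G
    lift-equal bot        bot          _ le = Q.Eq.refl
    lift-equal (vert v)   (vert v′)    _ le = same-rank (vert v) (vert v′) bot⋖vert (vert⋖edge {m = 0ℤ} (inj₁ mod-refl)) refl le
    lift-equal (edge s m) (edge s′ m′) _ le = same-rank (edge s m) (edge s′ m′) (vert⋖edge (inj₁ mod-refl)) (edge⋖poly {i = 0ℤ} mod-refl) refl le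
    lift-equal (poly i j) (poly i′ j′) _ le = same-rank (poly i j) (poly i′ j′) (edge⋖poly {s = 0ℤ} {m = j} (≡⇒≡[] (solve (e ∷ i ∷ j ∷ [])))) (poly⋖facet (inj₁ mod-refl)) refl le
    lift-equal (facet c)  (facet c′)   _ le = same-rank (facet c) (facet c′) (poly⋖facet {j = 0ℤ} (inj₁ mod-refl)) facet⋖top refl le
    lift-equal top        top          _ le = Q.Eq.refl

    lift-cover : ∀ F G → toℕ (rank G) ≡ suc (toℕ (rank F)) → π₀ F Q.≤ π₀ G → Lifted F G
    lift-cover bot (vert v) _ le = through bot (vert v) Q.Eq.refl (cover bot⋖vert) Q.Eq.refl
    lift-cover (vert v) (edge s m) _ le =
      [ (λ p → through (vert s) (edge s m) p (cover (vert⋖edge (inj₁ mod-refl))) Q.Eq.refl)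
      , (λ p → through (vert (s + 1ℤ)) (edge s m) p (cover (vert⋖edge (inj₂ mod-refl))) Q.Eq.refl) ]′
      (squeeze {bot} {edge s m} {vert s} {vert (s + 1ℤ)} (vert v) bot⋖vert (vert⋖edge (inj₁ mod-refl))
        bot⋖vert (vert⋖edge (inj₂ mod-refl)) (verts-apart s) (π-strict bot⋖vert) (π-≺ (vert v) (edge s m) le (s≤s (s≤s z≤n))))
    lift-cover (edge s m) (poly i j) _ le =
      [ (λ p → through (edge s (j - e * s * i)) (poly i j) p (cover (edge⋖poly (at s))) Q.Eq.refl)
      , (λ p → through (edge (s - 1ℤ) (j - e * (s - 1ℤ) * i)) (poly i j) p (cover (edge⋖poly (at (s - 1ℤ)))) Q.Eq.refl) ]′
      (squeeze {vert s} {poly i j} {edge s (j - e * s * i)} {edge (s - 1ℤ) (j - e * (s - 1ℤ) * i)} (edge s m)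
        (vert⋖edge (inj₁ mod-refl)) (edge⋖poly (at s)) (vert⋖edge (inj₂ (≡⇒≡[] (predecessor s)))) (edge⋖poly (at (s - 1ℤ)))
        (λ p → edges-apart (s - 1ℤ) (j - e * (s - 1ℤ) * i) s (j - e * s * i) i (≡⇒≡[] (predecessor s))
          (mod-trans (mod-sym (at (s - 1ℤ))) (at s)) (Q.Eq.sym p))
        (π-strict (vert⋖edge (inj₁ mod-refl))) (π-≺ (edge s m) (poly i j) le (s≤s (s≤s (s≤s z≤n)))))
      where
      at : ∀ s → j ≡[ + 4 ] e * s * i + (j - e * s * i)
      at s = ≡⇒≡[] (remainder j (e * s * i))
    lift-cover (poly i j) (facet c) _ le =
      [ (λ p → through (poly i j) (facet i) Q.Eq.refl (cover (poly⋖facet (inj₁ mod-refl))) (Q.Eq.sym p))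
      , (λ p → through (poly i j) (facet (i + 1ℤ + + 8 * K * j)) Q.Eq.refl (cover (poly⋖facet (inj₂ mod-refl))) (Q.Eq.sym p)) ]′
      (squeeze {poly i j} {top} {facet i} {facet (i + 1ℤ + + 8 * K * j)} (facet c)
        (poly⋖facet (inj₁ mod-refl)) facet⋖top (poly⋖facet (inj₂ mod-refl)) facet⋖top (facets-apart i j)
        (π-≺ (poly i j) (facet c) le (s≤s (s≤s (s≤s (s≤s z≤n))))) (π-strict facet⋖top))
    lift-cover (facet c) top _ le = through (facet c) top Q.Eq.refl (cover facet⋖top) Q.Eq.refl

    -- Faces at least two ranks apart are already incident in P; representatives have to be changed
    -- only for consecutive ranks, where a diamond of P offers two candidates.
    lift : ∀ F G → π₀ F Q.≤ π₀ G → Lifted F G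
    lift F G le with ℕ.<-cmp (toℕ (rank F)) (toℕ (rank G))
    ... | tri≈ _ eq _ = through F F Q.Eq.refl (equal ≈-refl) (lift-equal F G (Fin.toℕ-injective eq) le)
    ... | tri> _ _ gt = contradiction (Q.rank-mono (le , λ p → ℕ.<⇒≢ gt (≡.cong toℕ (≡.sym (∼-rank F G p)))))
      (ℕ.<-asym (≡.subst₂ ℕ._<_ (≡.sym (rank-π G)) (≡.sym (rank-π F)) gt))
    ... | tri< lt _ _ with ℕ.m≤n⇒m<n∨m≡n lt
    ...   | inj₁ d  = through F G Q.Eq.refl (far d) Q.Eq.refl
    ...   | inj₂ eq = lift-cover F G (≡.sym eq) le

    -- The reflection of the quotient

    module Reflection (h₁₆ : H (+ 16 * K)) where

      translate₁₆ : ∀ i j w → poly i j ∼ poly (i + + 16 * K * w) j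
      translate₁₆ i j w = ∼-resp ≈-refl (poly≈ (≡⇒≡[] (regroup K i w)) mod-refl)
        -- 16 K + 1 is its own inverse modulo 32 K: its square is 1 + (8 K + 1) 32 K.
        (polys-translate (+ 4 * K) (+ 16 * K + 1ℤ) (by (+ 8 * K + 1ℤ) (solve (K ∷ []))) (H-resp (≡⇒≡[] (sixteen K)) h₁₆) i j w)
        where
        regroup : ∀ K i w → i + + 4 * (+ 4 * K) * w ≡ i + + 16 * K * w
        regroup = solve-∀
        sixteen : ∀ K → + 16 * K ≡ + 4 * (+ 4 * K)
        sixteen = solve-∀

      translate₈ : H (+ 8 * K) → ∀ i j w → poly i j ∼ poly (i + + 8 * K * w) j
      translate₈ h₈ i j w = ∼-resp ≈-refl (poly≈ (≡⇒≡[] (regroup K i w)) mod-refl)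
        (polys-translate (+ 2 * K) (1ℤ - + 8 * K) (by (- (+ 2 * K)) (solve (K ∷ []))) (H-resp (≡⇒≡[] (eight K)) h₈) i j w)
        where
        regroup : ∀ K i w → i + + 4 * (+ 2 * K) * w ≡ i + + 8 * K * w
        regroup = solve-∀
        eight : ∀ K → + 8 * K ≡ + 4 * (+ 2 * K)
        eight = solve-∀

      -- In the straight case H contains 8 K times the odd number j′ - j, and odd squares are 1
      -- modulo 4. In the crossed case it would contain 2 + 8 K x for x = j + j′, hence 2, since (1
      -- - 4 K x) (2 + 8 K x) ≡ 2, and also an odd number, because i + i′ is even; so it would
      -- contain 1.
      H₈ : ∀ i j i′ j′ q p → j + j′ ≡ 1ℤ + q * + 2 → 1ℤ + i + i′ ≡ 1ℤ + p * + 2 → poly i j ∼ poly i′ j′ → H (+ 8 * K)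
      H₈ i j i′ j′ q p odd-j even-i r = [ straight , crossed ]′ (polys-facets i j i′ j′ r)
        where
        d = i′ + 1ℤ + + 8 * K * j′ - (i + 1ℤ + + 8 * K * j) - (i′ - i)
        expand : ∀ K i i′ j j′ → i′ + 1ℤ + + 8 * K * j′ - (i + 1ℤ + + 8 * K * j) - (i′ - i) ≡ + 8 * K * (j + j′ - + 2 * j)
        expand = solve-∀
        d≡ : d ≡ + 8 * K * (+ 2 * (q - j) + 1ℤ)
        d≡ = ≡.trans (expand K i i′ j j′) (≡.trans (≡.cong (λ x → + 8 * K * (x - + 2 * j)) odd-j) (solve (K ∷ j ∷ q ∷ [])))
        square : ∀ K x → (+ 2 * x + 1ℤ) * (+ 8 * K * (+ 2 * x + 1ℤ)) ≡ + 8 * K + (x * x + x) * (+ 32 * K)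
        square = solve-∀
        straight : facet i ∼ facet i′ × facet (i + 1ℤ + + 8 * K * j) ∼ facet (i′ + 1ℤ + + 8 * K * j′) → H (+ 8 * K)
        straight (r₁ , r₂) = H-resp (≡.subst (λ x → (+ 2 * (q - j) + 1ℤ) * x ≡[ + 32 * K ] + 8 * K) (≡.sym d≡) (by ((q - j) * (q - j) + (q - j)) (square K (q - j))))
          (H-* d (H-- (i′ - i) (i′ + 1ℤ + + 8 * K * j′ - (i + 1ℤ + + 8 * K * j)) (H-difference i i′ r₁)
            (H-difference (i + 1ℤ + + 8 * K * j) (i′ + 1ℤ + + 8 * K * j′) r₂)) (+ 2 * (q - j) + 1ℤ))
        two : ∀ K x → (1ℤ - + 4 * K * x) * (+ 2 + + 8 * K * x) ≡ + 2 + - (K * x * x) * (+ 32 * K)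
        two = solve-∀
        expand′ : ∀ K i i′ j′ p → i′ + 1ℤ + + 8 * K * j′ - i - (p - i + + 4 * K * j′) * + 2 ≡ 1ℤ + i + i′ - p * + 2
        expand′ = solve-∀
        odd-facet : i′ + 1ℤ + + 8 * K * j′ - i - (p - i + + 4 * K * j′) * + 2 ≡ 1ℤ
        odd-facet = ≡.trans (expand′ K i i′ j′ p) (≡.trans (≡.cong (_- p * + 2) even-i) (solve (p ∷ [])))
        crossed : facet i ∼ facet (i′ + 1ℤ + + 8 * K * j′) × facet (i + 1ℤ + + 8 * K * j) ∼ facet i′ → H (+ 8 * K)
        crossed (r₁ , r₂) = contradiction (H-resp (≡⇒≡[] odd-facet) (H-- ((p - i + + 4 * K * j′) * + 2) (i′ + 1ℤ + + 8 * K * j′ - i)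
            (H-* (+ 2) H2 (p - i + + 4 * K * j′)) (H-difference i (i′ + 1ℤ + + 8 * K * j′) r₁))) ¬H1
          where
          H2 : H (+ 2)
          H2 = H-resp (by (- (K * (j + j′) * (j + j′))) (two K (j + j′))) (H-* (+ 2 + + 8 * K * (j + j′)) (H-sum i j i′ j′ r₁ r₂) (1ℤ - + 4 * K * (j + j′)))

      -- A rotation that takes poly i j to poly i′ (- j′) takes poly i′ j′ to poly i (- j), up to a translation by
      -- a multiple of 8 K.
      reflect-polys : ∀ i j i′ j′ → poly i j ∼ poly i′ j′ → poly i (- j) ∼ poly i′ (- j′)
      reflect-polys i j i′ j′ r = Q.Eq.sym (Q.Eq.trans swapped (Q.Eq.sym (correct (parity (j + j′)) (parity (1ℤ + i + i′)) refl refl)))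
        where
        -- The indices j ↦ - j′ and j′ ↦ - j determine u. Then a is chosen so that i goes to i′
        -- modulo 32 K, and 8 K W is the amount by which the image of i′ misses i.
        u = - (j + j′)
        a = i + i′ + 1ℤ + + 8 * K * (j + i′ * (j + j′))
        W = j - j′ + (i′ - i) * (j + j′)
        g : Face → Face
        g F = rotate 0ℤ u (shift a (turn F))
        image-i : ∀ K e i j i′ j′ t → let x = - i - 1ℤ - + 8 * K * j + (i + i′ + 1ℤ + + 8 * K * (j + i′ * (j + j′))) in
          x + + 8 * K * (e * 0ℤ * t + - (j + j′) * x) ≡ i′ + - (+ 2 * K * i′ * (j + j′) * (j + j′)) * (+ 32 * K)
        image-i = solve-∀
        image-j : ∀ e j j′ x → j + e * 0ℤ * x + - (j + j′) ≡ - j′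
        image-j = solve-∀
        image-i′ : ∀ K e i j i′ j′ t → let x = - i′ - 1ℤ - + 8 * K * j′ + (i + i′ + 1ℤ + + 8 * K * (j + i′ * (j + j′))) in
          x + + 8 * K * (e * 0ℤ * t + - (j + j′) * x) ≡ i + + 8 * K * (j - j′ + (i′ - i) * (j + j′))
            + - (+ 2 * K * (j + j′) * (j - j′ + i′ * (j + j′))) * (+ 32 * K)
        image-i′ = solve-∀
        image-j′ : ∀ e j j′ x → j′ + e * 0ℤ * x + - (j + j′) ≡ - j
        image-j′ = solve-∀
        x₁ = - i - 1ℤ - + 8 * K * j + a
        x₂ = - i′ - 1ℤ - + 8 * K * j′ + a
        swapped : poly i′ (- j′) ∼ poly (i + + 8 * K * W) (- j)
        swapped = ∼-resp
          (poly≈ (by (- (+ 2 * K * i′ * (j + j′) * (j + j′))) (image-i K e i j i′ j′ (T x₁))) (≡⇒≡[] (image-j e j j′ x₁)))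
          (poly≈ (by (- (+ 2 * K * (j + j′) * (j - j′ + i′ * (j + j′)))) (image-i′ K e i j i′ j′ (T x₂))) (≡⇒≡[] (image-j′ e j j′ x₂)))
          (rotate-invariant 0ℤ u (shift a (turn (poly i j))) (shift a (turn (poly i′ j′)))
            (shift-invariant a (turn (poly i j)) (turn (poly i′ j′)) (turn-invariant (poly i j) (poly i′ j′) r)))
        -- Modulo 2, W is (j + j′) (1 + i + i′). If this is even, 8 K W is a multiple of 16 K; if
        -- both factors are odd, the given identification of polygons supplies `H (+ 8 * K)` by
        -- `H₈`.
        W≡ : ∀ i i′ j j′ → j - j′ + (i′ - i) * (j + j′) ≡ (j + j′) * (1ℤ + i + i′) - + 2 * (j′ + i * (j + j′))
        W≡ = solve-∀
        halved : ∀ K q x → + 8 * K * (q * + 2 - + 2 * x) ≡ + 16 * K * (q - x)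
        halved = solve-∀
        from-even : ∀ q → (j + j′) * (1ℤ + i + i′) ≡ q * + 2 → poly i (- j) ∼ poly (i + + 8 * K * W) (- j)
        from-even q eq = ∼-resp ≈-refl (poly≈ (≡⇒≡[] (≡.cong (λ x → i + x) (≡.sym (≡.trans
            (≡.cong (λ x → + 8 * K * x) (≡.trans (W≡ i i′ j j′) (≡.cong (_- + 2 * (j′ + i * (j + j′))) eq)))
            (halved K q (j′ + i * (j + j′))))))) mod-refl)
          (translate₁₆ i (- j) (q - (j′ + i * (j + j′))))
        swap-two : ∀ x q → x * (q * + 2) ≡ x * q * + 2
        swap-two = solve-∀
        swap-two′ : ∀ x q → q * + 2 * x ≡ q * x * + 2
        swap-two′ = solve-∀
        correct : ∀ {x y} → Parity x → Parity y → x ≡ j + j′ → y ≡ 1ℤ + i + i′ → poly i (- j) ∼ poly (i + + 8 * K * W) (- j)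
        correct (even q) _        eq eq′ = from-even (q * (1ℤ + i + i′)) (≡.trans (≡.cong (_* (1ℤ + i + i′)) (≡.sym eq)) (swap-two′ (1ℤ + i + i′) q))
        correct (odd _)  (even q) eq eq′ = from-even ((j + j′) * q) (≡.trans (≡.cong (λ x → (j + j′) * x) (≡.sym eq′)) (swap-two (j + j′) q))
        correct (odd q)  (odd p)  eq eq′ = translate₈ (H₈ i j i′ j′ q p (≡.sym eq) (≡.sym eq′) r) i (- j) W

      -- ρ preserves all incidences of P but those of polygons with facets, where i + 1 + 8 K j and i + 1 - 8 K j
      -- differ by a multiple of 16 K.
      ρ : Face → Face
      ρ bot        = bot
      ρ (vert v)   = vert (1ℤ - v)
      ρ (edge s m) = edge (- s) (- m)
      ρ (poly i j) = poly i (- j)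
      ρ (facet c)  = facet c
      ρ top        = top

      rank-ρ : ∀ F → rank (ρ F) ≡ rank F
      rank-ρ bot        = refl
      rank-ρ (vert _)   = refl
      rank-ρ (edge _ _) = refl
      rank-ρ (poly _ _) = refl
      rank-ρ (facet _)  = refl
      rank-ρ top        = refl

      ρ-cong : ∀ {F G} → F ≈ G → ρ F ≈ ρ G
      ρ-cong bot≈        = bot≈
      ρ-cong (vert≈ p)   = vert≈ (mod-+ (mod-refl {a = 1ℤ}) (mod-neg p))
      ρ-cong (edge≈ p q) = edge≈ (mod-neg p) (mod-neg q)
      ρ-cong (poly≈ p q) = poly≈ p (mod-neg q)
      ρ-cong (facet≈ p)  = facet≈ p
      ρ-cong top≈        = top≈

      ρ-involutive : ∀ F → ρ (ρ F) ≈ F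
      ρ-involutive bot        = bot≈
      ρ-involutive (vert v)   = turn-involutive (vert v)
      ρ-involutive (edge s m) = edge≈ (≡⇒≡[] (ℤ.neg-involutive s)) (≡⇒≡[] (ℤ.neg-involutive m))
      ρ-involutive (poly i j) = poly≈ mod-refl (≡⇒≡[] (ℤ.neg-involutive j))
      ρ-involutive (facet c)  = ≈-refl
      ρ-involutive top        = top≈

      ρ-invariant : Invariant ρ
      ρ-invariant F G p = go F G (∼-rank F G p) p
        where
        far-end : ∀ s s′ → s + - (s + s′) ≡ - s′
        far-end = solve-∀
        near-end : ∀ s s′ → s′ + - (s + s′) ≡ - s
        near-end = solve-∀
        go : ∀ F G → rank F ≡ rank G → F ∼ G → ρ F ∼ ρ G
        go bot        bot          _ p = p
        go (vert v)   (vert v′)    _ p = turn-invariant (vert v) (vert v′) p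
        -- The rotation by - (s + s′) and - (m + m′) takes each of the two edges to the reflection
        -- of the other.
        go (edge s m) (edge s′ m′) _ p = Q.Eq.sym (∼-resp
          (edge≈ (≡⇒≡[] (far-end s s′)) (≡⇒≡[] (far-end m m′))) (edge≈ (≡⇒≡[] (near-end s s′)) (≡⇒≡[] (near-end m m′)))
          (rotate-invariant (- (s + s′)) (- (m + m′)) (edge s m) (edge s′ m′) p))
        go (poly i j) (poly i′ j′) _ p = reflect-polys i j i′ j′ p
        go (facet c)  (facet c′)   _ p = p
        go top        top          _ p = p

      πρ-mono : ∀ {F G} → F ≼ G → π₀ (ρ F) Q.≤ π₀ (ρ G)
      πρ-mono (equal p) = Q.reflexive (π.cong (ρ-cong p))
      πρ-mono {F} {G} (far d) = π.mono (far (≡.subst₂ (λ x y → 2 ℕ.+ toℕ x ℕ.≤ toℕ y) (≡.sym (rank-ρ F)) (≡.sym (rank-ρ G)) d))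
      πρ-mono (cover bot⋖vert) = π.mono (cover bot⋖vert)
      πρ-mono (cover facet⋖top) = π.mono (cover facet⋖top)
      πρ-mono (cover (vert⋖edge {s = s} (inj₁ p))) = π.mono (cover (vert⋖edge (inj₂ (mod-trans (mod-+ (mod-refl {a = 1ℤ}) (mod-neg p)) (≡⇒≡[] (ℤ.+-comm 1ℤ (- s)))))))
      πρ-mono (cover (vert⋖edge {s = s} (inj₂ p))) = π.mono (cover (vert⋖edge (inj₁ (mod-trans (mod-+ (mod-refl {a = 1ℤ}) (mod-neg p)) (≡⇒≡[] (flip s))))))
        where
        flip : ∀ s → 1ℤ - (s + 1ℤ) ≡ - s
        flip = solve-∀
      πρ-mono (cover (edge⋖poly {s} {m} {i} p)) = π.mono (cover (edge⋖poly (mod-trans (mod-neg p) (≡⇒≡[] (flip e s i m)))))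
        where
        flip : ∀ e s i m → - (e * s * i + m) ≡ e * - s * i + - m
        flip = solve-∀
      πρ-mono (cover (poly⋖facet (inj₁ p))) = π.mono (cover (poly⋖facet (inj₁ p)))
      πρ-mono (cover (poly⋖facet {i} {j} {c} (inj₂ p))) = Q.trans (π.mono (cover (poly⋖facet {c = i + 1ℤ + + 8 * K * - j} (inj₂ mod-refl))))
        (Q.reflexive (∼-resp ≈-refl (facet≈ (mod-trans (≡⇒≡[] (regroup K i j)) (mod-sym p)))
          (H-translate (i + 1ℤ + + 8 * K * - j) (j * (+ 16 * K)) (H-* (+ 16 * K) h₁₆ j))))
        where
        regroup : ∀ K i j → j * (+ 16 * K) + (i + 1ℤ + + 8 * K * - j) ≡ i + 1ℤ + + 8 * K * j
        regroup = solve-∀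

      section-of : Q.Face → Face
      section-of G = proj₁ (π.surjective G)

      π-section : ∀ G → π₀ (section-of G) Q.≈ G
      π-section G = proj₂ (π.surjective G)

      reflect : Q.Face → Q.Face
      reflect G = π₀ (ρ (section-of G))

      reflect-π : ∀ F → reflect (π₀ F) Q.≈ π₀ (ρ F)
      reflect-π F = ρ-invariant (section-of (π₀ F)) F (π-section (π₀ F))

      reflect-cong : ∀ {G G′} → G Q.≈ G′ → reflect G Q.≈ reflect G′
      reflect-cong {G} {G′} p = ρ-invariant (section-of G) (section-of G′)
        (Q.Eq.trans (π-section G) (Q.Eq.trans p (Q.Eq.sym (π-section G′))))

      reflect-involutive : ∀ G → reflect (reflect G) Q.≈ G
      reflect-involutive G = Q.Eq.trans (reflect-π (ρ (section-of G)))
        (Q.Eq.trans (π.cong (ρ-involutive (section-of G))) (π-section G))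

      reflect-mono : ∀ {G G′} → G Q.≤ G′ → reflect G Q.≤ reflect G′
      reflect-mono {G} {G′} le with lift (section-of G) (section-of G′)
        (Q.trans (Q.reflexive (π-section G)) (Q.trans le (Q.reflexive (Q.Eq.sym (π-section G′)))))
      ... | through F F′ p F≼F′ q = Q.trans (Q.reflexive (ρ-invariant (section-of G) F p))
        (Q.trans (πρ-mono F≼F′) (Q.reflexive (ρ-invariant F′ (section-of G′) q)))

      reflection : PosetIsomorphism Q.poset Q.poset
      reflection = record
        { ⟦_⟧ = reflect
        ; isOrderIsomorphism = record
          { isOrderMonomorphism = record
            { isOrderHomomorphism = record { cong = reflect-cong ; mono = reflect-mono }
            ; injective = λ p → Q.Eq.trans (Q.Eq.sym (reflect-involutive _)) (Q.Eq.trans (reflect-cong p) (reflect-involutive _))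
            ; cancel = λ p → Q.trans (Q.reflexive (Q.Eq.sym (reflect-involutive _)))
                (Q.trans (reflect-mono p) (Q.reflexive (reflect-involutive _)))
            }
          ; surjective = λ G → reflect G , λ p → Q.Eq.trans (reflect-cong p) (reflect-involutive G)
          }
        }

      not-chiral : ⊥
      not-chiral = proj₂ chiral 0F (π.mapFlag Φ₀) (π.mapFlag Φ₁) (π.adjacency-preserving 0F Φ₀ Φ₁ (Φ₀^-adjacent 0F))
        (reflection , λ k → Q.Eq.trans (reflect-π (face Φ₀ k)) (π.cong (swap k)))
        where
        simp : ∀ e → - (e * 0ℤ * 0ℤ + 0ℤ) ≡ e * 0ℤ * 0ℤ + 0ℤ
        simp = solve-∀
        swap : ∀ k → ρ (face Φ₀ k) ≈ face Φ₁ k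
        swap 0F = bot≈
        swap 1F = ≈-refl
        swap 2F = ≈-refl
        swap 3F = poly≈ mod-refl (≡⇒≡[] (simp e))
        swap 4F = ≈-refl
        swap 5F = top≈

    injective : ∀ F G → F ∼ G → F ≈ G
    injective F G p with ≈-dec F G (∼-rank F G p)
    ... | yes q = q
    ... | no ≉ with nontrivial F G p ≉
    ...   | d , d≢0 , h with order-two d d≢0
    ...     | q , qd≡ = ⊥-elim (Reflection.not-chiral (H-resp qd≡ (H-* d h q)))

    isomorphism : PosetIsomorphism poset Q.poset
    isomorphism = record
      { ⟦_⟧ = π₀
      ; isOrderIsomorphism = record
        { isOrderMonomorphism = record
          { isOrderHomomorphism = π.isOrderHomomorphism
          ; injective = λ {F} {G} → injective F G
          ; cancel = λ {F} {G} le → case lift F G le of λ where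
              (through F′ G′ p F′≼G′ q) → ≼-trans (equal (injective F F′ p)) (≼-trans F′≼G′ (equal (injective G′ G q)))
          }
        ; surjective = λ G → proj₁ (π.surjective G) , λ p → Q.Eq.trans (π.cong p) (proj₂ (π.surjective G))
        }
      }

  covers-nothing-properly : ∀ Q → IsTight Q → IsChiral Q → ¬ ProperlyCovers P Q
  covers-nothing-properly Q _ chiral (π , ¬iso) = ¬iso (Kernel.isomorphism Q chiral π)

theorem5p8 : ∀ (β : ℕ) → 5 ≤ β → ∀ (e : ℤ) → e ≡ 1ℤ ⊎ e ≡ -1ℤ →
    Σ[ P ∈ Polytope 4 ]
    IsAtomic P × HasType P 4 8 (2 ℕ.^ β) × IsAutomorphismGroup (Λ₂ β e) gen P
theorem5p8 β (s≤s (s≤s (s≤s (s≤s (s≤s {n = b} z≤n))))) e e≡±1 =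
  Flags.polytope K e e² ,
  ((isTight , Chirality.isChiral K e e²) , Atomicity.covers-nothing-properly K e e² order-two) ,
  hasType ,
  AutomorphismGroupOfP.isAutomorphismGroup β K e e² 2^β (power 3)
  where
  K : ℤ
  K = + (2 ℕ.^ b)

  instance
    K≢0 : ℤ.NonZero K
    K≢0 = ℕ.m^n≢0 2 b

    2^β≢0 : NonZero (2 ℕ.^ β)
    2^β≢0 = ℕ.m^n≢0 2 β

  e² : e * e ≡ 1ℤ
  e² = case e≡±1 of λ { (inj₁ refl) → refl ; (inj₂ refl) → refl }

  power : ∀ k → + (2 ℕ.^ (k ℕ.+ b)) ≡ + (2 ℕ.^ k) * K
  power k = ≡.trans (≡.cong +_ (ℕ.^-distribˡ-+-* 2 k b)) (ℤ.pos-* (2 ℕ.^ k) (2 ℕ.^ b))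

  2^β : + (2 ℕ.^ β) ≡ + 32 * K
  2^β = power 5

  open PolytopeType K e e² (2 ℕ.^ β) 2^β using (hasType; isTight)

  order-two : ∀ d → ¬ d ≡[ + 32 * K ] 0ℤ → ∃[ q ] q * d ≡[ + 32 * K ] + 16 * K
  order-two d d≢0 = ≡.subst₂ (λ n h → ∃[ q ] q * d ≡[ n ] h) 2^β (power 4)
    (multiple-of-order-two (4 ℕ.+ b) d (λ p → d≢0 (≡.subst (λ n → d ≡[ n ] 0ℤ) 2^β p)))
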